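{- Let $f=x^{24}+x+t\in\mathbb{F}_2(t)[x]$. The $24$ roots of $f$ in a splitting field over $\mathbb{F}_2(t)$ form a Steiner system $S(5,8,24)$ whose blocks are the sets of eight distinct roots of $f$ that sum to $0$ (that is, every set of five distinct roots of $f$ is contained in exactly one set of eight distinct roots whose sum is $0$). There are exactly $759$ sets of eight distinct roots of $f$ that sum to $0$.
   Context: A $2$-polynomial over a field $F$ of characteristic $2$ is a polynomial of the form $\sum_{i=0}^n a_i x^{2^i}\in F[x]$, and its $2$-degree is $n$ if $a_n\neq 0$. The minimal $2$-polynomial of a polynomial $f\in F[x]$ without repeated roots is the unique monic $2$-polynomial over $F$ of smallest $2$-degree that is divisible by $f$; its set of roots is the $\mathbb{F}_2$-span of the roots of $f$. Standing facts assumed (established by computer algebra): the polynomial $f=x^{24}+x+t$ is irreducible over $\mathbb{F}_2(t)$; its minimal $2$-polynomial over $\mathbb{F}_2(t)$ is $$L=x^{4096} + (t^{24} + t)x^{2048} + t^{128}x^{1024} + (t^{88} +t^{65})x^{512} + t^{16}x^{32} +t^9x^{16} + (t^{40} + t^{17})x^8 + x^2 + (t^{24} + t)x,$$ which has $2$-degree $12$; and the irreducible factors of $L$ over $\mathbb{F}_2(t)$ have degrees $1, 24, 276, 1771, 2024$. Nothing is assumed about the Galois group of $f$. A Steiner system $S(5,8,24)$ is a set of $24$ points with a collection of $8$-element subsets (blocks) such that every $5$-element subset lies in exactly one block. -}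

module Defs where

open import Level using (Level; _⊔_; 0ℓ) renaming (suc to lsuc)
open import Algebra.Bundles using (CommutativeRing; Semiring)
import Algebra.Definitions.RawSemiring as RawSemiringDefs
open import Algebra.Apartness.Bundles using (HeytingCommutativeRing; HeytingField)
open import Algebra.Morphism.Structures using (module RingMorphisms)
open import Data.Bool.Base using (Bool; true; false; if_then_else_)
import Data.Bool.Properties as Bool
open import Data.Empty using (⊥-elim)
open import Data.Fin.Base using (Fin; toℕ; fromℕ)
open import Data.Fin.Subset using (Subset; ∣_∣; _⊆_)
open import Data.List.Base as List using (List; []; _∷_; length; foldr)
open import Data.List.Membership.Propositional using (_∈_)
open import Data.List.Relation.Binary.Pointwise using (Pointwise)
open import Data.List.Relation.Unary.Unique.Propositional using (Unique)
open import Data.Nat.Base as ℕ using (ℕ; zero; suc)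
open import Data.Product.Base using (Σ; Σ-syntax; ∃; _×_; _,_; proj₁; proj₂)
open import Data.Product using (∃!)
open import Data.Sum.Base as Sum using (_⊎_; inj₁; inj₂)
open import Data.Vec.Base using (lookup)
open import Data.Vec.Functional using (Vector)
open import Function.Base using (_∘_)
open import Function.Bundles using (Bijection; _⇔_)
open import Relation.Binary.Bundles using (Setoid)
open import Relation.Binary.Definitions using (Decidable)
open import Relation.Binary.PropositionalEquality as ≡ using (_≡_)
import Relation.Binary.Construct.On as On
open import Relation.Nullary using (¬_; ¬?; Dec; yes; no)
open import Relation.Unary using (Pred)

private
  variable
    a c c′ ℓ ℓ′ ℓ₁ ℓ₂ ℓ₁′ ℓ₂′ : Level

module Polynomial (R : CommutativeRing c ℓ) where

  open CommutativeRing R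
  open import Algebra.Properties.Ring ring using (-0#≈0#)

  -- Coefficients, constant term first.  Trailing zeros are allowed, hence
  -- the coefficientwise equality below.
  Poly : Set c
  Poly = List Carrier

  coeff : Poly → ℕ → Carrier
  coeff []      _       = 0#
  coeff (x ∷ p) zero    = x
  coeff (x ∷ p) (suc n) = coeff p n

  infix 4 _≈ₚ_
  record _≈ₚ_ (p q : Poly) : Set ℓ where
    constructor coeff-≈
    field at : ∀ n → coeff p n ≈ coeff q n
  open _≈ₚ_ public

  infixl 6 _+ₚ_
  _+ₚ_ : Poly → Poly → Poly
  []      +ₚ q       = q
  (x ∷ p) +ₚ []      = x ∷ p
  (x ∷ p) +ₚ (y ∷ q) = (x + y) ∷ (p +ₚ q)

  scale : Carrier → Poly → Poly
  scale x = List.map (x *_)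

  infixl 7 _*ₚ_
  _*ₚ_ : Poly → Poly → Poly
  []      *ₚ q = []
  (x ∷ p) *ₚ q = scale x q +ₚ (0# ∷ (p *ₚ q))

  -ₚ_ : Poly → Poly
  -ₚ_ = List.map (-_)

  C : Carrier → Poly
  C x = x ∷ []

  X : Poly
  X = 0# ∷ 1# ∷ []

  eval : Poly → Carrier → Carrier
  eval []      x = 0#
  eval (y ∷ p) x = y + x * eval p x

  HasDegree : Poly → ℕ → Set ℓ
  HasDegree p n = coeff p n ≉ 0# × (∀ m → n ℕ.< m → coeff p m ≈ 0#)

  coeff-+ : ∀ p q n → coeff (p +ₚ q) n ≈ coeff p n + coeff q n
  coeff-+ []      q       n       = sym (+-identityˡ _)
  coeff-+ (x ∷ p) []      n       = sym (+-identityʳ _)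
  coeff-+ (x ∷ p) (y ∷ q) zero    = refl
  coeff-+ (x ∷ p) (y ∷ q) (suc n) = coeff-+ p q n

  coeff-scale : ∀ x p n → coeff (scale x p) n ≈ x * coeff p n
  coeff-scale x []      n       = sym (zeroʳ x)
  coeff-scale x (y ∷ p) zero    = refl
  coeff-scale x (y ∷ p) (suc n) = coeff-scale x p n

  coeff-neg : ∀ p n → coeff (-ₚ p) n ≈ - coeff p n
  coeff-neg []      n       = sym -0#≈0#
  coeff-neg (x ∷ p) zero    = refl
  coeff-neg (x ∷ p) (suc n) = coeff-neg p n

  private
    reflₚ : ∀ {p} → p ≈ₚ p
    reflₚ .at n = refl

    symₚ : ∀ {p q} → p ≈ₚ q → q ≈ₚ p
    symₚ e .at n = sym (at e n)

    transₚ : ∀ {p q r} → p ≈ₚ q → q ≈ₚ r → p ≈ₚ r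
    transₚ e f .at n = trans (at e n) (at f n)

    polySetoid : Setoid c ℓ
    polySetoid = record
      { Carrier = Poly
      ; _≈_ = _≈ₚ_
      ; isEquivalence = record { refl = reflₚ ; sym = symₚ ; trans = transₚ }
      }

    open import Relation.Binary.Reasoning.Setoid polySetoid

    +ₚ-cong : ∀ {p p′ q q′} → p ≈ₚ p′ → q ≈ₚ q′ → p +ₚ q ≈ₚ p′ +ₚ q′
    +ₚ-cong {p} {p′} {q} {q′} e f .at n =
      trans (coeff-+ p q n)
        (trans (+-cong (at e n) (at f n)) (sym (coeff-+ p′ q′ n)))

    +ₚ-assoc : ∀ p q r → (p +ₚ q) +ₚ r ≈ₚ p +ₚ (q +ₚ r)
    +ₚ-assoc p q r .at n =
      trans (coeff-+ (p +ₚ q) r n)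
      (trans (+-congʳ (coeff-+ p q n))
      (trans (+-assoc _ _ _)
      (trans (+-congˡ (sym (coeff-+ q r n)))
        (sym (coeff-+ p (q +ₚ r) n)))))

    +ₚ-comm : ∀ p q → p +ₚ q ≈ₚ q +ₚ p
    +ₚ-comm p q .at n =
      trans (coeff-+ p q n) (trans (+-comm _ _) (sym (coeff-+ q p n)))

    +ₚ-identityˡ : ∀ p → [] +ₚ p ≈ₚ p
    +ₚ-identityˡ p = reflₚ

    +ₚ-identityʳ : ∀ p → p +ₚ [] ≈ₚ p
    +ₚ-identityʳ p = transₚ (+ₚ-comm p []) reflₚ

    -ₚ-cong : ∀ {p q} → p ≈ₚ q → -ₚ p ≈ₚ -ₚ q
    -ₚ-cong {p} {q} e .at n =
      trans (coeff-neg p n) (trans (-‿cong (at e n)) (sym (coeff-neg q n)))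

    -ₚ-inverseˡ : ∀ p → -ₚ p +ₚ p ≈ₚ []
    -ₚ-inverseˡ p .at n =
      trans (coeff-+ (-ₚ p) p n)
        (trans (+-congʳ (coeff-neg p n)) (-‿inverseˡ _))

    +ₚ-swap : ∀ p q r → p +ₚ (q +ₚ r) ≈ₚ q +ₚ (p +ₚ r)
    +ₚ-swap p q r = begin
      p +ₚ (q +ₚ r)  ≈⟨ symₚ (+ₚ-assoc p q r) ⟩
      (p +ₚ q) +ₚ r  ≈⟨ +ₚ-cong (+ₚ-comm p q) reflₚ ⟩
      (q +ₚ p) +ₚ r  ≈⟨ +ₚ-assoc q p r ⟩
      q +ₚ (p +ₚ r)  ∎

    +ₚ-medial : ∀ p q r s → (p +ₚ q) +ₚ (r +ₚ s) ≈ₚ (p +ₚ r) +ₚ (q +ₚ s)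
    +ₚ-medial p q r s = begin
      (p +ₚ q) +ₚ (r +ₚ s)  ≈⟨ +ₚ-assoc p q (r +ₚ s) ⟩
      p +ₚ (q +ₚ (r +ₚ s))  ≈⟨ +ₚ-cong {p} reflₚ (+ₚ-swap q r s) ⟩
      p +ₚ (r +ₚ (q +ₚ s))  ≈⟨ symₚ (+ₚ-assoc p r (q +ₚ s)) ⟩
      (p +ₚ r) +ₚ (q +ₚ s)  ∎

    ∷-cong : ∀ {x y p q} → x ≈ y → p ≈ₚ q → (x ∷ p) ≈ₚ (y ∷ q)
    ∷-cong e f .at zero    = e
    ∷-cong e f .at (suc n) = at f n

    0∷0 : (0# ∷ []) ≈ₚ []
    0∷0 .at zero    = refl
    0∷0 .at (suc n) = refl

    shift-+ : ∀ p q → (0# ∷ (p +ₚ q)) ≈ₚ (0# ∷ p) +ₚ (0# ∷ q)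
    shift-+ p q = ∷-cong (sym (+-identityˡ 0#)) reflₚ

    scale-cong : ∀ x {p q} → p ≈ₚ q → scale x p ≈ₚ scale x q
    scale-cong x {p} {q} e .at n =
      trans (coeff-scale x p n)
        (trans (*-congˡ (at e n)) (sym (coeff-scale x q n)))

    scale-+ : ∀ x p q → scale x (p +ₚ q) ≈ₚ scale x p +ₚ scale x q
    scale-+ x p q .at n =
      trans (coeff-scale x (p +ₚ q) n)
      (trans (*-congˡ (coeff-+ p q n))
      (trans (distribˡ _ _ _)
      (trans (sym (+-cong (coeff-scale x p n) (coeff-scale x q n)))
        (sym (coeff-+ (scale x p) (scale x q) n)))))

    scale-+ˡ : ∀ x y p → scale (x + y) p ≈ₚ scale x p +ₚ scale y p
    scale-+ˡ x y p .at n =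
      trans (coeff-scale (x + y) p n)
      (trans (distribʳ _ _ _)
      (trans (sym (+-cong (coeff-scale x p n) (coeff-scale y p n)))
        (sym (coeff-+ (scale x p) (scale y p) n))))

    scale-* : ∀ x y p → scale (x * y) p ≈ₚ scale x (scale y p)
    scale-* x y p .at n =
      trans (coeff-scale (x * y) p n)
      (trans (*-assoc _ _ _)
      (trans (*-congˡ (sym (coeff-scale y p n)))
        (sym (coeff-scale x (scale y p) n))))

    scale-0 : ∀ p → scale 0# p ≈ₚ []
    scale-0 p .at n = trans (coeff-scale 0# p n) (zeroˡ _)

    scale-1 : ∀ p → scale 1# p ≈ₚ p
    scale-1 p .at n = trans (coeff-scale 1# p n) (*-identityˡ _)

    *ₚ-congˡ : ∀ p {q q′} → q ≈ₚ q′ → p *ₚ q ≈ₚ p *ₚ q′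
    *ₚ-congˡ []      e = reflₚ
    *ₚ-congˡ (x ∷ p) e =
      +ₚ-cong (scale-cong x e) (∷-cong refl (*ₚ-congˡ p e))

    *ₚ-distribʳ : ∀ r p q → (p +ₚ q) *ₚ r ≈ₚ p *ₚ r +ₚ q *ₚ r
    *ₚ-distribʳ r []      q       = reflₚ
    *ₚ-distribʳ r (x ∷ p) []      = symₚ (+ₚ-identityʳ _)
    *ₚ-distribʳ r (x ∷ p) (y ∷ q) = begin
      scale (x + y) r +ₚ (0# ∷ ((p +ₚ q) *ₚ r))
        ≈⟨ +ₚ-cong (scale-+ˡ x y r)
             (transₚ (∷-cong refl (*ₚ-distribʳ r p q)) (shift-+ (p *ₚ r) (q *ₚ r))) ⟩
      (scale x r +ₚ scale y r) +ₚ ((0# ∷ (p *ₚ r)) +ₚ (0# ∷ (q *ₚ r)))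
        ≈⟨ +ₚ-medial (scale x r) (scale y r) (0# ∷ (p *ₚ r)) (0# ∷ (q *ₚ r)) ⟩
      (scale x r +ₚ (0# ∷ (p *ₚ r))) +ₚ (scale y r +ₚ (0# ∷ (q *ₚ r))) ∎

    *ₚ-zeroʳ : ∀ p → p *ₚ [] ≈ₚ []
    *ₚ-zeroʳ []      = reflₚ
    *ₚ-zeroʳ (x ∷ p) = transₚ (∷-cong refl (*ₚ-zeroʳ p)) 0∷0

    *ₚ-∷ʳ : ∀ p y q → p *ₚ (y ∷ q) ≈ₚ scale y p +ₚ (0# ∷ (p *ₚ q))
    *ₚ-∷ʳ []      y q = symₚ 0∷0
    *ₚ-∷ʳ (x ∷ p) y q =
      ∷-cong (+-congʳ (*-comm x y)) (begin
        scale x q +ₚ p *ₚ (y ∷ q)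
          ≈⟨ +ₚ-cong reflₚ (*ₚ-∷ʳ p y q) ⟩
        scale x q +ₚ (scale y p +ₚ (0# ∷ (p *ₚ q)))
          ≈⟨ +ₚ-swap (scale x q) (scale y p) _ ⟩
        scale y p +ₚ (scale x q +ₚ (0# ∷ (p *ₚ q))) ∎)

    *ₚ-comm : ∀ p q → p *ₚ q ≈ₚ q *ₚ p
    *ₚ-comm []      q = symₚ (*ₚ-zeroʳ q)
    *ₚ-comm (x ∷ p) q = begin
      scale x q +ₚ (0# ∷ (p *ₚ q))
        ≈⟨ +ₚ-cong reflₚ (∷-cong refl (*ₚ-comm p q)) ⟩
      scale x q +ₚ (0# ∷ (q *ₚ p))  ≈⟨ symₚ (*ₚ-∷ʳ q x p) ⟩
      q *ₚ (x ∷ p)                  ∎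

    *ₚ-cong : ∀ {p p′ q q′} → p ≈ₚ p′ → q ≈ₚ q′ → p *ₚ q ≈ₚ p′ *ₚ q′
    *ₚ-cong {p} {p′} {q} {q′} e f = begin
      p *ₚ q    ≈⟨ *ₚ-congˡ p f ⟩
      p *ₚ q′   ≈⟨ *ₚ-comm p q′ ⟩
      q′ *ₚ p   ≈⟨ *ₚ-congˡ q′ e ⟩
      q′ *ₚ p′  ≈⟨ *ₚ-comm q′ p′ ⟩
      p′ *ₚ q′  ∎

    *ₚ-distribˡ : ∀ p q r → p *ₚ (q +ₚ r) ≈ₚ p *ₚ q +ₚ p *ₚ r
    *ₚ-distribˡ p q r = begin
      p *ₚ (q +ₚ r)     ≈⟨ *ₚ-comm p (q +ₚ r) ⟩
      (q +ₚ r) *ₚ p     ≈⟨ *ₚ-distribʳ p q r ⟩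
      q *ₚ p +ₚ r *ₚ p  ≈⟨ +ₚ-cong (*ₚ-comm q p) (*ₚ-comm r p) ⟩
      p *ₚ q +ₚ p *ₚ r  ∎

    shift-* : ∀ p q → (0# ∷ p) *ₚ q ≈ₚ (0# ∷ (p *ₚ q))
    shift-* p q = +ₚ-cong (scale-0 q) reflₚ

    scale-*ₚ : ∀ x p q → scale x p *ₚ q ≈ₚ scale x (p *ₚ q)
    scale-*ₚ x []      q = reflₚ
    scale-*ₚ x (y ∷ p) q = begin
      scale (x * y) q +ₚ (0# ∷ (scale x p *ₚ q))
        ≈⟨ +ₚ-cong (scale-* x y q)
             (∷-cong (sym (zeroʳ x)) (scale-*ₚ x p q)) ⟩
      scale x (scale y q) +ₚ scale x (0# ∷ (p *ₚ q))
        ≈⟨ symₚ (scale-+ x (scale y q) (0# ∷ (p *ₚ q))) ⟩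
      scale x (scale y q +ₚ (0# ∷ (p *ₚ q))) ∎

    *ₚ-assoc : ∀ p q r → (p *ₚ q) *ₚ r ≈ₚ p *ₚ (q *ₚ r)
    *ₚ-assoc []      q r = reflₚ
    *ₚ-assoc (x ∷ p) q r = begin
      (scale x q +ₚ (0# ∷ (p *ₚ q))) *ₚ r
        ≈⟨ *ₚ-distribʳ r (scale x q) (0# ∷ (p *ₚ q)) ⟩
      scale x q *ₚ r +ₚ (0# ∷ (p *ₚ q)) *ₚ r
        ≈⟨ +ₚ-cong (scale-*ₚ x q r)
             (transₚ (shift-* (p *ₚ q) r) (∷-cong refl (*ₚ-assoc p q r))) ⟩
      scale x (q *ₚ r) +ₚ (0# ∷ (p *ₚ (q *ₚ r))) ∎

    *ₚ-identityˡ : ∀ p → C 1# *ₚ p ≈ₚ p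
    *ₚ-identityˡ p =
      transₚ (+ₚ-cong (scale-1 p) 0∷0) (+ₚ-identityʳ p)

  polynomialRing : CommutativeRing c ℓ
  polynomialRing = record
    { Carrier = Poly
    ; _≈_ = _≈ₚ_
    ; _+_ = _+ₚ_
    ; _*_ = _*ₚ_
    ; -_ = -ₚ_
    ; 0# = []
    ; 1# = C 1#
    ; isCommutativeRing = record
      { isRing = record
        { +-isAbelianGroup = record
          { isGroup = record
            { isMonoid = record
              { isSemigroup = record
                { isMagma = record
                  { isEquivalence = Setoid.isEquivalence polySetoid
                  ; ∙-cong = +ₚ-cong
                  }
                ; assoc = +ₚ-assoc
                }
              ; identity = +ₚ-identityˡ , +ₚ-identityʳ
              }
            ; inverse = -ₚ-inverseˡ
                      , λ p → transₚ (+ₚ-comm p (-ₚ p)) (-ₚ-inverseˡ p)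
            ; ⁻¹-cong = -ₚ-cong
            }
          ; comm = +ₚ-comm
          }
        ; *-cong = *ₚ-cong
        ; *-assoc = *ₚ-assoc
        ; *-identity = *ₚ-identityˡ
                     , λ p → transₚ (*ₚ-comm p (C 1#)) (*ₚ-identityˡ p)
        ; distrib = *ₚ-distribˡ , *ₚ-distribʳ
        }
      ; *-comm = *ₚ-comm
      }
    }

record IntegralDomain c ℓ : Set (lsuc (c ⊔ ℓ)) where
  field
    commutativeRing : CommutativeRing c ℓ
  open CommutativeRing commutativeRing public
  infix 4 _≟_
  field
    _≟_           : Decidable _≈_
    1≉0           : 1# ≉ 0#
    noZeroDivisor : ∀ x y → x * y ≈ 0# → x ≈ 0# ⊎ y ≈ 0#

polynomialDomain : IntegralDomain c ℓ → IntegralDomain c ℓ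
polynomialDomain D = record
  { commutativeRing = polynomialRing
  ; _≟_ = _≟ₚ_
  ; 1≉0 = λ e → 1≉0 (at e 0)
  ; noZeroDivisor = noZeroDivisorₚ
  }
  where
  open IntegralDomain D
  open Polynomial commutativeRing

  ∷-dec : ∀ {x y p q} → Dec (x ≈ y) → Dec (p ≈ₚ q) → Dec ((x ∷ p) ≈ₚ (y ∷ q))
  ∷-dec (no ¬e) _       = no λ e → ¬e (at e 0)
  ∷-dec (yes _) (no ¬f) = no λ e → ¬f (coeff-≈ (at e ∘ suc))
  ∷-dec (yes e) (yes f) = yes (coeff-≈ λ { zero → e ; (suc n) → at f n })

  _≟ₚ[] : ∀ p → Dec (p ≈ₚ [])
  []      ≟ₚ[] = yes (coeff-≈ λ _ → refl)
  (x ∷ p) ≟ₚ[] with ∷-dec (x ≟ 0#) (p ≟ₚ[])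
  ... | yes e = yes (coeff-≈ λ { zero → at e 0 ; (suc n) → at e (suc n) })
  ... | no ¬e = no λ e → ¬e (coeff-≈ λ { zero → at e 0 ; (suc n) → at e (suc n) })

  _≟ₚ_ : Decidable _≈ₚ_
  p       ≟ₚ []      = p ≟ₚ[]
  []      ≟ₚ (y ∷ q) with (y ∷ q) ≟ₚ[]
  ... | yes e = yes (coeff-≈ λ n → sym (at e n))
  ... | no ¬e = no λ e → ¬e (coeff-≈ λ n → sym (at e n))
  (x ∷ p) ≟ₚ (y ∷ q) = ∷-dec (x ≟ y) (p ≟ₚ q)

  ∷-zero : ∀ {x p} → x ≈ 0# → p ≈ₚ [] → (x ∷ p) ≈ₚ []
  ∷-zero e f .at zero    = e
  ∷-zero e f .at (suc n) = at f n

  module P = CommutativeRing polynomialRing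

  ∷-*-cancel : ∀ x p q → x ≈ 0# → (x ∷ p) *ₚ q ≈ₚ [] → p *ₚ q ≈ₚ []
  ∷-*-cancel x p q x≈0 e .at n = begin
    coeff (p *ₚ q) n
      ≈⟨ sym (+-identityˡ _) ⟩
    0# + coeff (p *ₚ q) n
      ≈⟨ +-congʳ (sym (trans (*-congʳ x≈0) (zeroˡ _))) ⟩
    x * coeff q (suc n) + coeff (p *ₚ q) n
      ≈⟨ +-congʳ (sym (coeff-scale x q (suc n))) ⟩
    coeff (scale x q) (suc n) + coeff (p *ₚ q) n
      ≈⟨ sym (coeff-+ (scale x q) (0# ∷ (p *ₚ q)) (suc n)) ⟩
    coeff ((x ∷ p) *ₚ q) (suc n)
      ≈⟨ at e (suc n) ⟩
    0# ∎
    where open import Relation.Binary.Reasoning.Setoid setoid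

  noZeroDivisorₚ : ∀ p q → p *ₚ q ≈ₚ [] → p ≈ₚ [] ⊎ q ≈ₚ []

  step : ∀ x p y q → (x ∷ p) *ₚ (y ∷ q) ≈ₚ [] →
         (p *ₚ (y ∷ q) ≈ₚ [] → p ≈ₚ [] ⊎ (y ∷ q) ≈ₚ []) →
         ((x ∷ p) *ₚ q ≈ₚ [] → (x ∷ p) ≈ₚ [] ⊎ q ≈ₚ []) →
         (x ∷ p) ≈ₚ [] ⊎ (y ∷ q) ≈ₚ []
  step x p y q e recˡ recʳ
    with noZeroDivisor x y (trans (sym (+-identityʳ _)) (at e 0))
  ... | inj₁ x≈0 =
    Sum.map₁ (∷-zero x≈0) (recˡ (∷-*-cancel x p (y ∷ q) x≈0 e))
  ... | inj₂ y≈0 =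
    Sum.map₂ (∷-zero y≈0) (recʳ
      (P.trans (P.*-comm (x ∷ p) q)
        (∷-*-cancel y q (x ∷ p) y≈0 (P.trans (P.*-comm (y ∷ q) (x ∷ p)) e))))

  noZeroDivisorₚ []      q       e = inj₁ P.refl
  noZeroDivisorₚ (x ∷ p) []      e = inj₂ P.refl
  noZeroDivisorₚ (x ∷ p) (y ∷ q) e =
    step x p y q e (noZeroDivisorₚ p (y ∷ q)) (noZeroDivisorₚ (x ∷ p) q)

-- Decidable apartness makes a Heyting field discrete: by tightness equality
-- is decidable, and an element unequal to 0# is invertible.  Classically
-- every field is of this kind.
record Field c ℓ₁ ℓ₂ : Set (lsuc (c ⊔ ℓ₁ ⊔ ℓ₂)) where
  field heytingField : HeytingField c ℓ₁ ℓ₂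
  open HeytingField heytingField using (heytingCommutativeRing)
  open HeytingCommutativeRing heytingCommutativeRing public
    using (commutativeRing; _#_)
  open CommutativeRing commutativeRing public
  infix 4 _#?_
  field _#?_ : Decidable _#_

module FractionField (D : IntegralDomain c ℓ) where

  open IntegralDomain D
  open import Algebra.Properties.Ring ring using (-‿distribˡ-*; -‿distribʳ-*)
  open import Algebra.Properties.AbelianGroup +-abelianGroup
    using (x∙y⁻¹≈ε⇒x≈y)
  open import Algebra.Solver.Ring.NaturalCoefficients.Default commutativeSemiring
    using (solve; _:=_; _:+_; _:*_; con)
  open import Relation.Binary.Reasoning.Setoid setoid

  record Fraction : Set (c ⊔ ℓ) where
    constructor _/_[_]
    field
      num   : Carrier
      den   : Carrier
      den≉0 : den ≉ 0#
  open Fraction public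

  infix 4 _≃_
  record _≃_ (p q : Fraction) : Set ℓ where
    constructor cross
    field cross-≈ : num p * den q ≈ num q * den p
  open _≃_ public

  fromDomain : Carrier → Fraction
  fromDomain x = x / 1# [ 1≉0 ]

  private
    *-≉0 : ∀ {x y} → x ≉ 0# → y ≉ 0# → x * y ≉ 0#
    *-≉0 {x} {y} x≉0 y≉0 e with noZeroDivisor x y e
    ... | inj₁ x≈0 = x≉0 x≈0
    ... | inj₂ y≈0 = y≉0 y≈0

    cancel : ∀ z {x y} → z ≉ 0# → z * x ≈ z * y → x ≈ y
    cancel z {x} {y} z≉0 e with noZeroDivisor z (x - y) (begin
        z * (x - y)        ≈⟨ distribˡ z x (- y) ⟩
        z * x + z * (- y)  ≈⟨ +-cong e (sym (-‿distribʳ-* z y)) ⟩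
        z * y - z * y      ≈⟨ -‿inverseʳ (z * y) ⟩
        0#                 ∎)
    ... | inj₁ z≈0   = ⊥-elim (z≉0 z≈0)
    ... | inj₂ x-y≈0 = x∙y⁻¹≈ε⇒x≈y x y x-y≈0

  infixl 6 _+ᶠ_
  infixl 7 _*ᶠ_

  _+ᶠ_ : Fraction → Fraction → Fraction
  p +ᶠ q = (num p * den q + num q * den p) / (den p * den q)
             [ *-≉0 (den≉0 p) (den≉0 q) ]

  _*ᶠ_ : Fraction → Fraction → Fraction
  p *ᶠ q = (num p * num q) / (den p * den q) [ *-≉0 (den≉0 p) (den≉0 q) ]

  -ᶠ_ : Fraction → Fraction
  -ᶠ p = (- num p) / den p [ den≉0 p ]

  0ᶠ 1ᶠ : Fraction
  0ᶠ = fromDomain 0#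
  1ᶠ = fromDomain 1#

  private
    reflᶠ : ∀ {p} → p ≃ p
    reflᶠ = cross refl

    symᶠ : ∀ {p q} → p ≃ q → q ≃ p
    symᶠ (cross e) = cross (sym e)

    transᶠ : ∀ {p q r} → p ≃ q → q ≃ r → p ≃ r
    transᶠ {p} {q} {r} (cross e) (cross f) = cross (cancel (den q) (den≉0 q) (begin
      den q * (num p * den r)  ≈⟨ solve 3 (λ a b c → a :* (b :* c) := (b :* a) :* c) refl _ _ _ ⟩
      (num p * den q) * den r  ≈⟨ *-congʳ e ⟩
      (num q * den p) * den r  ≈⟨ solve 3 (λ a b c → (a :* b) :* c := (a :* c) :* b) refl _ _ _ ⟩
      (num q * den r) * den p  ≈⟨ *-congʳ f ⟩
      (num r * den q) * den p  ≈⟨ solve 3 (λ a b c → (a :* b) :* c := b :* (a :* c)) refl _ _ _ ⟩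
      den q * (num r * den p)  ∎))

    +ᶠ-cong : ∀ {p p′ q q′} → p ≃ p′ → q ≃ q′ → p +ᶠ q ≃ p′ +ᶠ q′
    +ᶠ-cong {p} {p′} {q} {q′} (cross e) (cross f) = cross (begin
      (num p * den q + num q * den p) * (den p′ * den q′)
        ≈⟨ solve 6 (λ a b c d b′ d′ →
             (a :* d :+ c :* b) :* (b′ :* d′)
               := (a :* b′) :* (d :* d′) :+ (c :* d′) :* (b :* b′))
             refl (num p) (den p) (num q) (den q) (den p′) (den q′) ⟩
      (num p * den p′) * (den q * den q′) + (num q * den q′) * (den p * den p′)
        ≈⟨ +-cong (*-congʳ e) (*-congʳ f) ⟩
      (num p′ * den p) * (den q * den q′) + (num q′ * den q) * (den p * den p′)
        ≈⟨ solve 6 (λ a b c d b′ d′ →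
             (a :* b′) :* (d′ :* d) :+ (c :* d′) :* (b′ :* b)
               := (a :* d :+ c :* b) :* (b′ :* d′))
             refl (num p′) (den p′) (num q′) (den q′) (den p) (den q) ⟩
      (num p′ * den q′ + num q′ * den p′) * (den p * den q) ∎)

    *ᶠ-cong : ∀ {p p′ q q′} → p ≃ p′ → q ≃ q′ → p *ᶠ q ≃ p′ *ᶠ q′
    *ᶠ-cong {p} {p′} {q} {q′} (cross e) (cross f) = cross (begin
      (num p * num q) * (den p′ * den q′)
        ≈⟨ interchange _ _ _ _ ⟩
      (num p * den p′) * (num q * den q′)
        ≈⟨ *-cong e f ⟩
      (num p′ * den p) * (num q′ * den q)
        ≈⟨ interchange _ _ _ _ ⟩
      (num p′ * num q′) * (den p * den q) ∎)
      where
      interchange : ∀ w x y z → (w * x) * (y * z) ≈ (w * y) * (x * z)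
      interchange = solve 4 (λ w x y z →
        (w :* x) :* (y :* z) := (w :* y) :* (x :* z)) refl

    -ᶠ-cong : ∀ {p q} → p ≃ q → -ᶠ p ≃ -ᶠ q
    -ᶠ-cong {p} {q} (cross e) = cross (begin
      (- num p) * den q  ≈⟨ sym (-‿distribˡ-* (num p) (den q)) ⟩
      - (num p * den q)  ≈⟨ -‿cong e ⟩
      - (num q * den p)  ≈⟨ -‿distribˡ-* (num q) (den p) ⟩
      (- num q) * den p  ∎)

    +ᶠ-assoc : ∀ p q r → (p +ᶠ q) +ᶠ r ≃ p +ᶠ (q +ᶠ r)
    +ᶠ-assoc p q r = cross (solve 6 (λ a b c d e f →
      ((a :* d :+ c :* b) :* f :+ e :* (b :* d)) :* (b :* (d :* f))
        := (a :* (d :* f) :+ (c :* f :+ e :* d) :* b) :* ((b :* d) :* f))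
      refl (num p) (den p) (num q) (den q) (num r) (den r))

    +ᶠ-comm : ∀ p q → p +ᶠ q ≃ q +ᶠ p
    +ᶠ-comm p q = cross (solve 4 (λ a b c d →
      (a :* d :+ c :* b) :* (d :* b) := (c :* b :+ a :* d) :* (b :* d))
      refl (num p) (den p) (num q) (den q))

    +ᶠ-identityˡ : ∀ p → 0ᶠ +ᶠ p ≃ p
    +ᶠ-identityˡ p = cross (solve 2 (λ a b →
      (con 0 :* b :+ a :* con 1) :* b := a :* (con 1 :* b))
      refl (num p) (den p))

    -ᶠ-inverseˡ : ∀ p → -ᶠ p +ᶠ p ≃ 0ᶠ
    -ᶠ-inverseˡ p = cross (begin
      ((- num p) * den p + num p * den p) * 1#
        ≈⟨ *-congʳ (+-congʳ (sym (-‿distribˡ-* (num p) (den p)))) ⟩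
      (- (num p * den p) + num p * den p) * 1#
        ≈⟨ *-congʳ (-‿inverseˡ _) ⟩
      0# * 1#               ≈⟨ zeroˡ _ ⟩
      0#                    ≈⟨ sym (zeroˡ _) ⟩
      0# * (den p * den p)  ∎)

    *ᶠ-assoc : ∀ p q r → (p *ᶠ q) *ᶠ r ≃ p *ᶠ (q *ᶠ r)
    *ᶠ-assoc p q r = cross (solve 6 (λ a b c d e f →
      ((a :* c) :* e) :* (b :* (d :* f)) := (a :* (c :* e)) :* ((b :* d) :* f))
      refl (num p) (den p) (num q) (den q) (num r) (den r))

    *ᶠ-comm : ∀ p q → p *ᶠ q ≃ q *ᶠ p
    *ᶠ-comm p q = cross (solve 4 (λ a b c d →
      (a :* c) :* (d :* b) := (c :* a) :* (b :* d))
      refl (num p) (den p) (num q) (den q))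

    *ᶠ-identityˡ : ∀ p → 1ᶠ *ᶠ p ≃ p
    *ᶠ-identityˡ p = cross (solve 2 (λ a b →
      (con 1 :* a) :* b := a :* (con 1 :* b)) refl (num p) (den p))

    *ᶠ-distribˡ : ∀ p q r → p *ᶠ (q +ᶠ r) ≃ p *ᶠ q +ᶠ p *ᶠ r
    *ᶠ-distribˡ p q r = cross (solve 6 (λ a b c d e f →
      (a :* (c :* f :+ e :* d)) :* ((b :* d) :* (b :* f))
        := ((a :* c) :* (b :* f) :+ (a :* e) :* (b :* d)) :* (b :* (d :* f)))
      refl (num p) (den p) (num q) (den q) (num r) (den r))

  fractionRing : CommutativeRing (c ⊔ ℓ) ℓ
  fractionRing = record
    { Carrier = Fraction
    ; _≈_ = _≃_
    ; _+_ = _+ᶠ_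
    ; _*_ = _*ᶠ_
    ; -_ = -ᶠ_
    ; 0# = 0ᶠ
    ; 1# = 1ᶠ
    ; isCommutativeRing = record
      { isRing = record
        { +-isAbelianGroup = record
          { isGroup = record
            { isMonoid = record
              { isSemigroup = record
                { isMagma = record
                  { isEquivalence =
                      record { refl = reflᶠ ; sym = symᶠ ; trans = transᶠ }
                  ; ∙-cong = +ᶠ-cong
                  }
                ; assoc = +ᶠ-assoc
                }
              ; identity = +ᶠ-identityˡ
                         , λ p → transᶠ (+ᶠ-comm p 0ᶠ) (+ᶠ-identityˡ p)
              }
            ; inverse = -ᶠ-inverseˡ
                      , λ p → transᶠ (+ᶠ-comm p (-ᶠ p)) (-ᶠ-inverseˡ p)
            ; ⁻¹-cong = -ᶠ-cong
            }
          ; comm = +ᶠ-comm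
          }
        ; *-cong = *ᶠ-cong
        ; *-assoc = *ᶠ-assoc
        ; *-identity = *ᶠ-identityˡ
                     , λ p → transᶠ (*ᶠ-comm p 1ᶠ) (*ᶠ-identityˡ p)
        ; distrib = *ᶠ-distribˡ
                  , λ p q r → transᶠ (*ᶠ-comm (q +ᶠ r) p)
                      (transᶠ (*ᶠ-distribˡ p q r)
                        (+ᶠ-cong (*ᶠ-comm p q) (*ᶠ-comm p r)))
        }
      ; *-comm = *ᶠ-comm
      }
    }

  infix 4 _≃?_
  _≃?_ : Decidable _≃_
  p ≃? q with (num p * den q) ≟ (num q * den p)
  ... | yes e = yes (cross e)
  ... | no ¬e = no (¬e ∘ cross-≈)

  private
    module Q = CommutativeRing fractionRing
    module QG where
      open import Algebra.Properties.AbelianGroup Q.+-abelianGroup public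

    cotrans : ∀ {p q} → ¬ (p ≃ q) → ∀ r → (¬ (p ≃ r)) ⊎ (¬ (r ≃ q))
    cotrans {p} {q} p≄q r with p ≃? r
    ... | no p≄r  = inj₁ p≄r
    ... | yes p≃r = inj₂ λ r≃q → p≄q (transᶠ p≃r r≃q)

    ≄0⇒num≉0 : ∀ {p} → ¬ (p ≃ 0ᶠ) → num p ≉ 0#
    ≄0⇒num≉0 p≄0 e = p≄0 (cross (trans (trans (*-congʳ e) (zeroˡ _)) (sym (zeroˡ _))))

    inverse : ∀ {p} → ¬ (p ≃ 0ᶠ) → ∃ λ q → q *ᶠ p ≃ 1ᶠ × p *ᶠ q ≃ 1ᶠ
    inverse {p} p≄0 = q , qp≃1 , transᶠ (*ᶠ-comm p q) qp≃1
      where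
      q : Fraction
      q = den p / num p [ ≄0⇒num≉0 p≄0 ]

      qp≃1 : q *ᶠ p ≃ 1ᶠ
      qp≃1 = cross (solve 2 (λ a b →
        (b :* a) :* con 1 := con 1 :* (a :* b)) refl (num p) (den p))

    1≄0 : ¬ (1ᶠ ≃ 0ᶠ)
    1≄0 (cross e) = 1≉0 (trans (sym (*-identityˡ 1#)) (trans e (zeroˡ 1#)))

  fractionField : Field (c ⊔ ℓ) ℓ ℓ
  fractionField = record
    { heytingField = fractionHeytingField
    ; _#?_ = λ p q → ¬? (p ≃? q)
    }
    where
    tight : ∀ p q → ¬ ¬ (p ≃ q) → p ≃ q
    tight p q ¬p≄q with p ≃? q
    ... | yes p≃q = p≃q
    ... | no p≄q  = ⊥-elim (¬p≄q p≄q)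

    fractionHeytingField : HeytingField (c ⊔ ℓ) ℓ ℓ
    fractionHeytingField = record
      { Carrier = Fraction
      ; _≈_ = _≃_
      ; _#_ = λ p q → ¬ (p ≃ q)
      ; _+_ = _+ᶠ_
      ; _*_ = _*ᶠ_
      ; -_ = -ᶠ_
      ; 0# = 0ᶠ
      ; 1# = 1ᶠ
      ; isHeytingField = record
        { isHeytingCommutativeRing = record
          { isCommutativeRing = Q.isCommutativeRing
          ; isApartnessRelation = record
            { irrefl = λ p≃q p≄q → p≄q p≃q
            ; sym = λ p≄q q≃p → p≄q (symᶠ q≃p)
            ; cotrans = cotrans
            }
          ; #⇒invertible = λ {p} {q} p≄q →
              inverse (λ p-q≃0 → p≄q (QG.x∙y⁻¹≈ε⇒x≈y p q p-q≃0))
          ; invertible⇒# = λ {p} {q} (r , r[p-q]≃1 , _) p≃q → 1≄0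
              (transᶠ (symᶠ r[p-q]≃1)
                (transᶠ (Q.*-congˡ {r} (QG.x≈y⇒x∙y⁻¹≈ε p≃q)) (Q.zeroʳ r)))
          }
        ; tight = λ p q → tight p q , λ p≃q p≄q → p≄q p≃q
        }
      }

module Factorization (F : Field c ℓ₁ ℓ₂) where

  open Field F using (commutativeRing)
  open Polynomial commutativeRing
  open CommutativeRing polynomialRing using (1#; semiring)
  open RawSemiringDefs (Semiring.rawSemiring semiring) public
    using (Irreducible)

  HasIrreducibleFactorDegrees : Poly → List ℕ → Set (c ⊔ ℓ₁)
  HasIrreducibleFactorDegrees p ds =
    Σ[ qs ∈ List Poly ]
      p ≈ₚ foldr _*ₚ_ 1# qs ×
      Pointwise (λ q d → Irreducible q × HasDegree q d) qs ds

module TwoPolynomial (F : Field c ℓ₁ ℓ₂) where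

  open Field F using (Carrier; _≈_; 1#; commutativeRing)
  open Polynomial commutativeRing
  open CommutativeRing polynomialRing using (semiring)
  open RawSemiringDefs (Semiring.rawSemiring semiring)
    using (_^_; _∣_; sum)

  twoPolynomial : ∀ {n} → Vector Carrier (suc n) → Poly
  twoPolynomial a = sum λ i → C (a i) *ₚ X ^ (2 ℕ.^ toℕ i)

  IsMonic2Polynomial : Poly → ℕ → Set (c ⊔ ℓ₁)
  IsMonic2Polynomial p n =
    Σ[ a ∈ Vector Carrier (suc n) ] p ≈ₚ twoPolynomial a × a (fromℕ n) ≈ 1#

  record IsMinimal2Polynomial (f p : Poly) (2-degree : ℕ) : Set (c ⊔ ℓ₁) where
    field
      monic   : IsMonic2Polynomial p 2-degree
      divides : f ∣ p
      minimal : ∀ q n → IsMonic2Polynomial q n → f ∣ q → 2-degree ℕ.≤ n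

-- The subfield of K generated by the image of ι and the elements of S.
data Adjoin (F : Field c ℓ₁ ℓ₂) (K : Field c′ ℓ₁′ ℓ₂′)
            (ι : Field.Carrier F → Field.Carrier K)
            (S : Pred (Field.Carrier K) ℓ)
            : Pred (Field.Carrier K) (c ⊔ c′ ⊔ ℓ₁′ ⊔ ℓ) where
  base : ∀ x → Adjoin F K ι S (ι x)
  gen  : ∀ {a} → S a → Adjoin F K ι S a
  resp : ∀ {a b} → Field._≈_ K a b → Adjoin F K ι S a → Adjoin F K ι S b
  add  : ∀ {a b} → Adjoin F K ι S a → Adjoin F K ι S b →
         Adjoin F K ι S (Field._+_ K a b)
  neg  : ∀ {a} → Adjoin F K ι S a → Adjoin F K ι S (Field.-_ K a)
  mul  : ∀ {a b} → Adjoin F K ι S a → Adjoin F K ι S b →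
         Adjoin F K ι S (Field._*_ K a b)
  inv  : ∀ {a b} → Field._≈_ K (Field._*_ K a b) (Field.1# K) →
         Adjoin F K ι S a → Adjoin F K ι S b

record SplittingField (F : Field c ℓ₁ ℓ₂) (K : Field c′ ℓ₁′ ℓ₂′)
                      (f : Polynomial.Poly (Field.commutativeRing F))
                      : Set (c ⊔ ℓ₁ ⊔ c′ ⊔ ℓ₁′) where
  private
    module F = Field F
    module K = Field K
  open Polynomial K.commutativeRing
  open CommutativeRing polynomialRing using (1#; _-_)
  open RingMorphisms F.rawRing K.rawRing using (IsRingHomomorphism)
  field
    embed                : F.Carrier → K.Carrier
    embed-isHomomorphism : IsRingHomomorphism embed

  IsRoot : Pred K.Carrier ℓ₁′
  IsRoot a = eval (List.map embed f) a K.≈ K.0#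

  field
    leading   : K.Carrier
    roots     : List K.Carrier
    splits    : List.map embed f ≈ₚ
                C leading *ₚ foldr (λ r p → (X - C r) *ₚ p) 1# roots
    generated : ∀ a → Adjoin F K embed IsRoot a

  rootSetoid : Setoid (c′ ⊔ ℓ₁′) ℓ₁′
  rootSetoid = record
    { Carrier = Σ K.Carrier IsRoot
    ; isEquivalence = On.isEquivalence proj₁ K.isEquivalence
    }

  RootEnumeration : ℕ → Set (c′ ⊔ ℓ₁′)
  RootEnumeration n = Bijection (≡.setoid (Fin n)) rootSetoid

  open import Algebra.Definitions.RawMonoid K.+-rawMonoid using (sum)

  -- Since e is a bijection, a Subset n of indices is a set of distinct roots.
  ZeroSum : ∀ {n} → RootEnumeration n → ℕ → Pred (Subset n) ℓ₁′
  ZeroSum e k B =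
    ∣ B ∣ ≡ k ×
    sum (λ i → if lookup B i then proj₁ (Bijection.to e i) else K.0#) K.≈ K.0#

-- S(t,k,v) on the point set Fin v.
record IsSteinerSystem (t k v : ℕ) (Block : Pred (Subset v) ℓ) : Set ℓ where
  field
    blockSize   : ∀ {B} → Block B → ∣ B ∣ ≡ k
    coveredOnce : ∀ S → ∣ S ∣ ≡ t → ∃! _≡_ λ B → Block B × S ⊆ B

HasCardinality : {A : Set a} → Pred A ℓ → ℕ → Set (a ⊔ ℓ)
HasCardinality P n =
  ∃ λ xs → Unique xs × (∀ x → x ∈ xs ⇔ P x) × length xs ≡ n

𝔽₂ : IntegralDomain 0ℓ 0ℓ
𝔽₂ = record
  { commutativeRing = Bool.xor-∧-commutativeRing
  ; _≟_ = Bool._≟_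
  ; 1≉0 = λ ()
  ; noZeroDivisor = λ { false y e → inj₁ ≡.refl ; true y e → inj₂ e }
  }

𝔽₂⟨t⟩ : Field 0ℓ 0ℓ 0ℓ
𝔽₂⟨t⟩ = FractionField.fractionField (polynomialDomain 𝔽₂)

t : Field.Carrier 𝔽₂⟨t⟩
t = FractionField.fromDomain (polynomialDomain 𝔽₂)
      (Polynomial.X (IntegralDomain.commutativeRing 𝔽₂))

private
  module F where
    open Field 𝔽₂⟨t⟩ public
    open RawSemiringDefs (Semiring.rawSemiring semiring) public using (_^_)

open Polynomial F.commutativeRing using (Poly; C; X; polynomialRing)
open CommutativeRing polynomialRing using (_+_; _*_; semiring)
open RawSemiringDefs (Semiring.rawSemiring semiring) using (_^_)

f : Poly
f = X ^ 24 + X + C t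

L : Poly
L = X ^ 4096
  + C (t F.^ 24 F.+ t) * X ^ 2048
  + C (t F.^ 128) * X ^ 1024
  + C (t F.^ 88 F.+ t F.^ 65) * X ^ 512
  + C (t F.^ 16) * X ^ 32
  + C (t F.^ 9) * X ^ 16
  + C (t F.^ 40 F.+ t F.^ 17) * X ^ 8
  + X ^ 2
  + C (t F.^ 24 F.+ t) * X

-- Let P_k be the product of X + ΣA over the k-element sets A of roots of f.  By
-- the theorem on symmetric functions P_k has coefficients in 𝔽₂(t).  Since L is
-- additive and divisible by f, every ΣA is a root of L.  Hence P_k is, up to a
-- constant, a product of irreducible factors of L, and 24 choose k is a sum of
-- their degrees 1, 24, 276, 1771, 2024.  The factors of L have no common and no
-- multiple roots.  Using this for k = 0, 1, 2, 3, 4 in turn, arithmetic shows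
-- that P_0, P_1, P_2, P_3 are the factors of degree 1, 24, 276, 2024, and that
-- P_4 is a power of the factor of degree 1771.  So sums of at most 3 roots are
-- distinct from each other and from sums of 4 roots, whence no set of 1 to 7
-- distinct roots has sum 0.
--
-- Now the 1771 quadruples through a given root have distinct sums, which are
-- therefore all the roots of the factor of degree 1771.  Given five roots, the
-- sum of four of them is thus the sum of a quadruple through the fifth, and the
-- two quadruples together are the block containing the five roots.  Counting
-- the pairs of a 5-set and a block containing it gives 759 * 56 = 42504.
module Submission where

open import Defs
open import Algebra.Apartness.Bundles using (HeytingField)
open import Algebra.Bundles using (CommutativeRing; Semiring)
open import Algebra.Definitions.RawMagma using (_,_; _∣ʳ_)
import Algebra.Definitions.RawMonoid as RawMonoidDefs
import Algebra.Definitions.RawSemiring as RawSemiringDefs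
open import Algebra.Morphism.Structures using (module RingMorphisms)
import Algebra.Properties.Monoid.Divisibility as MonoidDivisibility
import Algebra.Properties.Ring as RingProperties
import Algebra.Properties.Semiring.Exp as Exp
import Algebra.Solver.Ring.NaturalCoefficients.Default as Solver
open import Data.Bool.Base using (if_then_else_; _xor_)
open import Data.Fin.Base using (Fin; zero; suc; toℕ)
open import Data.Fin.Subset as Subset using (Subset; inside; outside; ∣_∣; _⊆_; _∩_) renaming (_∈_ to _∈ₛ_)
import Data.Fin.Subset.Properties as Subset
open import Data.List.Base as List using (List; []; _∷_; length; foldr; _++_; [_]; filter)
open import Data.List.Membership.Propositional using (_∈_; find; lose)
open import Data.List.Membership.Propositional.Properties as ∈ using (∈-∃++)
import Data.List.Properties as List
open import Data.List.Relation.Binary.Permutation.Propositional as ↭ using (_↭_; prep; swap; ↭-trans; ↭-sym)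
open import Data.List.Relation.Binary.Permutation.Propositional.Properties using (shift; All-resp-↭; ↭-length; filter-↭; Any-resp-↭)
open import Data.List.Relation.Binary.Pointwise using ([]; _∷_) renaming (Pointwise to ListPointwise)
open import Data.List.Relation.Unary.All as All using (All; []; _∷_)
import Data.List.Relation.Unary.All.Properties as All
open import Data.List.Relation.Unary.AllPairs as AllPairs using (AllPairs; []; _∷_)
import Data.List.Relation.Unary.AllPairs.Properties as AllPairs
open import Data.List.Relation.Unary.Any as Any using (Any; here; there)
import Data.List.Relation.Unary.Any.Properties as Any
open import Data.List.Relation.Unary.Unique.Propositional using (Unique)
import Data.List.Relation.Unary.Unique.Propositional.Properties as Unique
open import Data.Nat.Base as ℕ using (ℕ; zero; suc; z≤n; s≤s; z<s)
open import Data.Nat.Combinatorics using (nCk+nC[k+1]≡[n+1]C[k+1]) renaming (_C_ to _choose_)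
open import Data.Nat.Divisibility as ℕ using (divides)
open import Data.Nat.Induction using (<-wellFounded)
open import Data.Nat.ListAction using (sum)
import Data.Nat.Properties as ℕ
open import Data.Product.Base using (∃; ∃-syntax; _×_; _,_; proj₁; proj₂)
open import Data.Sum.Base as Sum using (_⊎_; inj₁; inj₂)
open import Data.Vec.Base as Vec using (Vec; []; _∷_; lookup; insertAt)
open import Data.Vec.Functional using (Vector)
open import Data.Vec.Properties using (∷-injectiveʳ; insertAt-lookup; lookup⇒[]=)
open import Data.Vec.Relation.Binary.Pointwise.Inductive as Pointwise using (Pointwise; []; _∷_)
import Data.Vec.Relation.Unary.All as VecAll
open import Function.Base using (_∘_)
open import Function.Bundles using (mk⇔; Bijection)
open import Induction.WellFounded using (Acc; acc)
open import Level using (Level; _⊔_)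
open import Relation.Binary.Core using (Rel)
open import Relation.Binary.Definitions using (Symmetric; Decidable; tri<; tri≈; tri>)
open import Relation.Binary.PropositionalEquality as ≡ using (_≡_; _≢_)
open import Relation.Nullary using (¬_; Dec; yes; no; contradiction)
open import Relation.Nullary.Decidable using (True; False; toWitness; toWitnessFalse)
import Relation.Binary.Reasoning.Setoid as SetoidReasoning
import Relation.Unary as U

-- No Galois action is at hand, so orbit lengths are replaced by divisibility: an irreducible `q`
-- that shares one root with P_k divides P_k, and splitting `q` off repeatedly shows that its degree
-- divides the number of k-sets whose sum is a root of `q`. For this P_k must be an actual
-- polynomial over the base field. Instead of rewriting symmetric functions, `resolvent` expresses
-- P_k through a single root. The expression has the same value at all roots, so its remainder
-- modulo f takes one value at 24 distinct points and is constant.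
--
-- Arithmetic and coding theory then alternate. If zero-sum sets of at most d roots are empty, a
-- k-sum cannot equal a j-sum with j ≠ k and j + k ≤ d; this removes factors already identified with
-- j-sums. The divisibilities settle the rest for k. Distinct k-sums raise d to 2k, and disjointness
-- of the k-sums from the sums of k + 1 roots raises it to 2k + 1. Multiple roots of L are excluded
-- by its derivative, the nonzero constant t^24 + t.

private
  variable
    a b c ℓ ℓ₁ ℓ₂ ℓa ℓb ℓ₁′ ℓp : Level
    m n : ℕ

-- Evaluation, derivatives and homomorphisms of polynomials

HasCharacteristic2 : CommutativeRing c ℓ → Set (c ⊔ ℓ)
HasCharacteristic2 R = ∀ x → x + x ≈ 0#
  where open CommutativeRing R

module PolynomialProperties (R : CommutativeRing c ℓ) where

  open CommutativeRing R
  open Polynomial R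
  open Solver commutativeSemiring using (solve; _:=_; _:+_; _:*_; con)
  open import Relation.Binary.Reasoning.Setoid setoid

  tail-≈ : ∀ {x y p q} → (x ∷ p) ≈ₚ (y ∷ q) → p ≈ₚ q
  tail-≈ e = coeff-≈ (at e ∘ suc)

  eval-zero : ∀ {p} x → p ≈ₚ [] → eval p x ≈ 0#
  eval-zero {[]}    x e = refl
  eval-zero {y ∷ p} x e = begin
    y + x * eval p x  ≈⟨ +-cong (at e 0) (*-congˡ (eval-zero {p} x (coeff-≈ (at e ∘ suc)))) ⟩
    0# + x * 0#       ≈⟨ solve 1 (λ x → con 0 :+ x :* con 0 := con 0) refl x ⟩
    0#                ∎

  eval-congˡ : ∀ {p q} x → p ≈ₚ q → eval p x ≈ eval q x
  eval-congˡ {[]}    {q}     x e = sym (eval-zero {q} x (coeff-≈ (sym ∘ at e)))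
  eval-congˡ {y ∷ p} {[]}    x e = eval-zero {y ∷ p} x e
  eval-congˡ {y ∷ p} {z ∷ q} x e = +-cong (at e 0) (*-congˡ (eval-congˡ {p} {q} x (tail-≈ e)))

  eval-congʳ : ∀ p {x y} → x ≈ y → eval p x ≈ eval p y
  eval-congʳ []      e = refl
  eval-congʳ (z ∷ p) e = +-congˡ (*-cong e (eval-congʳ p e))

  eval-+ : ∀ p q x → eval (p +ₚ q) x ≈ eval p x + eval q x
  eval-+ []      q       x = sym (+-identityˡ _)
  eval-+ (y ∷ p) []      x = sym (+-identityʳ _)
  eval-+ (y ∷ p) (z ∷ q) x = begin
    (y + z) + x * eval (p +ₚ q) x         ≈⟨ +-congˡ (*-congˡ (eval-+ p q x)) ⟩
    (y + z) + x * (eval p x + eval q x)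
      ≈⟨ solve 5 (λ x y z p q → (y :+ z) :+ x :* (p :+ q) := (y :+ x :* p) :+ (z :+ x :* q))
           refl x y z (eval p x) (eval q x) ⟩
    (y + x * eval p x) + (z + x * eval q x) ∎

  eval-scale : ∀ y p x → eval (scale y p) x ≈ y * eval p x
  eval-scale y []      x = sym (zeroʳ y)
  eval-scale y (z ∷ p) x = begin
    y * z + x * eval (scale y p) x  ≈⟨ +-congˡ (*-congˡ (eval-scale y p x)) ⟩
    y * z + x * (y * eval p x)
      ≈⟨ solve 4 (λ x y z p → y :* z :+ x :* (y :* p) := y :* (z :+ x :* p)) refl x y z (eval p x) ⟩
    y * (z + x * eval p x)          ∎

  eval-* : ∀ p q x → eval (p *ₚ q) x ≈ eval p x * eval q x
  eval-* []      q x = sym (zeroˡ _)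
  eval-* (y ∷ p) q x = begin
    eval (scale y q +ₚ (0# ∷ (p *ₚ q))) x          ≈⟨ eval-+ (scale y q) _ x ⟩
    eval (scale y q) x + (0# + x * eval (p *ₚ q) x)
      ≈⟨ +-cong (eval-scale y q x) (+-congˡ (*-congˡ (eval-* p q x))) ⟩
    y * eval q x + (0# + x * (eval p x * eval q x))
      ≈⟨ solve 4 (λ x y p q → y :* q :+ (con 0 :+ x :* (p :* q)) := (y :+ x :* p) :* q)
           refl x y (eval p x) (eval q x) ⟩
    (y + x * eval p x) * eval q x                   ∎

  eval-C : ∀ y x → eval (C y) x ≈ y
  eval-C y x = solve 2 (λ y x → y :+ x :* con 0 := y) refl y x

  eval-X : ∀ x → eval X x ≈ x
  eval-X x = solve 1 (λ x → con 0 :+ x :* (con 1 :+ x :* con 0) := x) refl x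

  -- The value of the formal derivative, by the Horner form of Leibniz' rule, (y + X p)′ = p + X p′.
  -- Only values of derivatives are needed, so no derivative polynomial is formed.
  derivative : Poly → Carrier → Carrier
  derivative []      x = 0#
  derivative (y ∷ p) x = eval p x + x * derivative p x

  derivative-zero : ∀ {p} x → p ≈ₚ [] → derivative p x ≈ 0#
  derivative-zero {[]}    x e = refl
  derivative-zero {y ∷ p} x e = begin
    eval p x + x * derivative p x
      ≈⟨ +-cong (eval-zero {p} x (coeff-≈ (at e ∘ suc))) (*-congˡ (derivative-zero {p} x (coeff-≈ (at e ∘ suc)))) ⟩
    0# + x * 0#       ≈⟨ solve 1 (λ x → con 0 :+ x :* con 0 := con 0) refl x ⟩
    0#                ∎

  derivative-cong : ∀ {p q} x → p ≈ₚ q → derivative p x ≈ derivative q x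
  derivative-cong {[]}    {q}     x e = sym (derivative-zero {q} x (coeff-≈ (sym ∘ at e)))
  derivative-cong {y ∷ p} {[]}    x e = derivative-zero {y ∷ p} x e
  derivative-cong {y ∷ p} {z ∷ q} x e =
    +-cong (eval-congˡ {p} {q} x (tail-≈ e)) (*-congˡ (derivative-cong {p} {q} x (tail-≈ e)))

  derivative-+ : ∀ p q x → derivative (p +ₚ q) x ≈ derivative p x + derivative q x
  derivative-+ []      q       x = sym (+-identityˡ _)
  derivative-+ (y ∷ p) []      x = sym (+-identityʳ _)
  derivative-+ (y ∷ p) (z ∷ q) x = begin
    eval (p +ₚ q) x + x * derivative (p +ₚ q) x
      ≈⟨ +-cong (eval-+ p q x) (*-congˡ (derivative-+ p q x)) ⟩
    (eval p x + eval q x) + x * (derivative p x + derivative q x)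
      ≈⟨ solve 5 (λ x y z p q → (y :+ z) :+ x :* (p :+ q) := (y :+ x :* p) :+ (z :+ x :* q))
           refl x _ _ _ _ ⟩
    (eval p x + x * derivative p x) + (eval q x + x * derivative q x) ∎

  derivative-scale : ∀ y p x → derivative (scale y p) x ≈ y * derivative p x
  derivative-scale y []      x = sym (zeroʳ y)
  derivative-scale y (z ∷ p) x = begin
    eval (scale y p) x + x * derivative (scale y p) x
      ≈⟨ +-cong (eval-scale y p x) (*-congˡ (derivative-scale y p x)) ⟩
    y * eval p x + x * (y * derivative p x)
      ≈⟨ solve 4 (λ x y z p → y :* z :+ x :* (y :* p) := y :* (z :+ x :* p)) refl x y _ _ ⟩
    y * (eval p x + x * derivative p x) ∎

  derivative-* : ∀ p q x → derivative (p *ₚ q) x ≈ derivative p x * eval q x + eval p x * derivative q x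
  derivative-* []      q x = solve 2 (λ q q′ → con 0 := con 0 :* q :+ con 0 :* q′) refl _ _
  derivative-* (y ∷ p) q x = begin
    derivative (scale y q +ₚ (0# ∷ (p *ₚ q))) x  ≈⟨ derivative-+ (scale y q) _ x ⟩
    derivative (scale y q) x + (eval (p *ₚ q) x + x * derivative (p *ₚ q) x)
      ≈⟨ +-cong (derivative-scale y q x) (+-cong (eval-* p q x) (*-congˡ (derivative-* p q x))) ⟩
    y * derivative q x + (eval p x * eval q x + x * (derivative p x * eval q x + eval p x * derivative q x))
      ≈⟨ solve 6 (λ x y p p′ q q′ → y :* q′ :+ (p :* q :+ x :* (p′ :* q :+ p :* q′))
                     := (p :+ x :* p′) :* q :+ (y :+ x :* p) :* q′)
           refl x y _ _ _ _ ⟩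
    (eval p x + x * derivative p x) * eval q x + (y + x * eval p x) * derivative q x ∎

module RingHomomorphisms (A : CommutativeRing a ℓa) (B : CommutativeRing b ℓb) where

  private
    module A = CommutativeRing A
    module B = CommutativeRing B
  open RingMorphisms A.rawRing B.rawRing public using (IsRingHomomorphism)

  -- Zero and negatives need not be checked: in a ring x + x ≈ x forces x ≈ 0, and additive inverses
  -- are unique.
  isRingHomomorphism : (φ : A.Carrier → B.Carrier) →
    (∀ {x y} → x A.≈ y → φ x B.≈ φ y) →
    (∀ x y → φ (x A.+ y) B.≈ φ x B.+ φ y) →
    (∀ x y → φ (x A.* y) B.≈ φ x B.* φ y) →
    φ A.1# B.≈ B.1# → IsRingHomomorphism φ
  isRingHomomorphism φ cong hom-+ hom-* hom-1 = record
    { isSemiringHomomorphism = record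
      { isNearSemiringHomomorphism = record
        { +-isMonoidHomomorphism = record
          { isMagmaHomomorphism = record
            { isRelHomomorphism = record { cong = cong }
            ; homo = hom-+
            }
          ; ε-homo = hom-0
          }
        ; *-homo = hom-*
        }
      ; 1#-homo = hom-1
      }
    ; -‿homo = λ x → inverseˡ-unique (φ (A.- x)) (φ x)
        (B.trans (B.sym (hom-+ (A.- x) x)) (B.trans (cong (A.-‿inverseˡ x)) hom-0))
    }
    where
    open RingProperties B.ring using (x+x≈x⇒x≈0; +-inverseˡ-unique)
    inverseˡ-unique = +-inverseˡ-unique
    hom-0 : φ A.0# B.≈ B.0#
    hom-0 = x+x≈x⇒x≈0 (φ A.0#) (B.trans (B.sym (hom-+ A.0# A.0#)) (cong (A.+-identityˡ A.0#)))

module MapPolynomial {A : CommutativeRing a ℓa} {B : CommutativeRing b ℓb}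
  {φ : CommutativeRing.Carrier A → CommutativeRing.Carrier B}
  (φ-hom : RingHomomorphisms.IsRingHomomorphism A B φ) where

  private
    module A = CommutativeRing A
    module B = CommutativeRing B
    module PA = Polynomial A
    module PB = Polynomial B
    module PPA = PolynomialProperties A
    module PPB = PolynomialProperties B
  open RingHomomorphisms A B using (module IsRingHomomorphism)
  open IsRingHomomorphism φ-hom

  mapₚ : PA.Poly → PB.Poly
  mapₚ = List.map φ

  coeff-map : ∀ p n → PB.coeff (mapₚ p) n B.≈ φ (PA.coeff p n)
  coeff-map []      n       = B.sym 0#-homo
  coeff-map (x ∷ p) zero    = B.refl
  coeff-map (x ∷ p) (suc n) = coeff-map p n

  map-cong : ∀ {p q} → p PA.≈ₚ q → mapₚ p PB.≈ₚ mapₚ q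
  map-cong {p} {q} e .PB.at n =
    B.trans (coeff-map p n) (B.trans (⟦⟧-cong (PA.at e n)) (B.sym (coeff-map q n)))

  private
    module PB' = CommutativeRing PB.polynomialRing

  map-+ : ∀ p q → mapₚ (p PA.+ₚ q) PB.≈ₚ mapₚ p PB.+ₚ mapₚ q
  map-+ p q .PB.at n =
    B.trans (coeff-map (p PA.+ₚ q) n)
    (B.trans (⟦⟧-cong (PA.coeff-+ p q n))
    (B.trans (+-homo _ _)
    (B.trans (B.sym (B.+-cong (coeff-map p n) (coeff-map q n)))
      (B.sym (PB.coeff-+ (mapₚ p) (mapₚ q) n)))))

  map-scale : ∀ x p → mapₚ (PA.scale x p) PB.≈ₚ PB.scale (φ x) (mapₚ p)
  map-scale x p .PB.at n =
    B.trans (coeff-map (PA.scale x p) n)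
    (B.trans (⟦⟧-cong (PA.coeff-scale x p n))
    (B.trans (*-homo _ _)
    (B.trans (B.sym (B.*-congˡ (coeff-map p n)))
      (B.sym (PB.coeff-scale (φ x) (mapₚ p) n)))))

  map-* : ∀ p q → mapₚ (p PA.*ₚ q) PB.≈ₚ mapₚ p PB.*ₚ mapₚ q
  map-* []      q = PB'.refl
  map-* (x ∷ p) q =
    PB'.trans (map-+ (PA.scale x q) (A.0# ∷ (p PA.*ₚ q)))
      (PB'.+-cong (map-scale x q) (PB.coeff-≈ λ
        { zero → 0#-homo ; (suc n) → PB.at (map-* p q) n }))

  map-isRingHomomorphism :
    RingHomomorphisms.IsRingHomomorphism PA.polynomialRing PB.polynomialRing mapₚ
  map-isRingHomomorphism =
    RingHomomorphisms.isRingHomomorphism PA.polynomialRing PB.polynomialRing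
      mapₚ map-cong map-+ map-* (PB.coeff-≈ λ { zero → 1#-homo ; (suc n) → B.refl })

  eval-map : ∀ p x → PB.eval (mapₚ p) (φ x) B.≈ φ (PA.eval p x)
  eval-map []      x = B.sym 0#-homo
  eval-map (y ∷ p) x =
    B.trans (B.+-congˡ (B.*-congˡ (eval-map p x)))
      (B.sym (B.trans (+-homo _ _) (B.+-congˡ (*-homo _ _))))

  derivative-map : ∀ p x → PPB.derivative (mapₚ p) (φ x) B.≈ φ (PPA.derivative p x)
  derivative-map []      x = B.sym 0#-homo
  derivative-map (y ∷ p) x =
    B.trans (B.+-cong (eval-map p x) (B.*-congˡ (derivative-map p x)))
      (B.sym (B.trans (+-homo _ _) (B.+-congˡ (*-homo _ _))))

  -- With y a root, this is the homomorphism along which `resolvent-spec` recurses and which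
  -- Euclid's algorithm uses to recognise non-units.
  evalAt-isRingHomomorphism : ∀ y →
    RingHomomorphisms.IsRingHomomorphism PA.polynomialRing B (λ p → PB.eval (mapₚ p) y)
  evalAt-isRingHomomorphism y =
    RingHomomorphisms.isRingHomomorphism PA.polynomialRing B _
      (λ e → PPB.eval-congˡ y (map-cong e))
      (λ p q → B.trans (PPB.eval-congˡ y (map-+ p q)) (PPB.eval-+ (mapₚ p) (mapₚ q) y))
      (λ p q → B.trans (PPB.eval-congˡ y (map-* p q)) (PPB.eval-* (mapₚ p) (mapₚ q) y))
      (B.trans (PPB.eval-C _ y) 1#-homo)

module ConstantEmbedding (R : CommutativeRing c ℓ) where

  open CommutativeRing R
  open Polynomial R

  C-isRingHomomorphism : RingHomomorphisms.IsRingHomomorphism R polynomialRing C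
  C-isRingHomomorphism = RingHomomorphisms.isRingHomomorphism R polynomialRing C
    (λ e → coeff-≈ λ { zero → e ; (suc n) → refl })
    (λ x y → coeff-≈ λ { zero → refl ; (suc n) → refl })
    (λ x y → coeff-≈ λ { zero → sym (+-identityʳ _) ; (suc n) → refl })
    (coeff-≈ λ _ → refl)

open VecAll using ([]; _∷_)

-- Symmetric functions of the roots of a polynomial

AllPairs-resp-↭ : {A : Set a} {R : Rel A ℓ} → Symmetric R →
  ∀ {xs ys} → xs ↭ ys → AllPairs R xs → AllPairs R ys
AllPairs-resp-↭ R-sym ↭.refl         rs                    = rs
AllPairs-resp-↭ R-sym (prep x p)   (r ∷ rs)              =
  All-resp-↭ p r ∷ AllPairs-resp-↭ R-sym p rs
AllPairs-resp-↭ R-sym (swap x y p) ((r ∷ rx) ∷ (ry ∷ rs)) =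
  (R-sym r ∷ All-resp-↭ p ry) ∷ All-resp-↭ p rx ∷ AllPairs-resp-↭ R-sym p rs
AllPairs-resp-↭ R-sym (↭.trans p q)  rs                    =
  AllPairs-resp-↭ R-sym q (AllPairs-resp-↭ R-sym p rs)

∈⇒↭ : {A : Set a} {x : A} {xs : List A} → x ∈ xs → ∃[ ys ] xs ↭ x ∷ ys
∈⇒↭ x∈xs with ys , zs , ≡.refl ← ∈-∃++ x∈xs = ys ++ zs , shift _ ys zs

module MonicDivision (R : CommutativeRing c ℓ) where

  open CommutativeRing R
  open Polynomial R
  open PolynomialProperties R
  open Solver commutativeSemiring using (solve; _:=_; _:+_; _:*_)
  open import Relation.Binary.Reasoning.Setoid setoid

  -- The leading coefficient `l` is kept apart from the n lower ones: `l` = 1 gives monic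
  -- polynomials of degree n, `l` = 0 gives remainders of degree below n, and both share the lemmas
  -- on slopes.
  horner : Carrier → Vec Carrier n → Carrier → Carrier
  horner l []       x = l
  horner l (a ∷ as) x = a + x * horner l as x

  horner-cong : ∀ {l m x y} {as bs : Vec Carrier n} →
    l ≈ m → Pointwise _≈_ as bs → x ≈ y → horner l as x ≈ horner m bs y
  horner-cong l≈m []       x≈y = l≈m
  horner-cong l≈m (e ∷ es) x≈y = +-cong e (*-cong x≈y (horner-cong l≈m es x≈y))

  monic : Vec Carrier n → Poly
  monic as = Vec.toList as ++ [ 1# ]

  -- The coefficients of (p(X) − p(y)) / (X − y) for p = horner l as; its
  -- leading coefficient is again l.
  slope : Carrier → Carrier → Vec Carrier (suc n) → Vec Carrier n
  slope y l (a ∷ [])     = []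
  slope y l (a ∷ b ∷ as) = horner l (b ∷ as) y ∷ slope y l (b ∷ as)

  -- This is p(x) - p(y) = (x - y) s(x) with the negative terms moved across, so that it is an
  -- identity of semirings.
  horner-slope : ∀ y l (as : Vec Carrier (suc n)) x → let s = horner l (slope y l as) x in
    horner l as x + y * s ≈ horner l as y + x * s
  horner-slope y l (a ∷ []) x =
    solve 4 (λ a l x y → a :+ x :* l :+ y :* l := a :+ y :* l :+ x :* l) refl a l x y
  horner-slope y l (a ∷ as@(_ ∷ _)) x = begin
    (a + x * p x) + y * (p y + x * s)
      ≈⟨ solve 6 (λ a x y px py s → a :+ x :* px :+ y :* (py :+ x :* s)
                   := a :+ y :* py :+ x :* (px :+ y :* s)) refl a x y (p x) (p y) s ⟩
    (a + y * p y) + x * (p x + y * s)  ≈⟨ +-congˡ (*-congˡ (horner-slope y l as x)) ⟩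
    (a + y * p y) + x * (p y + x * s)  ∎
    where
    p = horner l as
    s = horner l (slope y l as) x

  -- One step of long division: the top coefficient `l` of the dividend is the quotient, and
  -- subtracting `l` times the monic divisor cancels the top term.
  reduce : Vec Carrier (suc n) → Vec Carrier n → Carrier × Vec Carrier n
  reduce (l ∷ [])     []       = l , []
  reduce (b ∷ bs@(_ ∷ _)) (a ∷ as) with l , v ← reduce bs as = l , (b - l * a) ∷ v

  -- Coefficients come constant term first, so the recursion is on p in a + X p: if p = q m + r,
  -- then a + X p = (X q) m + (a + X r), and a + X r has degree at most n, within reach of one
  -- `reduce`.
  quot : Vec Carrier n → Poly → Poly
  rem  : Vec Carrier n → Poly → Vec Carrier n
  quot as []      = []
  quot as (a ∷ p) = proj₁ (reduce (a ∷ rem as p) as) ∷ quot as p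
  rem  as []      = Vec.replicate _ 0#
  rem  as (a ∷ p) = proj₂ (reduce (a ∷ rem as p) as)

  private module P = CommutativeRing polynomialRing

  reduce-spec : (bs : Vec Carrier (suc n)) (as : Vec Carrier n) → let l , v = reduce bs as in
    Vec.toList bs ≈ₚ scale l (monic as) +ₚ Vec.toList v
  reduce-spec (l ∷ [])     []       = coeff-≈ λ { zero → sym (*-identityʳ l) ; (suc n) → refl }
  reduce-spec (b ∷ bs@(_ ∷ _)) (a ∷ as) with l , v ← reduce bs as | e ← reduce-spec bs as =
    coeff-≈ λ { zero → sym (begin
                  l * a + (b - l * a)  ≈⟨ +-congˡ (+-comm _ _) ⟩
                  l * a + (- (l * a) + b) ≈⟨ +-assoc _ _ _ ⟨
                  l * a - l * a + b  ≈⟨ +-congʳ (-‿inverseʳ _) ⟩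
                  0# + b             ≈⟨ +-identityˡ b ⟩
                  b                  ∎)
              ; (suc n) → at e n }

  replicate-0 : ∀ n → Vec.toList (Vec.replicate n 0#) ≈ₚ []
  replicate-0 zero    = P.refl
  replicate-0 (suc n) = coeff-≈ λ { zero → refl ; (suc m) → at (replicate-0 n) m }

  division : (as : Vec Carrier n) (p : Poly) →
    p ≈ₚ quot as p *ₚ monic as +ₚ Vec.toList (rem as p)
  division as []      = P.sym (replicate-0 _)
  division as (a ∷ p) = coeff-≈ λ
    { zero → begin
        a                                ≈⟨ at (reduce-spec (a ∷ rem as p) as) 0 ⟩
        coeff (scale l (monic as) +ₚ v) 0  ≈⟨ coeff-+ (scale l (monic as)) v 0 ⟩
        coeff (scale l (monic as)) 0 + coeff v 0
          ≈⟨ +-congʳ (trans (coeff-+ (scale l (monic as)) _ 0) (+-identityʳ _)) ⟨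
        coeff ((l ∷ quot as p) *ₚ monic as) 0 + coeff v 0
          ≈⟨ coeff-+ ((l ∷ quot as p) *ₚ monic as) v 0 ⟨
        coeff ((l ∷ quot as p) *ₚ monic as +ₚ v) 0  ∎
    ; (suc n) → begin
        coeff p n  ≈⟨ at (division as p) n ⟩
        coeff (quot as p *ₚ monic as +ₚ r) n  ≈⟨ coeff-+ (quot as p *ₚ monic as) r n ⟩
        coeff (quot as p *ₚ monic as) n + coeff r n
          ≈⟨ +-congˡ (at (reduce-spec (a ∷ rem as p) as) (suc n)) ⟩
        coeff (quot as p *ₚ monic as) n + coeff (scale l (monic as) +ₚ v) (suc n)
          ≈⟨ +-congˡ (coeff-+ (scale l (monic as)) v (suc n)) ⟩
        coeff (quot as p *ₚ monic as) n + (coeff (scale l (monic as)) (suc n) + coeff v (suc n))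
          ≈⟨ solve 3 (λ x y z → x :+ (y :+ z) := y :+ x :+ z) refl _ _ _ ⟩
        coeff (scale l (monic as)) (suc n) + coeff (quot as p *ₚ monic as) n + coeff v (suc n)
          ≈⟨ +-congʳ (coeff-+ (scale l (monic as)) (0# ∷ (quot as p *ₚ monic as)) (suc n)) ⟨
        coeff ((l ∷ quot as p) *ₚ monic as) (suc n) + coeff v (suc n)
          ≈⟨ coeff-+ ((l ∷ quot as p) *ₚ monic as) v (suc n) ⟨
        coeff ((l ∷ quot as p) *ₚ monic as +ₚ v) (suc n)  ∎
    }
    where
    l = proj₁ (reduce (a ∷ rem as p) as)
    r = Vec.toList (rem as p)
    v = Vec.toList (rem as (a ∷ p))

module MapHorner {A : CommutativeRing a ℓa} {B : CommutativeRing b ℓb}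
  {φ : CommutativeRing.Carrier A → CommutativeRing.Carrier B}
  (φ-hom : RingHomomorphisms.IsRingHomomorphism A B φ) where

  private
    module A = CommutativeRing A
    module B = CommutativeRing B
    module PB = Polynomial B
    module MA = MonicDivision A
    module MB = MonicDivision B
  open RingHomomorphisms A B using (module IsRingHomomorphism)
  open IsRingHomomorphism φ-hom

  horner-map : ∀ l (as : Vec A.Carrier n) x →
    MB.horner (φ l) (Vec.map φ as) (φ x) B.≈ φ (MA.horner l as x)
  horner-map l []       x = B.refl
  horner-map l (a ∷ as) x =
    B.trans (B.+-congˡ (B.*-congˡ (horner-map l as x)))
      (B.sym (B.trans (+-homo _ _) (B.+-congˡ (*-homo _ _))))

  -- The slope is given by polynomial formulas without division, so every homomorphism commutes with
  -- it, in particular one that sends a variable y to a root.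
  slope-map : ∀ y l (as : Vec A.Carrier (suc n)) →
    Pointwise B._≈_ (Vec.map φ (MA.slope y l as)) (MB.slope (φ y) (φ l) (Vec.map φ as))
  slope-map y l (a ∷ [])     = []
  slope-map y l (a ∷ b ∷ as) = B.sym (horner-map l (b ∷ as) y) ∷ slope-map y l (b ∷ as)

  eval-toList-map : (as : Vec A.Carrier n) → ∀ x →
    PB.eval (List.map φ (Vec.toList as)) x B.≈ MB.horner B.0# (Vec.map φ as) x
  eval-toList-map []       x = B.refl
  eval-toList-map (a ∷ as) x = B.+-congˡ (B.*-congˡ (eval-toList-map as x))

  eval-monic-map : (as : Vec A.Carrier n) → ∀ x →
    PB.eval (List.map φ (MA.monic as)) x B.≈ MB.horner B.1# (Vec.map φ as) x
  eval-monic-map []       x = B.trans (PolynomialProperties.eval-C B _ x) 1#-homo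
  eval-monic-map (a ∷ as) x = B.+-congˡ (B.*-congˡ (eval-monic-map as x))

module RootBound (D : IntegralDomain c ℓ) where

  open IntegralDomain D
  open MonicDivision commutativeRing
  open RingProperties ring using (x∙y⁻¹≈ε⇒x≈y; -‿distribˡ-*)
  open import Relation.Binary.Reasoning.Setoid setoid

  *-cancelʳ : ∀ {x y z} → x ≉ y → x * z ≈ y * z → z ≈ 0#
  *-cancelʳ {x} {y} {z} x≉y e with noZeroDivisor (x - y) z (begin
      (x - y) * z        ≈⟨ distribʳ z x (- y) ⟩
      x * z + (- y) * z  ≈⟨ +-cong e (sym (-‿distribˡ-* y z)) ⟩
      y * z - y * z      ≈⟨ -‿inverseʳ _ ⟩
      0#                 ∎)
  ... | inj₁ x-y≈0 = contradiction (x∙y⁻¹≈ε⇒x≈y x y x-y≈0) x≉y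
  ... | inj₂ z≈0   = z≈0

  slope-root : ∀ {l x y} (as : Vec Carrier (suc n)) → x ≉ y →
    horner l as x ≈ 0# → horner l as y ≈ 0# → horner l (slope y l as) x ≈ 0#
  slope-root {l = l} {x} {y} as x≉y ex ey = *-cancelʳ x≉y (begin
    x * s                  ≈⟨ +-identityˡ _ ⟨
    0# + x * s             ≈⟨ +-congʳ ey ⟨
    horner l as y + x * s  ≈⟨ horner-slope y l as x ⟨
    horner l as x + y * s  ≈⟨ +-congʳ ex ⟩
    0# + y * s             ≈⟨ +-identityˡ _ ⟩
    y * s                  ∎)
    where s = horner l (slope y l as) x

  private
    +*-zero : ∀ {a x h} → a + x * h ≈ 0# → h ≈ 0# → a ≈ 0#
    +*-zero {a} {x} {h} e h≈0 = begin
      a          ≈⟨ +-identityʳ a ⟨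
      a + 0#     ≈⟨ +-congˡ (trans (*-congˡ h≈0) (zeroʳ x)) ⟨
      a + x * h  ≈⟨ e ⟩
      0#         ∎

  -- The slope's coefficients are the values at y of the successive tails of the polynomial. Each
  -- coefficient of the polynomial is the value of one tail minus y times the value of the next.
  slope-zero : ∀ {l y} (as : Vec Carrier (suc n)) → l ≈ 0# → horner l as y ≈ 0# →
    VecAll.All (_≈ 0#) (slope y l as) → VecAll.All (_≈ 0#) as
  slope-zero (a ∷ [])     l≈0 e []       = +*-zero e l≈0 ∷ []
  slope-zero (a ∷ b ∷ as) l≈0 e (z ∷ zs) = +*-zero e z ∷ slope-zero (b ∷ as) l≈0 z zs

  -- As `l` vanishes, the degree is below n, too small for n distinct roots. The induction passes to
  -- the slope at one root, which keeps the other roots and the leading coefficient.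
  rootBound : ∀ {l} (as : Vec Carrier n) rs → l ≈ 0# → length rs ≡ n → AllPairs _≉_ rs →
    All (λ r → horner l as r ≈ 0#) rs → VecAll.All (_≈ 0#) as
  rootBound []             []       l≈0 _  _          _        = []
  rootBound (a ∷ as) (r ∷ rs) l≈0 eq (r≉ ∷ rs≉) (er ∷ ers) =
    slope-zero (a ∷ as) l≈0 er
      (rootBound (slope r _ (a ∷ as)) rs l≈0 (ℕ.suc-injective eq) rs≉
        (All.zipWith (λ { (r≉s , es) → slope-root (a ∷ as) (r≉s ∘ sym) es er }) (r≉ , ers)))

-- subsetProduct k rs x is the product of x + Σ A over the k-element
-- subsets A of rs.
module SubsetProduct (R : CommutativeRing c ℓ) where

  open CommutativeRing R
  open Solver commutativeSemiring using (solve; _:=_; _:+_; _:*_)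

  subsetProduct : ℕ → List Carrier → Carrier → Carrier
  subsetProduct zero    rs       x = x
  subsetProduct (suc k) []       x = 1#
  subsetProduct (suc k) (r ∷ rs) x = subsetProduct (suc k) rs x * subsetProduct k rs (x + r)

  subsetProduct-cong : ∀ k rs {x y} → x ≈ y → subsetProduct k rs x ≈ subsetProduct k rs y
  subsetProduct-cong zero    rs       e = e
  subsetProduct-cong (suc k) []       e = refl
  subsetProduct-cong (suc k) (r ∷ rs) e =
    *-cong (subsetProduct-cong (suc k) rs e) (subsetProduct-cong k rs (+-congʳ e))

  -- Only a swap of r and s has content. Two expansions separate the subsets containing neither,
  -- one, or both; the last kind sees x + r + s in either order. For size 1 there is no such kind,
  -- hence the separate case.
  subsetProduct-↭ : ∀ k {rs ss} → rs ↭ ss → ∀ x → subsetProduct k rs x ≈ subsetProduct k ss x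
  subsetProduct-↭ zero          p            x = refl
  subsetProduct-↭ (suc k)       ↭.refl       x = refl
  subsetProduct-↭ (suc k)       (prep r p)   x =
    *-cong (subsetProduct-↭ (suc k) p x) (subsetProduct-↭ k p (x + r))
  subsetProduct-↭ 1             (swap {xs = rs} r s p) x =
    trans (*-congʳ (*-congʳ (subsetProduct-↭ 1 p x)))
      (solve 4 (λ q x r s → q :* (x :+ s) :* (x :+ r) := q :* (x :+ r) :* (x :+ s)) refl _ x r s)
  subsetProduct-↭ (suc (suc k)) (swap {ys = ss} r s p) x =
    trans (*-cong (*-cong (subsetProduct-↭ (suc (suc k)) p x) (subsetProduct-↭ (suc k) p (x + s)))
                  (*-cong (subsetProduct-↭ (suc k) p (x + r))
                    (trans (subsetProduct-↭ k p (x + r + s))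
                      (subsetProduct-cong k ss
                        (solve 3 (λ x r s → x :+ r :+ s := x :+ s :+ r) refl x r s)))))
      (solve 4 (λ p q r s → (p :* q) :* (r :* s) := (p :* r) :* (q :* s)) refl _ _ _ _)
  subsetProduct-↭ (suc k)       (↭.trans p q) x =
    trans (subsetProduct-↭ (suc k) p x) (subsetProduct-↭ (suc k) q x)

-- The element of A whose image is subsetProduct k rs x whenever rs are the
-- roots of monic as.  It is a polynomial expression in any one root; as all
-- roots give the same value, its remainder modulo monic as is constant.
resolvent : (A : CommutativeRing a ℓ) → ℕ → Vec (CommutativeRing.Carrier A) n →
  CommutativeRing.Carrier A → CommutativeRing.Carrier A
resolventAtRoot : (A : CommutativeRing a ℓ) → ℕ → Vec (CommutativeRing.Carrier A) (suc n) →
  CommutativeRing.Carrier A → Polynomial.Poly A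
resolvent         A zero    as           x = x
resolvent {n = zero}  A (suc k) as       x = CommutativeRing.1# A
resolvent {n = suc n} A (suc k) as       x = Vec.head (rem as (resolventAtRoot A k as x))
  where open MonicDivision A
resolventAtRoot A k as x =
  resolvent polynomialRing (suc k) as′ (C x) *ₚ resolvent polynomialRing k as′ (C x +ₚ X)
  where
  open Polynomial A
  as′ = MonicDivision.slope polynomialRing X (C (CommutativeRing.1# A)) (Vec.map C as)

module _ (D : IntegralDomain b ℓb) where

  private
    module D = IntegralDomain D
    B = D.commutativeRing
  open SubsetProduct B
  open RootBound D
  open MonicDivision B using (horner; horner-cong)
  open RingProperties D.ring using (x∙y⁻¹≈ε⇒x≈y; x≈y⇒x∙y⁻¹≈ε)
  open Solver D.commutativeSemiring using (solve; _:=_; _:+_; _:*_; con)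
  open import Relation.Binary.Reasoning.Setoid D.setoid

  -- The induction changes the base ring from A to A[X]. For a root r, evaluation `ψ` at r sends X
  -- to r and the slope at X to the monic polynomial of the other roots; the two factors of
  -- `resolventAtRoot` then collect the subsets without r and with r. So `Q` is the value at every
  -- root r of the remainder `g`. Subtracting `Q` from the constant term of `g` leaves a polynomial
  -- of degree below n with n distinct roots, and `rootBound` makes it zero.
  resolvent-spec : (A : CommutativeRing a ℓa) → let module A = CommutativeRing A in
    (φ : A.Carrier → D.Carrier) → RingHomomorphisms.IsRingHomomorphism A B φ →
    ∀ k (as : Vec A.Carrier n) x rs → length rs ≡ n → AllPairs D._≉_ rs →
    All (λ r → horner D.1# (Vec.map φ as) r D.≈ D.0#) rs →
    subsetProduct k rs (φ x) D.≈ φ (resolvent A k as x)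
  resolvent-spec A φ hom zero as x rs eq rs≉ roots = D.refl
  resolvent-spec {n = zero} A φ hom (suc k) as x [] eq rs≉ roots = D.sym 1#-homo
    where open RingHomomorphisms.IsRingHomomorphism A B hom
  resolvent-spec {n = suc n} A φ hom (suc k) as x rs@(_ ∷ _) eq rs≉ roots = goal
    where
    module A = CommutativeRing A
    open RingHomomorphisms.IsRingHomomorphism A B hom
    open MonicDivision A using (rem; quot; division; monic)
    module PA = Polynomial A
    module PB = Polynomial B
    module SA = MonicDivision PA.polynomialRing
    open PolynomialProperties B
    open MapPolynomial hom

    as′ = SA.slope PA.X (PA.C A.1#) (Vec.map PA.C as)
    g = rem as (resolventAtRoot A k as x)
    Q = subsetProduct (suc k) rs (φ x)

    module _ {r} (r∈rs : r ∈ rs) where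
      rest = proj₁ (∈⇒↭ r∈rs)
      perm = proj₂ (∈⇒↭ r∈rs)

      ψ : PA.Poly → D.Carrier
      ψ p = PB.eval (mapₚ p) r

      ψ-hom = evalAt-isRingHomomorphism r
      module ψ = RingHomomorphisms.IsRingHomomorphism PA.polynomialRing B ψ-hom
      open MapHorner ψ-hom using (slope-map)

      ψ-C : ∀ y → ψ (PA.C y) D.≈ φ y
      ψ-C y = eval-C (φ y) r

      ψ-X : ψ PA.X D.≈ r
      ψ-X = D.trans (eval-congˡ {mapₚ PA.X} {PB.X} r (PB.coeff-≈ λ { 0 → 0#-homo ; 1 → 1#-homo ; (suc (suc _)) → D.refl })) (eval-X r)

      map-ψ-C : ∀ {m} (bs : Vec A.Carrier m) →
        Pointwise D._≈_ (Vec.map ψ (Vec.map PA.C bs)) (Vec.map φ bs)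
      map-ψ-C []       = []
      map-ψ-C (b ∷ bs) = ψ-C b ∷ map-ψ-C bs

      roots↭ = All-resp-↭ perm roots

      root-ψ : ∀ {s} → horner D.1# (Vec.map φ as) s D.≈ D.0# →
        horner (ψ (PA.C A.1#)) (Vec.map ψ (Vec.map PA.C as)) s D.≈ D.0#
      root-ψ = D.trans (horner-cong ψ.1#-homo (map-ψ-C as) D.refl)

      rest-root : ∀ {s} → (r D.≉ s) × horner D.1# (Vec.map φ as) s D.≈ D.0# →
        horner D.1# (Vec.map ψ as′) s D.≈ D.0#
      rest-root {s} (r≉s , e) = D.trans
        (horner-cong (D.sym ψ.1#-homo)
          (slope-map PA.X (PA.C A.1#) (Vec.map PA.C as)) D.refl)
        (slope-root (Vec.map ψ (Vec.map PA.C as)) (λ s≈X → r≉s (D.sym (D.trans s≈X ψ-X))) (root-ψ e)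
          (D.trans (horner-cong {as = Vec.map ψ (Vec.map PA.C as)} D.refl (Pointwise.refl D.refl) ψ-X) (root-ψ (All.head roots↭))))

      IH : ∀ k y → subsetProduct k rest (ψ y) D.≈ ψ (resolvent PA.polynomialRing k as′ y)
      IH k y = resolvent-spec PA.polynomialRing ψ ψ-hom k as′ y rest
        (ℕ.suc-injective (≡.trans (≡.sym (↭-length perm)) eq))
        (AllPairs.tail rs≉↭)
        (All.zipWith rest-root (AllPairs.head rs≉↭ , All.tail roots↭))
        where rs≉↭ = AllPairs-resp-↭ (λ x≉y y≈x → x≉y (D.sym y≈x)) perm rs≉

      Q≈ψ : Q D.≈ ψ (resolventAtRoot A k as x)
      Q≈ψ = begin
        subsetProduct (suc k) rs (φ x)  ≈⟨ subsetProduct-↭ (suc k) perm (φ x) ⟩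
        subsetProduct (suc k) rest (φ x) D.* subsetProduct k rest (φ x D.+ r)
          ≈⟨ D.*-cong (subsetProduct-cong (suc k) rest (ψ-C x))
                      (subsetProduct-cong k rest (D.trans (ψ.+-homo (PA.C x) PA.X) (D.+-cong (ψ-C x) ψ-X))) ⟨
        subsetProduct (suc k) rest (ψ (PA.C x)) D.* subsetProduct k rest (ψ (PA.C x PA.+ₚ PA.X))
          ≈⟨ D.*-cong (IH (suc k) (PA.C x)) (IH k (PA.C x PA.+ₚ PA.X)) ⟩
        ψ (resolvent PA.polynomialRing (suc k) as′ (PA.C x)) D.*
          ψ (resolvent PA.polynomialRing k as′ (PA.C x PA.+ₚ PA.X))
          ≈⟨ ψ.*-homo (resolvent PA.polynomialRing (suc k) as′ (PA.C x))
                      (resolvent PA.polynomialRing k as′ (PA.C x PA.+ₚ PA.X)) ⟨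
        ψ (resolventAtRoot A k as x) ∎

      Q≈g : Q D.≈ horner D.0# (Vec.map φ g) r
      Q≈g = begin
        Q      ≈⟨ Q≈ψ ⟩
        ψ p    ≈⟨ ψ.⟦⟧-cong (division as p) ⟩
        ψ (quot as p PA.*ₚ monic as PA.+ₚ Vec.toList g)
          ≈⟨ D.trans (ψ.+-homo (quot as p PA.*ₚ monic as) (Vec.toList g)) (D.+-congʳ (ψ.*-homo (quot as p) (monic as))) ⟩
        ψ (quot as p) D.* ψ (monic as) D.+ ψ (Vec.toList g)
          ≈⟨ D.+-cong (D.*-congˡ (D.trans (eval-monic-map as r) (All.head roots↭))) (eval-toList-map g r) ⟩
        ψ (quot as p) D.* D.0# D.+ horner D.0# (Vec.map φ g) r
          ≈⟨ solve 2 (λ x y → x :* con 0 :+ y := y) D.refl _ _ ⟩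
        horner D.0# (Vec.map φ g) r ∎
        where
        open MapHorner {A = A} {B} hom
        p = resolventAtRoot A k as x

    shifted-root : ∀ (g : Vec D.Carrier (suc n)) {r} → Q D.≈ horner D.0# g r →
      horner D.0# ((Vec.head g D.- Q) ∷ Vec.tail g) r D.≈ D.0#
    shifted-root (g₀ ∷ gs) {r} e = begin
      (g₀ D.- Q) D.+ u  ≈⟨ solve 3 (λ x y z → x :+ y :+ z := x :+ z :+ y) D.refl g₀ (D.- Q) u ⟩
      (g₀ D.+ u) D.- Q  ≈⟨ x≈y⇒x∙y⁻¹≈ε (D.sym e) ⟩
      D.0#              ∎
      where u = r D.* horner D.0# gs r

    head-map : ∀ (g : Vec A.Carrier (suc n)) → Vec.head (Vec.map φ g) ≡ φ (Vec.head g)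
    head-map (_ ∷ _) = ≡.refl

    goal : Q D.≈ φ (Vec.head g)
    goal = D.trans (D.sym (x∙y⁻¹≈ε⇒x≈y _ _ (VecAll.head
      (rootBound ((Vec.head (Vec.map φ g) D.- Q) ∷ Vec.tail (Vec.map φ g)) rs D.refl eq rs≉
        (All.tabulate λ r∈rs → shifted-root (Vec.map φ g) (Q≈g r∈rs))))))
      (D.reflexive (head-map g))

-- Irreducible factors and their roots

module FieldProperties (K : Field c ℓ₁ ℓ₂) where

  open Field K
  open HeytingField (Field.heytingField K) using (tight; #⇒invertible; invertible⇒#)
  open RingProperties ring using (-0#≈0#)

  infix 4 _≟_
  _≟_ : Decidable _≈_
  x ≟ y with x #? y
  ... | yes x#y = no λ x≈y → proj₂ (tight x y) x≈y x#y
  ... | no ¬x#y = yes (proj₁ (tight x y) ¬x#y)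

  inverse : ∀ {x} → x ≉ 0# → ∃[ y ] y * x ≈ 1#
  inverse {x} x≉0 with x #? 0#
  ... | no ¬x#0 = contradiction (proj₁ (tight x 0#) ¬x#0) x≉0
  ... | yes x#0 with y , yx≈1 , _ ← #⇒invertible x#0 =
    y , trans (*-congˡ (trans (sym (+-identityʳ x)) (+-congˡ (sym -0#≈0#)))) yx≈1

  1≉0 : 1# ≉ 0#
  1≉0 1≈0 = proj₂ (tight 1# 0#) 1≈0 (invertible⇒# {1#} {0#} (1# , e , trans (*-comm _ 1#) e))
    where
    e : 1# * (1# - 0#) ≈ 1#
    e = trans (*-identityˡ _) (trans (+-congˡ -0#≈0#) (+-identityʳ 1#))

  domain : IntegralDomain c ℓ₁
  domain = record
    { commutativeRing = commutativeRing
    ; _≟_ = _≟_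
    ; 1≉0 = 1≉0
    ; noZeroDivisor = noZeroDivisor
    }
    where
    noZeroDivisor : ∀ x y → x * y ≈ 0# → x ≈ 0# ⊎ y ≈ 0#
    noZeroDivisor x y e with x ≟ 0#
    ... | yes x≈0 = inj₁ x≈0
    ... | no x≉0 with z , zx≈1 ← inverse x≉0 = inj₂
      (trans (sym (*-identityˡ y)) (trans (*-congʳ (sym zx≈1))
      (trans (*-assoc z x y) (trans (*-congˡ e) (zeroʳ z)))))

module Degree (D : IntegralDomain c ℓ) where

  open IntegralDomain D
  open Polynomial commutativeRing

  *-≉0 : ∀ {x y} → x ≉ 0# → y ≉ 0# → x * y ≉ 0#
  *-≉0 {x} {y} x≉0 y≉0 e with noZeroDivisor x y e
  ... | inj₁ x≈0 = x≉0 x≈0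
  ... | inj₂ y≈0 = y≉0 y≈0

  *-cancelˡ : ∀ {x y z} → x ≉ 0# → x * y ≈ x * z → y ≈ z
  *-cancelˡ {x} {y} {z} x≉0 e with noZeroDivisor x (y - z) (begin
      x * (y - z)        ≈⟨ distribˡ x y (- z) ⟩
      x * y + x * (- z)  ≈⟨ +-cong e (sym (-‿distribʳ-* x z)) ⟩
      x * z - x * z      ≈⟨ -‿inverseʳ (x * z) ⟩
      0#                 ∎)
    where
    open RingProperties ring using (-‿distribʳ-*)
    open import Relation.Binary.Reasoning.Setoid setoid
  ... | inj₁ x≈0 = contradiction x≈0 x≉0
  ... | inj₂ e′  = x∙y⁻¹≈ε⇒x≈y y z e′
    where open RingProperties ring using (x∙y⁻¹≈ε⇒x≈y)

  hasDegree-cong : ∀ {p q n} → p ≈ₚ q → HasDegree p n → HasDegree q n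
  hasDegree-cong e (p≉0 , p≈0) =
    (λ q≈0 → p≉0 (trans (at e _) q≈0)) , λ m n<m → trans (sym (at e m)) (p≈0 m n<m)

  hasDegree-unique : ∀ {p m n} → HasDegree p m → HasDegree p n → m ≡ n
  hasDegree-unique {m = m} {n} (pm , p>m) (pn , p>n) with ℕ.<-cmp m n
  ... | tri< m<n _ _ = contradiction (p>m n m<n) pn
  ... | tri≈ _ m≡n _ = m≡n
  ... | tri> _ _ m>n = contradiction (p>n m m>n) pm

  degree : ∀ p → p ≈ₚ [] ⊎ ∃[ n ] HasDegree p n
  degree []      = inj₁ (coeff-≈ λ _ → refl)
  degree (x ∷ p) with degree p
  ... | inj₂ (n , p≉0 , p≈0) = inj₂ (suc n , p≉0 , λ { (suc m) (s≤s n<m) → p≈0 m n<m })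
  ... | inj₁ p≈[] with x ≟ 0#
  ...   | yes x≈0 = inj₁ (coeff-≈ λ { zero → x≈0 ; (suc n) → at p≈[] n })
  ...   | no x≉0  = inj₂ (0 , x≉0 , λ { (suc m) _ → at p≈[] m })

  hasDegree-scale : ∀ {x p n} → x ≉ 0# → HasDegree p n → HasDegree (scale x p) n
  hasDegree-scale {x} {p} x≉0 (p≉0 , p≈0) =
    (λ e → *-≉0 x≉0 p≉0 (trans (sym (coeff-scale x p _)) e)) ,
    λ m n<m → trans (coeff-scale x p m) (trans (*-congˡ (p≈0 m n<m)) (zeroʳ x))

  hasDegree-* : ∀ p q {m n} → HasDegree p m → HasDegree q n → HasDegree (p *ₚ q) (m ℕ.+ n)
  hasDegree-* []      q (p≉0 , _) _ = contradiction refl p≉0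
  hasDegree-* (x ∷ p) q {zero} (x≉0 , p≈0) hq =
    hasDegree-cong {scale x q} {(x ∷ p) *ₚ q}
      (coeff-≈ λ n → trans (sym (+-identityʳ _)) (trans (+-congˡ (sym (shifted-zero n)))
        (sym (coeff-+ (scale x q) (0# ∷ (p *ₚ q)) n))))
      (hasDegree-scale {x} {q} x≉0 hq)
    where
    module P = CommutativeRing polynomialRing
    shifted-zero : ∀ n → coeff (0# ∷ (p *ₚ q)) n ≈ 0#
    shifted-zero zero    = refl
    shifted-zero (suc n) = at (P.trans (P.*-congʳ {q} {p} {[]} (coeff-≈ λ n → p≈0 (suc n) z<s)) (P.zeroˡ q)) n
  hasDegree-* (x ∷ p) q {suc m} {n} (p≉0 , p≈0) hq@(_ , q≈0) =
    (λ e → proj₁ IH (trans (sym (higher (m ℕ.+ n) (s≤s (ℕ.m≤n+m n m)))) e)) ,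
    λ { (suc k) (s≤s lt) → trans (higher k (s≤s (ℕ.≤-trans (ℕ.m≤n+m n m) (ℕ.<⇒≤ lt)))) (proj₂ IH k lt) }
    where
    IH = hasDegree-* p q {m} {n} (p≉0 , λ k m<k → p≈0 (suc k) (s≤s m<k)) hq
    higher : ∀ k → n ℕ.< suc k → coeff ((x ∷ p) *ₚ q) (suc k) ≈ coeff (p *ₚ q) k
    higher k n<k = trans (coeff-+ (scale x q) (0# ∷ (p *ₚ q)) (suc k))
      (trans (+-congʳ (trans (coeff-scale x q (suc k)) (trans (*-congˡ (q≈0 (suc k) n<k)) (zeroʳ x))))
        (+-identityˡ _))

module Truncation (R : CommutativeRing c ℓ) where

  open CommutativeRing R
  open Polynomial R
  open MonicDivision R using (monic)

  truncate : ∀ n → Poly → Vec Carrier n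
  truncate zero    p       = []
  truncate (suc n) []      = 0# ∷ truncate n []
  truncate (suc n) (x ∷ p) = x ∷ truncate n p

  monic-truncate : ∀ n p → coeff p n ≈ 1# → (∀ m → n ℕ.< m → coeff p m ≈ 0#) →
    p ≈ₚ monic (truncate n p)
  monic-truncate zero    p       e z = coeff-≈ λ { zero → e ; (suc m) → z (suc m) z<s }
  monic-truncate (suc n) []      e z = coeff-≈ λ
    { zero → refl ; (suc m) → at (monic-truncate n [] e (λ _ _ → refl)) m }
  monic-truncate (suc n) (x ∷ p) e z = coeff-≈ λ
    { zero → refl ; (suc m) → at (monic-truncate n p e (λ k lt → z (suc k) (s≤s lt))) m }

  toList-degree : (v : Vec Carrier n) → ∀ m → n ℕ.≤ m → coeff (Vec.toList v) m ≈ 0#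
  toList-degree []      m       _        = refl
  toList-degree (x ∷ v) (suc m) (s≤s le) = toList-degree v m le

-- ψ stands for evaluation at a root in an extension of F.
module MinimalPolynomial (F : Field a ℓ₁ ℓ₂) (B : CommutativeRing b ℓb)
  (ψ : Polynomial.Poly (Field.commutativeRing F) → CommutativeRing.Carrier B)
  (ψ-hom : RingHomomorphisms.IsRingHomomorphism (Polynomial.polynomialRing (Field.commutativeRing F)) B ψ)
  (1≉0 : ¬ (CommutativeRing._≈_ B (CommutativeRing.1# B) (CommutativeRing.0# B)))
  where

  private
    module B = CommutativeRing B
    module F = Field F
  open FieldProperties F using (inverse; domain)
  open Polynomial F.commutativeRing
  open MonicDivision F.commutativeRing
  open Degree domain
  open Truncation F.commutativeRing
  private module P = CommutativeRing polynomialRing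
  open MonoidDivisibility P.*-monoid using (_∣_; ∣ʳ-trans; ∣ʳ-respʳ-≈; x∣ʳy⇒x∣ʳzy)
  open Factorization F using (Irreducible)
  open RingHomomorphisms.IsRingHomomorphism polynomialRing B ψ-hom

  scale-C : ∀ x p → scale x p ≈ₚ C x *ₚ p
  scale-C x p .at n = F.sym (F.trans (coeff-+ (scale x p) (F.0# ∷ []) n)
    (F.trans (F.+-congˡ (zeros n)) (F.+-identityʳ _)))
    where
    zeros : ∀ n → coeff (F.0# ∷ []) n F.≈ F.0#
    zeros zero    = F.refl
    zeros (suc n) = F.refl

  ψ-∣ : ∀ {p q} → p ∣ q → ψ p B.≈ B.0# → ψ q B.≈ B.0#
  ψ-∣ {p} {q} (s , e) ψp≈0 = B.trans (⟦⟧-cong (P.sym e))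
    (B.trans (*-homo s p) (B.trans (B.*-congˡ ψp≈0) (B.zeroʳ (ψ s))))

  ∣-+ : ∀ {p q r} → p ∣ q → p ∣ r → p ∣ q +ₚ r
  ∣-+ {p} (s , e) (u , e′) = s +ₚ u , P.trans (P.distribʳ p s u) (P.+-cong e e′)

  -- Division is by monic polynomials only, so each nonzero remainder in Euclid's algorithm is
  -- replaced by its monic associate. One divisibility transports the root to it, the other brings
  -- the factor `q` back.
  normalise : ∀ p {n} → HasDegree p n → ∃[ as ] (p ∣ monic {n} as) × (monic as ∣ p)
  normalise p {n} (p≉0 , p≈0) with z , e ← inverse p≉0 =
    truncate n (scale z p) , (C z , P.trans (P.sym (scale-C z p)) eq) ,
    (C (coeff p n) , P.trans (P.*-congˡ {C (coeff p n)} (P.trans (P.sym eq) (scale-C z p)))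
      (P.trans (P.sym (P.*-assoc (C (coeff p n)) (C z) p))
      (P.trans (P.*-congʳ {p} {C (coeff p n) *ₚ C z} {C F.1#} (coeff-≈ λ
        { zero → F.trans (F.+-identityʳ _) (F.trans (F.*-comm _ z) e) ; (suc n) → F.refl }))
      (P.*-identityˡ p))))
    where
    eq : scale z p ≈ₚ monic (truncate n (scale z p))
    eq = monic-truncate n (scale z p) (F.trans (coeff-scale z p n) e)
      λ m n<m → F.trans (coeff-scale z p m) (F.trans (F.*-congˡ (p≈0 m n<m)) (F.zeroʳ z))

  hasDegree-< : (v : Vec F.Carrier n) → HasDegree (Vec.toList v) m → m ℕ.< n
  hasDegree-< {n} {m} v (v≉0 , _) with ℕ.<-≤-connex m n
  ... | inj₁ m<n = m<n
  ... | inj₂ n≤m = contradiction (toList-degree v m n≤m) v≉0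

  ψ-rem : (as : Vec F.Carrier n) → ∀ p → ψ (monic as) B.≈ B.0# → ψ p B.≈ B.0# →
    ψ (Vec.toList (rem as p)) B.≈ B.0#
  ψ-rem as p ψas ψp = begin
    ψ r            ≈⟨ B.+-identityˡ _ ⟨
    B.0# B.+ ψ r   ≈⟨ B.+-congʳ (ψ-∣ (quot as p , P.refl) ψas) ⟨
    ψ (quot as p *ₚ monic as) B.+ ψ r  ≈⟨ +-homo (quot as p *ₚ monic as) r ⟨
    ψ (quot as p *ₚ monic as +ₚ r)     ≈⟨ ⟦⟧-cong (division as p) ⟨
    ψ p            ≈⟨ ψp ⟩
    B.0#           ∎
    where
    r = Vec.toList (rem as p)
    open import Relation.Binary.Reasoning.Setoid B.setoid

  module _ {q} (q-irreducible : Irreducible q) (ψq≈0 : ψ q B.≈ B.0#) where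

    open RawSemiringDefs.Irreducible q-irreducible using (split-∣1)

    private
      -- A common factor of divisor and remainder divides p. A nonzero remainder is again killed by
      -- `ψ` and has smaller degree, so the recursive hypothesis applies to it; a zero remainder is
      -- left to the caller.
      viaRemainder : (as : Vec F.Carrier n) → ∀ p → ψ (monic as) B.≈ B.0# → ψ p B.≈ B.0# →
        (∀ {m} → m ℕ.< n → (bs : Vec F.Carrier m) → ψ (monic bs) B.≈ B.0# → q ∣ monic bs) →
        (p ≈ₚ quot as p *ₚ monic as → q ∣ p) → (q ∣ monic as → q ∣ p)

    -- Euclid's algorithm; ψ kills every remainder, so none of them is a unit.
    irreducible-∣-monic : Acc ℕ._<_ n → (as : Vec F.Carrier n) → ψ (monic as) B.≈ B.0# → q ∣ monic as

    viaRemainder as p ψas ψp rec zero-case q∣as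
      with degree (Vec.toList (rem as p))
    ... | inj₁ r≈0 = zero-case
      (P.trans (division as p) (P.trans (P.+-congˡ {quot as p *ₚ monic as} r≈0) (P.+-identityʳ _)))
    ... | inj₂ (m , hm) with bs , r∣bs , bs∣r ← normalise _ hm =
      ∣ʳ-respʳ-≈ (P.sym (division as p))
        (∣-+ (x∣ʳy⇒x∣ʳzy (quot as p) q∣as)
          (∣ʳ-trans (rec (hasDegree-< (rem as p) hm) bs (ψ-∣ r∣bs (ψ-rem as p ψas ψp))) bs∣r))

    irreducible-∣-monic (acc rs) as ψas with degree (Vec.toList (rem as q))
    ... | inj₁ r≈0 with split-∣1 {quot as q} {monic as}
            (P.trans (division as q) (P.trans (P.+-congˡ {quot as q *ₚ monic as} r≈0) (P.+-identityʳ _)))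
    ...   | inj₁ (u , e) = u , (begin
              u *ₚ q                          ≈⟨ P.*-congˡ {u} (division as q) ⟩
              u *ₚ (quot as q *ₚ monic as +ₚ Vec.toList (rem as q))
                ≈⟨ P.*-congˡ {u} (P.trans (P.+-congˡ {quot as q *ₚ monic as} r≈0) (P.+-identityʳ _)) ⟩
              u *ₚ (quot as q *ₚ monic as)    ≈⟨ P.*-assoc u (quot as q) (monic as) ⟨
              (u *ₚ quot as q) *ₚ monic as    ≈⟨ P.*-congʳ e ⟩
              C F.1# *ₚ monic as              ≈⟨ P.*-identityˡ (monic as) ⟩
              monic as                        ∎)
      where open import Relation.Binary.Reasoning.Setoid P.setoid
    ...   | inj₂ as∣1 = contradiction (B.trans (B.sym 1#-homo) (ψ-∣ as∣1 ψas)) 1≉0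
    -- The remainder of `q` by `monic as` is not zero: by induction `q` divides its monic associate
    -- `monic bs`. Dividing `monic as` by `monic bs` in turn then gives the claim.
    irreducible-∣-monic (acc rs) as ψas | inj₂ (m , hm)
      with bs , r∣bs , bs∣r ← normalise _ hm =
      viaRemainder bs (monic as) ψbs ψas (λ lt → irreducible-∣-monic (rs (ℕ.<-trans lt m<n)))
        (λ e → ∣ʳ-respʳ-≈ (P.sym e) (x∣ʳy⇒x∣ʳzy (quot bs (monic as)) q∣bs)) q∣bs
      where
      m<n = hasDegree-< (rem as q) hm
      ψbs = ψ-∣ r∣bs (ψ-rem as q ψas ψq≈0)
      q∣bs = irreducible-∣-monic (rs m<n) bs ψbs

    -- Up to a constant, `q` is the minimal polynomial of the point at which `ψ` evaluates.
    irreducible-∣ : ∀ p → ψ p B.≈ B.0# → q ∣ p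
    irreducible-∣ p ψp≈0 with degree p
    ... | inj₁ p≈0 = [] , P.sym p≈0
    ... | inj₂ (n , hn) with as , p∣as , as∣p ← normalise p hn =
      ∣ʳ-trans (irreducible-∣-monic (<-wellFounded n) as (ψ-∣ p∣as ψp≈0)) as∣p

-- Counting and double counting in lists

count : {A : Set a} {P : U.Pred A ℓp} → U.Decidable P → List A → ℕ
count P? xs = length (filter P? xs)

private
  indicator : {P : Set ℓp} → Dec P → ℕ
  indicator (yes _) = 1
  indicator (no _)  = 0

  count-∷ : {A : Set a} {P : U.Pred A ℓp} (P? : U.Decidable P) → ∀ x xs →
    count P? (x ∷ xs) ≡ indicator (P? x) ℕ.+ count P? xs
  count-∷ P? x xs with P? x
  ... | yes _ = ≡.refl
  ... | no  _ = ≡.refl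

count-none : {A : Set a} {P : U.Pred A ℓp} (P? : U.Decidable P) {xs : List A} →
  ¬ Any P xs → count P? xs ≡ 0
count-none P? ¬P = ≡.cong length (List.filter-none P? (All.¬Any⇒All¬ _ ¬P))

count-all : {A : Set a} {P : U.Pred A ℓp} (P? : U.Decidable P) {xs : List A} →
  All P xs → count P? xs ≡ length xs
count-all P? Ps = ≡.cong length (List.filter-all P? Ps)

count-unique : {A : Set a} {P : U.Pred A ℓp} (P? : U.Decidable P) {xs : List A} →
  AllPairs (λ x y → ¬ (P x × P y)) xs → Any P xs → count P? xs ≡ 1
count-unique P? {x ∷ xs} (d ∷ ds) Pxs with P? x
... | yes Px = ≡.cong suc (count-none P? λ any → case any)
  where
  case : ¬ Any _ xs
  case any with find any
  ... | y , y∈ , Py = All.lookup d y∈ (Px , Py)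
count-unique P? {x ∷ xs} (d ∷ ds) (here Px)  | no ¬Px = contradiction Px ¬Px
count-unique P? {x ∷ xs} (d ∷ ds) (there Pxs) | no ¬Px = count-unique P? ds Pxs

doubleCount : {A : Set a} {B : Set b} {R : A → B → Set ℓp} (R? : ∀ x y → Dec (R x y)) →
  ∀ xs ys → sum (List.map (λ x → count (R? x) ys) xs) ≡ sum (List.map (λ y → count (λ x → R? x y) xs) ys)
doubleCount R? []       ys = ≡.sym (zeros ys)
  where
  zeros : ∀ ys → sum (List.map (λ _ → 0) ys) ≡ 0
  zeros []       = ≡.refl
  zeros (y ∷ ys) = zeros ys
doubleCount R? (x ∷ xs) ys = ≡.trans (≡.cong (count (R? x) ys ℕ.+_) (doubleCount R? xs ys)) (addRow ys)
  where
  open ≡.≡-Reasoning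
  col = λ y → count (λ x → R? x y) xs
  addRow : ∀ ys → count (R? x) ys ℕ.+ sum (List.map col ys) ≡
               sum (List.map (λ y → count (λ x → R? x y) (x ∷ xs)) ys)
  addRow []       = ≡.refl
  addRow (y ∷ ys) = begin
    count (R? x) (y ∷ ys) ℕ.+ (col y ℕ.+ rest)
      ≡⟨ ≡.cong (ℕ._+ (col y ℕ.+ rest)) (count-∷ (R? x) y ys) ⟩
    (i ℕ.+ count (R? x) ys) ℕ.+ (col y ℕ.+ rest)
      ≡⟨ interchange i (count (R? x) ys) (col y) rest ⟩
    (i ℕ.+ col y) ℕ.+ (count (R? x) ys ℕ.+ rest)
      ≡⟨ ≡.cong₂ ℕ._+_ (≡.sym (count-∷ (λ x → R? x y) x xs)) (addRow ys) ⟩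
    count (λ x → R? x y) (x ∷ xs) ℕ.+ sum (List.map (λ y → count (λ x → R? x y) (x ∷ xs)) ys) ∎
    where
    i = indicator (R? x y)
    rest = sum (List.map col ys)
    open import Algebra.Properties.CommutativeSemigroup ℕ.+-commutativeSemigroup using (interchange)

-- Split polynomials and separability in characteristic 2

polynomialProduct : (R : CommutativeRing c ℓ) → List (Polynomial.Poly R) → Polynomial.Poly R
polynomialProduct R = foldr _*ₚ_ (C 1#)
  where
  open CommutativeRing R
  open Polynomial R

-- In characteristic 2 the linear polynomial with root s is X + s.
module LinearFactors (D : IntegralDomain c ℓ)
  (x+x≈0 : HasCharacteristic2 (IntegralDomain.commutativeRing D)) where

  open IntegralDomain D
  open Polynomial commutativeRing
  open PolynomialProperties commutativeRing
  open MonicDivision commutativeRing using (quot; rem; division)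
  open Degree D
  open RingProperties ring using (+-inverseˡ-unique)
  private
    module P = CommutativeRing polynomialRing
    module DP = Degree (polynomialDomain D)
  open import Algebra.Properties.CommutativeSemigroup P.*-commutativeSemigroup using (x∙yz≈y∙xz)

  x+y≈0⇒x≈y : ∀ {x y} → x + y ≈ 0# → x ≈ y
  x+y≈0⇒x≈y {x} {y} e = trans (+-inverseˡ-unique x y e) (sym (+-inverseˡ-unique y y (x+x≈0 y)))

  eval-*-zeroˡ : ∀ p q {x} → eval p x ≈ 0# → eval (p *ₚ q) x ≈ 0#
  eval-*-zeroˡ p q {x} e = trans (eval-* p q x) (trans (*-congʳ e) (zeroˡ (eval q x)))

  eval-*-zeroʳ : ∀ p q {x} → eval q x ≈ 0# → eval (p *ₚ q) x ≈ 0#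
  eval-*-zeroʳ p q {x} e = trans (eval-* p q x) (trans (*-congˡ e) (zeroʳ (eval p x)))

  eval-*-split : ∀ p q {x} → eval (p *ₚ q) x ≈ 0# → eval p x ≈ 0# ⊎ eval q x ≈ 0#
  eval-*-split p q {x} e = noZeroDivisor (eval p x) (eval q x) (trans (sym (eval-* p q x)) e)

  linear : Carrier → Poly
  linear s = s ∷ 1# ∷ []

  eval-linear : ∀ s x → eval (linear s) x ≈ s + x
  eval-linear s x = solve 2 (λ s x → s :+ x :* (con 1 :+ x :* con 0) := s :+ x) refl s x
    where open Solver commutativeSemiring using (solve; _:=_; _:+_; _:*_; con)

  eval-linear-root : ∀ {s x} → s ≈ x → eval (linear s) x ≈ 0#
  eval-linear-root {s} {x} e = trans (eval-linear s x) (trans (+-congʳ e) (x+x≈0 x))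

  linear≉0 : ∀ s → ¬ (linear s ≈ₚ [])
  linear≉0 s e = 1≉0 (at e 1)

  -- The remainder by `linear s` is a constant, namely the value of p at s.
  factorTheorem : ∀ p {s} → eval p s ≈ 0# → ∃[ q ] p ≈ₚ linear s *ₚ q
  factorTheorem p {s} e = quot (s ∷ []) p , (begin
    p                                          ≈⟨ division (s ∷ []) p ⟩
    quot (s ∷ []) p *ₚ linear s +ₚ Vec.toList (rem (s ∷ []) p)
      ≈⟨ P.+-congˡ {quot (s ∷ []) p *ₚ linear s} (remainder-zero (rem (s ∷ []) p) (division (s ∷ []) p)) ⟩
    quot (s ∷ []) p *ₚ linear s +ₚ []          ≈⟨ P.+-identityʳ _ ⟩
    quot (s ∷ []) p *ₚ linear s                ≈⟨ P.*-comm (quot (s ∷ []) p) (linear s) ⟩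
    linear s *ₚ quot (s ∷ []) p                ∎)
    where
    open import Relation.Binary.Reasoning.Setoid P.setoid
    remainder-zero : (v : Vec Carrier 1) → p ≈ₚ quot (s ∷ []) p *ₚ linear s +ₚ Vec.toList v →
      Vec.toList v ≈ₚ []
    remainder-zero (c ∷ []) eq = coeff-≈ λ
      { zero → R.begin
          c R.≈⟨ +-identityˡ c ⟨
          0# + c R.≈⟨ +-cong (zeroʳ q) (eval-C c s) ⟨
          q * 0# + eval (c ∷ []) s
            R.≈⟨ +-congʳ (trans (eval-* (quot (s ∷ []) p) (linear s) s) (*-congˡ (eval-linear-root refl))) ⟨
          eval (quot (s ∷ []) p *ₚ linear s) s + eval (c ∷ []) s
            R.≈⟨ eval-+ (quot (s ∷ []) p *ₚ linear s) (c ∷ []) s ⟨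
          eval (quot (s ∷ []) p *ₚ linear s +ₚ (c ∷ [])) s  R.≈⟨ eval-congˡ s eq ⟨
          eval p s R.≈⟨ e ⟩
          0# R.∎
      ; (suc n) → refl }
      where
      module R = SetoidReasoning setoid
      q = eval (quot (s ∷ []) p) s

  rootProduct : List Carrier → Poly
  rootProduct = foldr (λ s p → linear s *ₚ p) (C 1#)

  hasDegree-rootProduct : ∀ ss → HasDegree (rootProduct ss) (length ss)
  hasDegree-rootProduct []       = 1≉0 , λ { (suc m) _ → refl }
  hasDegree-rootProduct (s ∷ ss) = hasDegree-* (linear s) (rootProduct ss)
    (1≉0 , λ { (suc (suc m)) _ → refl ; (suc zero) (s≤s ()) }) (hasDegree-rootProduct ss)

  -- Roots are listed with multiplicity. A leading coefficient is carried along because the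
  -- irreducible factors and their cofactors need not be monic.
  record HasRoots (p : Poly) (ss : List Carrier) : Set (c ⊔ ℓ) where
    constructor hasRoots
    field
      leading       : Carrier
      leading≉0     : leading ≉ 0#
      factorization : p ≈ₚ C leading *ₚ rootProduct ss

  hasRoots-length : ∀ {p ss n} → HasRoots p ss → HasDegree p n → length ss ≡ n
  hasRoots-length {p} {ss} (hasRoots u u≉0 e) hp = hasDegree-unique {C u *ₚ rootProduct ss}
    (hasDegree-* (C u) (rootProduct ss) {0} (u≉0 , λ { (suc m) _ → refl }) (hasDegree-rootProduct ss))
    (hasDegree-cong {p} e hp)

  root-rootProduct : ∀ ss {x} → eval (rootProduct ss) x ≈ 0# → Any (_≈ x) ss
  root-rootProduct []       e = contradiction (trans (sym (eval-C 1# _)) e) 1≉0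
  root-rootProduct (s ∷ ss) {x} e = Sum.[ here ∘ linear-root , there ∘ root-rootProduct ss ]′
    (eval-*-split (linear s) (rootProduct ss) e)
    where
    linear-root : eval (linear s) x ≈ 0# → s ≈ x
    linear-root e = x+y≈0⇒x≈y (trans (sym (eval-linear s x)) e)

  rootProduct-root : ∀ {ss x} → Any (_≈ x) ss → eval (rootProduct ss) x ≈ 0#
  rootProduct-root {s ∷ ss} (here e)  = eval-*-zeroˡ (linear s) (rootProduct ss) (eval-linear-root e)
  rootProduct-root {s ∷ ss} (there i) = eval-*-zeroʳ (linear s) (rootProduct ss) (rootProduct-root i)

  hasRoots-root : ∀ {p ss x} → HasRoots p ss → eval p x ≈ 0# → Any (_≈ x) ss
  hasRoots-root {p} {ss} {x} (hasRoots u u≉0 e) px≈0 = Sum.[ absurd , root-rootProduct ss ]′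
    (eval-*-split (C u) (rootProduct ss) (trans (sym (eval-congˡ {p} {C u *ₚ rootProduct ss} x e)) px≈0))
    where
    absurd : eval (C u) x ≈ 0# → Any (_≈ x) ss
    absurd u≈0 = contradiction (trans (sym (eval-C u x)) u≈0) u≉0

  root-hasRoots : ∀ {p ss x} → HasRoots p ss → Any (_≈ x) ss → eval p x ≈ 0#
  root-hasRoots {p} {ss} {x} (hasRoots u _ e) i = trans (eval-congˡ {p} {C u *ₚ rootProduct ss} x e)
    (eval-*-zeroʳ (C u) (rootProduct ss) (rootProduct-root i))

  private
    -- Degrees add over a domain, so a factor of a nonzero constant is constant.
    constant : ∀ {p q u} → u ≉ 0# → p *ₚ q ≈ₚ C u → HasRoots p []
    constant {p} {q} {u} u≉0 e with degree p | degree q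
    ... | inj₁ p≈0 | _ = contradiction (at (P.trans (P.sym e) (P.trans (P.*-congʳ {q} p≈0) (P.zeroˡ q))) 0) u≉0
    ... | inj₂ _ | inj₁ q≈0 = contradiction (at (P.trans (P.sym e) (P.trans (P.*-congˡ {p} q≈0) (P.zeroʳ p))) 0) u≉0
    ... | inj₂ (m , hp) | inj₂ (n , hq)
      with ≡.refl ← ℕ.m+n≡0⇒m≡0 m (hasDegree-unique {p *ₚ q} (hasDegree-* p q hp hq)
             (hasDegree-cong {C u} (P.sym e) (u≉0 , λ { (suc m) _ → refl }))) =
      hasRoots (coeff p 0) (proj₁ hp)
        (P.trans (coeff-≈ λ { zero → refl ; (suc k) → proj₂ hp (suc k) z<s }) (P.sym (P.*-identityʳ (C (coeff p 0)))))

  -- Unique factorization for linear factors: a root s of p q is a root of p or of q, and `linear s`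
  -- is cancelled from that factor and from the product.
  splitRoots : ∀ ss {p q} → HasRoots (p *ₚ q) ss →
    ∃[ ss₁ ] ∃[ ss₂ ] ss ↭ ss₁ ++ ss₂ × HasRoots p ss₁ × HasRoots q ss₂
  splitRoots [] {p} {q} (hasRoots u u≉0 e) = [] , [] , ↭.refl ,
    constant {p} {q} u≉0 e′ , constant {q} {p} u≉0 (P.trans (P.*-comm q p) e′)
    where e′ = P.trans e (P.*-identityʳ (C u))
  splitRoots (s ∷ ss) {p} {q} (hasRoots u u≉0 e) = split
    (eval-*-split p q (root-hasRoots {p *ₚ q} {s ∷ ss} (hasRoots u u≉0 e) (here refl)))
    where
    extend : ∀ {p p′ ss} → p ≈ₚ linear s *ₚ p′ → HasRoots p′ ss → HasRoots p (s ∷ ss)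
    extend {ss = ss} e (hasRoots v v≉0 e′) = hasRoots v v≉0 (P.trans e (P.trans (P.*-congˡ {linear s} e′)
      (x∙yz≈y∙xz (linear s) (C v) (rootProduct ss))))

    cancel : ∀ {r} → p *ₚ q ≈ₚ linear s *ₚ r → HasRoots r ss
    cancel {r} eq = hasRoots u u≉0 (DP.*-cancelˡ {linear s} (linear≉0 s) (P.trans (P.sym eq) (P.trans e
      (x∙yz≈y∙xz (C u) (linear s) (rootProduct ss)))))

    split : eval p s ≈ 0# ⊎ eval q s ≈ 0# →
      ∃[ ss₁ ] ∃[ ss₂ ] (s ∷ ss) ↭ ss₁ ++ ss₂ × HasRoots p ss₁ × HasRoots q ss₂
    split (inj₁ ps≈0) with p′ , ep ← factorTheorem p ps≈0
      with ss₁ , ss₂ , perm , h₁ , h₂ ← splitRoots ss {p′} {q} (cancel (P.trans (P.*-congʳ {q} ep) (P.*-assoc (linear s) p′ q))) =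
      s ∷ ss₁ , ss₂ , prep s perm , extend {p} ep h₁ , h₂
    split (inj₂ qs≈0) with q′ , eq ← factorTheorem q qs≈0
      with ss₁ , ss₂ , perm , h₁ , h₂ ← splitRoots ss {p} {q′} (cancel (P.trans (P.*-congˡ {p} eq)
        (x∙yz≈y∙xz p (linear s) q′))) =
      ss₁ , s ∷ ss₂ , ↭-trans (prep s perm) (↭-sym (shift s ss₁ ss₂)) , h₁ , extend {q} eq h₂

  -- Stated through values rather than a gcd, the condition passes to factors by Leibniz' rule
  -- alone; for a split polynomial it says that all roots are simple.
  Separable : Poly → Set (c ⊔ ℓ)
  Separable p = ∀ x → eval p x ≈ 0# → derivative p x ≉ 0#

  separable-cong : ∀ {p q} → p ≈ₚ q → Separable p → Separable q
  separable-cong {p} {q} e sep x qx≈0 q′x≈0 =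
    sep x (trans (eval-congˡ {p} {q} x e) qx≈0) (trans (derivative-cong {p} {q} x e) q′x≈0)

  module _ {p q} (sep : Separable (p *ₚ q)) where

    private
      derivative-vanishes : ∀ {x} → derivative p x * eval q x ≈ 0# → eval p x * derivative q x ≈ 0# →
        derivative (p *ₚ q) x ≈ 0#
      derivative-vanishes {x} e e′ = trans (derivative-* p q x) (trans (+-cong e e′) (+-identityˡ 0#))

    -- At a common root both terms of (p q)′ = p′ q + p q′ vanish.
    separable-disjoint : ∀ x → eval p x ≈ 0# → eval q x ≉ 0#
    separable-disjoint x px qx = sep x (eval-*-zeroˡ p q px)
      (derivative-vanishes (trans (*-congˡ qx) (zeroʳ (derivative p x))) (trans (*-congʳ px) (zeroˡ (derivative q x))))

    separable-*ˡ : Separable p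
    separable-*ˡ x px p′x = sep x (eval-*-zeroˡ p q px)
      (derivative-vanishes (trans (*-congʳ p′x) (zeroˡ (eval q x))) (trans (*-congʳ px) (zeroˡ (derivative q x))))

    separable-*ʳ : Separable q
    separable-*ʳ x qx q′x = sep x (eval-*-zeroʳ p q qx)
      (derivative-vanishes (trans (*-congˡ qx) (zeroʳ (derivative p x))) (trans (*-congˡ q′x) (zeroʳ (eval p x))))

  separable-rootProduct : ∀ ss → Separable (rootProduct ss) → AllPairs _≉_ ss
  separable-rootProduct []       sep = []
  separable-rootProduct (s ∷ ss) sep =
    All.tabulate (λ x∈ss s≈x → separable-disjoint {linear s} {rootProduct ss} sep _ (eval-linear-root s≈x)
      (rootProduct-root (lose x∈ss refl)))
    ∷ separable-rootProduct ss (separable-*ʳ {linear s} {rootProduct ss} sep)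

  separable-distinct : ∀ {p ss} → Separable p → HasRoots p ss → AllPairs _≉_ ss
  separable-distinct {p} {ss} sep (hasRoots u _ e) =
    separable-rootProduct ss (separable-*ʳ {C u} {rootProduct ss} (separable-cong {p} {C u *ₚ rootProduct ss} e sep))

  product : List Poly → Poly
  product = polynomialProduct commutativeRing

  separable-product : ∀ qs → Separable (product qs) →
    ∀ x → AllPairs (λ p q → ¬ (eval p x ≈ 0# × eval q x ≈ 0#)) qs
  product-root : ∀ {qs x} → Any (λ q → eval q x ≈ 0#) qs → eval (product qs) x ≈ 0#
  product-root {q ∷ qs} (here e)  = eval-*-zeroˡ q (product qs) e
  product-root {q ∷ qs} (there i) = eval-*-zeroʳ q (product qs) (product-root i)

  separable-product []       sep x = []
  separable-product (q ∷ qs) sep x =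
    All.tabulate (λ r∈qs (qx , rx) → separable-disjoint {q} {product qs} sep x qx (product-root (lose r∈qs rx)))
    ∷ separable-product qs (separable-*ʳ {q} {product qs} sep) x

  root-product : ∀ qs {x} → eval (product qs) x ≈ 0# → Any (λ q → eval q x ≈ 0#) qs
  root-product []       e = contradiction (trans (sym (eval-C 1# _)) e) 1≉0
  root-product (q ∷ qs) e = Sum.[ here , there ∘ root-product qs ]′ (eval-*-split q (product qs) e)

module RootCount (F : Field a ℓ₁ ℓ₂) (D : IntegralDomain b ℓb)
  (x+x≈0 : HasCharacteristic2 (IntegralDomain.commutativeRing D))
  {φ : Field.Carrier F → IntegralDomain.Carrier D}
  (φ-hom : RingHomomorphisms.IsRingHomomorphism (Field.commutativeRing F) (IntegralDomain.commutativeRing D) φ)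
  where

  open IntegralDomain D using (_≈_; 0#)
  private
    A = Field.commutativeRing F
    B = IntegralDomain.commutativeRing D
    module F = Field F
    module D = IntegralDomain D
    module PF = Polynomial A
    module PD = Polynomial B
  open LinearFactors D x+x≈0
  open MapPolynomial {A = A} {B} φ-hom
  open Factorization F using (Irreducible)

  isRoot? : ∀ q x → Dec (PD.eval (mapₚ q) x ≈ 0#)
  isRoot? q x = PD.eval (mapₚ q) x D.≟ 0#

  module _ {q} (q-irreducible : Irreducible q) where

    record SplitOff (ss : List D.Carrier) : Set (a ⊔ b ⊔ ℓb) where
      constructor splitting
      field
        {cofactor} : PF.Poly
        {ss₁ ss₂}  : List D.Carrier
        partition  : ss ↭ ss₁ ++ ss₂
        roots₁     : HasRoots (mapₚ cofactor) ss₁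
        roots₂     : HasRoots (mapₚ q) ss₂

    -- One common root suffices: it makes the irreducible `q` divide p already over F, and
    -- `splitRoots` distributes the roots of p.
    splitOff : ∀ {p ss} → HasRoots (mapₚ p) ss → Any (λ s → PD.eval (mapₚ q) s ≈ 0#) ss → SplitOff ss
    splitOff {p} {ss} h any = split (find any)
      where
      module PD' = CommutativeRing PD.polynomialRing
      open HasRoots h

      splitQuotient : ∀ {r} → r PF.*ₚ q PF.≈ₚ p → SplitOff ss
      splitQuotient {r} rq≈p with splitRoots ss {mapₚ r} {mapₚ q} (hasRoots leading leading≉0
        (PD'.trans (PD'.sym (map-* r q)) (PD'.trans (map-cong rq≈p) factorization)))
      ... | _ , _ , perm , h₁ , h₂ = splitting perm h₁ h₂

      split : ∃[ s ] s ∈ ss × PD.eval (mapₚ q) s ≈ 0# → SplitOff ss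
      split (s , s∈ss , qs≈0) = splitQuotient {_∣ʳ_.quotient q∣p} (_∣ʳ_.equality q∣p)
        where
        q∣p = MinimalPolynomial.irreducible-∣ F B (λ p → PD.eval (mapₚ p) s)
          (evalAt-isRingHomomorphism s) D.1≉0 q-irreducible qs≈0 p
          (root-hasRoots h (lose s∈ss D.refl))

    roots-satisfy : ∀ {ss} → HasRoots (mapₚ q) ss → All (λ s → PD.eval (mapₚ q) s ≈ 0#) ss
    roots-satisfy h = All.tabulate λ s∈ss → root-hasRoots h (lose s∈ss D.refl)

    module _ {d} (q-degree : PD.HasDegree (mapₚ q) d) where

      module _ {ss} (any : Any (λ s → PD.eval (mapₚ q) s ≈ 0#) ss) (split : SplitOff ss) where

        open SplitOff split

        length-split : length ss ≡ length ss₁ ℕ.+ length ss₂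
        length-split = ≡.trans (↭-length partition) (List.length-++ ss₁)

        count-split : count (isRoot? q) ss ≡ count (isRoot? q) ss₁ ℕ.+ d
        count-split = ≡.trans (↭-length (filter-↭ (isRoot? q) partition))
          (≡.trans (≡.cong length (List.filter-++ (isRoot? q) ss₁ ss₂))
          (≡.trans (List.length-++ (filter (isRoot? q) ss₁))
            (≡.cong (count (isRoot? q) ss₁ ℕ.+_)
              (≡.trans (count-all (isRoot? q) (roots-satisfy roots₂)) (hasRoots-length roots₂ q-degree)))))

        shorter : length ss₁ ℕ.< length ss
        shorter = ≡.subst (length ss₁ ℕ.<_) (≡.sym length-split) (ℕ.m<m+n (length ss₁)
          (nonempty (hasRoots-root roots₂ (proj₂ (proj₂ (find any))))))
          where
          nonempty : ∀ {x ss} → Any (_≈ x) ss → 0 ℕ.< length ss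
          nonempty (here _)  = z<s
          nonempty (there _) = z<s

      -- The count is with multiplicity. Without a common root it is 0. Otherwise `q` splits off d
      -- entries, all of them roots of `q`, and the recursion continues with the cofactor, whose
      -- root list is shorter because `q` has at least one root. This stands in for the orbits of a
      -- Galois group.
      degree-∣-count : ∀ {p ss} → Acc ℕ._<_ (length ss) → HasRoots (mapₚ p) ss →
        d ℕ.∣ count (isRoot? q) ss
      degree-∣-count {p} {ss} (acc rs) h = byCases (Any.any? (isRoot? q) ss)
        where
        byCases : Dec (Any (λ s → PD.eval (mapₚ q) s ≈ 0#) ss) → d ℕ.∣ count (isRoot? q) ss
        byCases (no ¬any) = ≡.subst (d ℕ.∣_) (≡.sym (count-none (isRoot? q) ¬any)) (d ℕ.∣0)
        byCases (yes any) = ≡.subst (d ℕ.∣_) (≡.sym (count-split any split))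
          (ℕ.∣m∣n⇒∣m+n (degree-∣-count {SplitOff.cofactor split} (rs (shorter any split)) (SplitOff.roots₁ split)) ℕ.∣-refl)
          where split = splitOff {p} h any

      -- After splitting off `q`, whose d roots exhaust the list, no root is left for the cofactor.
      allRoots : ∀ {p ss} → HasRoots (mapₚ p) ss → length ss ≡ d →
        Any (λ s → PD.eval (mapₚ q) s ≈ 0#) ss → ∃[ ss′ ] ss ↭ ss′ × HasRoots (mapₚ q) ss′
      allRoots {p} {ss} h eq any = conclude (splitOff {p} h any)
        where
        conclude : SplitOff ss → ∃[ ss′ ] ss ↭ ss′ × HasRoots (mapₚ q) ss′
        conclude (splitting {ss₁ = []} {ss₂} partition _ roots₂) = ss₂ , partition , roots₂
        conclude split@(splitting {ss₁ = x ∷ ss₁} {ss₂} _ _ roots₂) = contradiction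
          (≡.trans (≡.sym (length-split any split)) (≡.trans eq (≡.sym (hasRoots-length roots₂ q-degree))))
          (ℕ.<⇒≢ (ℕ.m<n+m (length ss₂) {suc (length ss₁)} z<s) ∘ ≡.sym)

-- Subsets and their sums

subsets : ∀ n → ℕ → List (Subset n)
subsets zero    zero    = [ [] ]
subsets zero    (suc k) = []
subsets (suc n) zero    = List.map (outside ∷_) (subsets n zero)
subsets (suc n) (suc k) = List.map (outside ∷_) (subsets n (suc k)) ++ List.map (inside ∷_) (subsets n k)

length-subsets : ∀ n k → length (subsets n k) ≡ n choose k
length-subsets zero    zero    = ≡.refl
length-subsets zero    (suc k) = ≡.refl
length-subsets (suc n) zero    = ≡.trans (List.length-map _ (subsets n zero)) (length-subsets n zero)
length-subsets (suc n) (suc k) = begin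
  length (List.map (outside ∷_) (subsets n (suc k)) ++ List.map (inside ∷_) (subsets n k))
    ≡⟨ List.length-++ (List.map (outside ∷_) (subsets n (suc k))) ⟩
  length (List.map (outside ∷_) (subsets n (suc k))) ℕ.+ length (List.map (inside ∷_) (subsets n k))
    ≡⟨ ≡.cong₂ ℕ._+_ (List.length-map _ (subsets n (suc k))) (List.length-map _ (subsets n k)) ⟩
  length (subsets n (suc k)) ℕ.+ length (subsets n k)
    ≡⟨ ≡.cong₂ ℕ._+_ (length-subsets n (suc k)) (length-subsets n k) ⟩
  n choose suc k ℕ.+ n choose k   ≡⟨ ℕ.+-comm (n choose suc k) (n choose k) ⟩
  n choose k ℕ.+ n choose suc k   ≡⟨ nCk+nC[k+1]≡[n+1]C[k+1] n k ⟩
  suc n choose suc k         ∎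
  where open ≡.≡-Reasoning

subsets-size : ∀ n k → All (λ A → ∣ A ∣ ≡ k) (subsets n k)
subsets-size zero    zero    = ≡.refl ∷ []
subsets-size zero    (suc k) = []
subsets-size (suc n) zero    = All.map⁺ (subsets-size n zero)
subsets-size (suc n) (suc k) =
  All.++⁺ (All.map⁺ (subsets-size n (suc k))) (All.map⁺ (All.map (≡.cong suc) (subsets-size n k)))

∈-subsets : ∀ (A : Subset n) {k} → ∣ A ∣ ≡ k → A ∈ subsets n k
∈-subsets []            ≡.refl = here ≡.refl
∈-subsets {suc n} (outside ∷ A) {zero}  eq = ∈.∈-map⁺ (outside ∷_) (∈-subsets A eq)
∈-subsets {suc n} (outside ∷ A) {suc k} eq = ∈.∈-++⁺ˡ (∈.∈-map⁺ (outside ∷_) (∈-subsets A eq))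
∈-subsets {suc n} (inside  ∷ A) {suc k} eq =
  ∈.∈-++⁺ʳ _ (∈.∈-map⁺ (inside ∷_) (∈-subsets A (ℕ.suc-injective eq)))

subsets-unique : ∀ n k → Unique (subsets n k)
subsets-unique zero    zero    = [] ∷ []
subsets-unique zero    (suc k) = []
subsets-unique (suc n) zero    = Unique.map⁺ ∷-injectiveʳ (subsets-unique n zero)
subsets-unique (suc n) (suc k) = Unique.++⁺
  (Unique.map⁺ ∷-injectiveʳ (subsets-unique n (suc k)))
  (Unique.map⁺ ∷-injectiveʳ (subsets-unique n k))
  disjoint
  where
  disjoint : ∀ {A} → ¬ (A ∈ List.map (outside ∷_) (subsets n (suc k)) × A ∈ List.map (inside ∷_) (subsets n k))
  disjoint (i , j) with ∈.∈-map⁻ (outside ∷_) i | ∈.∈-map⁻ (inside ∷_) j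
  ... | _ , _ , ≡.refl | _ , _ , ()

infixl 6 _△_
-- Symmetric difference is addition of binary words. In characteristic 2 subset sums are additive
-- for it, so relations among the roots form a binary linear code.
_△_ : Subset n → Subset n → Subset n
_△_ = Vec.zipWith _xor_

∣△∣ : (A B : Subset n) → ∣ A △ B ∣ ℕ.+ (∣ A ∩ B ∣ ℕ.+ ∣ A ∩ B ∣) ≡ ∣ A ∣ ℕ.+ ∣ B ∣
∣△∣ []            []            = ≡.refl
∣△∣ (outside ∷ A) (outside ∷ B) = ∣△∣ A B
∣△∣ (outside ∷ A) (inside  ∷ B) = ≡.trans (≡.cong suc (∣△∣ A B)) (≡.sym (ℕ.+-suc ∣ A ∣ ∣ B ∣))
∣△∣ (inside  ∷ A) (outside ∷ B) = ≡.cong suc (∣△∣ A B)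
∣△∣ (inside  ∷ A) (inside  ∷ B) = begin
  d ℕ.+ suc (i ℕ.+ suc i)    ≡⟨ ≡.cong (λ j → d ℕ.+ suc j) (ℕ.+-suc i i) ⟩
  d ℕ.+ suc (suc (i ℕ.+ i))  ≡⟨ ℕ.+-suc d _ ⟩
  suc (d ℕ.+ suc (i ℕ.+ i))  ≡⟨ ≡.cong suc (ℕ.+-suc d _) ⟩
  suc (suc (d ℕ.+ (i ℕ.+ i)))  ≡⟨ ≡.cong (2 ℕ.+_) (∣△∣ A B) ⟩
  suc (suc (∣ A ∣ ℕ.+ ∣ B ∣))  ≡⟨ ≡.cong suc (ℕ.+-suc ∣ A ∣ ∣ B ∣) ⟨
  suc (∣ A ∣ ℕ.+ suc ∣ B ∣)    ∎
  where
  open ≡.≡-Reasoning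
  d = ∣ A △ B ∣
  i = ∣ A ∩ B ∣

∣△∣≤ : (A B : Subset n) → ∣ A △ B ∣ ℕ.≤ ∣ A ∣ ℕ.+ ∣ B ∣
∣△∣≤ A B = ≡.subst (∣ A △ B ∣ ℕ.≤_) (∣△∣ A B) (ℕ.m≤m+n ∣ A △ B ∣ _)

∣△∣≡0 : (A B : Subset n) → ∣ A △ B ∣ ≡ 0 → A ≡ B
∣△∣≡0 []            []            eq = ≡.refl
∣△∣≡0 (outside ∷ A) (outside ∷ B) eq = ≡.cong (outside ∷_) (∣△∣≡0 A B eq)
∣△∣≡0 (inside  ∷ A) (inside  ∷ B) eq = ≡.cong (inside ∷_) (∣△∣≡0 A B eq)

partition : (W : Subset n) → ∀ j k → ∣ W ∣ ≡ j ℕ.+ k →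
  ∃[ A ] ∃[ B ] ∣ A ∣ ≡ j × ∣ B ∣ ≡ k × W ≡ A △ B
partition []            zero    zero    eq = [] , [] , ≡.refl , ≡.refl , ≡.refl
partition (outside ∷ W) j       k       eq with partition W j k eq
... | A , B , eA , eB , ≡.refl = outside ∷ A , outside ∷ B , eA , eB , ≡.refl
partition (inside ∷ W)  zero    (suc k) eq with partition W zero k (ℕ.suc-injective eq)
... | A , B , eA , eB , ≡.refl = outside ∷ A , inside ∷ B , eA , ≡.cong suc eB , ≡.refl
partition (inside ∷ W)  (suc j) k       eq with partition W j k (ℕ.suc-injective eq)
... | A , B , eA , eB , ≡.refl = inside ∷ A , outside ∷ B , ≡.cong suc eA , eB , ≡.refl

∣insertAt-inside∣ : (A : Subset n) → ∀ i → ∣ insertAt A i inside ∣ ≡ suc ∣ A ∣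
∣insertAt-inside∣ A             zero    = ≡.refl
∣insertAt-inside∣ (outside ∷ A) (suc i) = ∣insertAt-inside∣ A i
∣insertAt-inside∣ (inside  ∷ A) (suc i) = ≡.cong suc (∣insertAt-inside∣ A i)

-- The inserted point lies in both sets or in neither, and so cancels.
∣insertAt-△∣ : (A B : Subset n) → ∀ i {s} → ∣ insertAt A i s △ insertAt B i s ∣ ≡ ∣ A △ B ∣
∣insertAt-△∣ A             B             zero    {outside} = ≡.refl
∣insertAt-△∣ A             B             zero    {inside}  = ≡.refl
∣insertAt-△∣ (outside ∷ A) (outside ∷ B) (suc i) = ∣insertAt-△∣ A B i
∣insertAt-△∣ (outside ∷ A) (inside  ∷ B) (suc i) = ≡.cong suc (∣insertAt-△∣ A B i)
∣insertAt-△∣ (inside  ∷ A) (outside ∷ B) (suc i) = ≡.cong suc (∣insertAt-△∣ A B i)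
∣insertAt-△∣ (inside  ∷ A) (inside  ∷ B) (suc i) = ∣insertAt-△∣ A B i

count-map : {A : Set a} {B : Set b} {P : B → Set ℓ} (P? : ∀ y → Dec (P y)) (g : A → B) → ∀ xs →
  count P? (List.map g xs) ≡ count (λ x → P? (g x)) xs
count-map P? g []       = ≡.refl
count-map P? g (x ∷ xs) with P? (g x)
... | yes _ = ≡.cong suc (count-map P? g xs)
... | no  _ = count-map P? g xs

count-≐ : {A : Set a} {P : A → Set b} {Q : A → Set c} (P? : ∀ x → Dec (P x)) (Q? : ∀ x → Dec (Q x)) →
  (∀ {x} → P x → Q x) → (∀ {x} → Q x → P x) → ∀ xs → count P? xs ≡ count Q? xs
count-≐ P? Q? P⇒Q Q⇒P xs = ≡.cong length (List.filter-≐ P? Q? (P⇒Q , Q⇒P) xs)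

count-++ : {A : Set a} {P : A → Set b} (P? : ∀ x → Dec (P x)) → ∀ xs ys →
  count P? (xs ++ ys) ≡ count P? xs ℕ.+ count P? ys
count-++ P? xs ys = ≡.trans (≡.cong length (List.filter-++ P? xs ys)) (List.length-++ (filter P? xs))

_⊆?_ : (A B : Subset n) → Dec (A ⊆ B)
_⊆?_ = Subset._⊆?_

-- Pascal's rule: `subsets` is built by the same recursion, and when the first point is outside `B`
-- the half of the list that contains it contributes nothing.
count-⊆ : (B : Subset n) → ∀ k → count (_⊆? B) (subsets n k) ≡ ∣ B ∣ choose k
count-⊆ []            zero    = ≡.refl
count-⊆ []            (suc k) = ≡.refl
count-⊆ {suc n} (s ∷ B) zero = ≡.trans (count-map (_⊆? (s ∷ B)) (outside ∷_) (subsets n zero))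
  (≡.trans (count-≐ (λ A → (outside ∷ A) ⊆? (s ∷ B)) (_⊆? B) Subset.drop-∷-⊆ Subset.out⊆ (subsets n zero))
    (count-⊆ B zero))
count-⊆ {suc n} (s ∷ B) (suc k) = begin
  count (_⊆? (s ∷ B)) (subsets (suc n) (suc k))  ≡⟨ count-++ (_⊆? (s ∷ B)) (List.map (outside ∷_) (subsets n (suc k))) _ ⟩
  count (_⊆? (s ∷ B)) (List.map (outside ∷_) (subsets n (suc k))) ℕ.+
    count (_⊆? (s ∷ B)) (List.map (inside ∷_) (subsets n k))
    ≡⟨ ≡.cong₂ ℕ._+_
         (≡.trans (count-map (_⊆? (s ∷ B)) (outside ∷_) (subsets n (suc k)))
         (≡.trans (count-≐ (λ A → (outside ∷ A) ⊆? (s ∷ B)) (_⊆? B) Subset.drop-∷-⊆ Subset.out⊆ (subsets n (suc k)))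
           (count-⊆ B (suc k))))
         (count-map (_⊆? (s ∷ B)) (inside ∷_) (subsets n k)) ⟩
  ∣ B ∣ choose suc k ℕ.+ count (λ A → (inside ∷ A) ⊆? (s ∷ B)) (subsets n k) ≡⟨ rest s ⟩
  ∣ s ∷ B ∣ choose suc k ∎
  where
  open ≡.≡-Reasoning
  rest : ∀ s → ∣ B ∣ choose suc k ℕ.+ count (λ A → (inside ∷ A) ⊆? (s ∷ B)) (subsets n k) ≡ ∣ s ∷ B ∣ choose suc k
  rest outside = ≡.trans (≡.cong (∣ B ∣ choose suc k ℕ.+_)
    (count-none (λ A → (inside ∷ A) ⊆? (outside ∷ B)) {subsets n k} λ any → in⊈out (proj₂ (proj₂ (find any)))))
    (ℕ.+-identityʳ _)
    where
    in⊈out : ∀ {A} → ¬ (inside ∷ A) ⊆ (outside ∷ B)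
    in⊈out p with () ← p Vec.here
  rest inside = begin
    ∣ B ∣ choose suc k ℕ.+ count (λ A → (inside ∷ A) ⊆? (inside ∷ B)) (subsets n k)
      ≡⟨ ≡.cong (∣ B ∣ choose suc k ℕ.+_) (≡.trans
           (count-≐ (λ A → (inside ∷ A) ⊆? (inside ∷ B)) (_⊆? B) Subset.drop-∷-⊆ Subset.in⊆in (subsets n k))
           (count-⊆ B k)) ⟩
    ∣ B ∣ choose suc k ℕ.+ ∣ B ∣ choose k  ≡⟨ ℕ.+-comm (∣ B ∣ choose suc k) _ ⟩
    ∣ B ∣ choose k ℕ.+ ∣ B ∣ choose suc k  ≡⟨ nCk+nC[k+1]≡[n+1]C[k+1] ∣ B ∣ k ⟩
    suc ∣ B ∣ choose suc k  ∎

module SubsetSum (R : CommutativeRing c ℓ) (x+x≈0 : HasCharacteristic2 R) where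

  open CommutativeRing R hiding (zero)
  open RawMonoidDefs +-rawMonoid using () renaming (sum to ∑)
  open import Algebra.Properties.CommutativeSemigroup +-commutativeSemigroup using (interchange)

  subsetSum : (Fin n → Carrier) → Subset n → Carrier
  subsetSum r B = ∑ λ i → if lookup B i then r i else 0#

  subsetSum-△ : (r : Fin n → Carrier) → ∀ A B → subsetSum r (A △ B) ≈ subsetSum r A + subsetSum r B
  subsetSum-△ r []      []      = sym (+-identityˡ 0#)
  subsetSum-△ r (s ∷ A) (u ∷ B) =
    trans (+-cong (head s u) (subsetSum-△ (r ∘ suc) A B)) (interchange _ _ _ _)
    where
    head : ∀ s u → (if s xor u then r zero else 0#) ≈
                   (if s then r zero else 0#) + (if u then r zero else 0#)
    head outside outside = sym (+-identityˡ 0#)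
    head outside inside  = sym (+-identityˡ _)
    head inside  outside = sym (+-identityʳ _)
    head inside  inside  = sym (x+x≈0 (r zero))

  subsetSum-⊥ : (r : Fin n → Carrier) → ∀ A → ∣ A ∣ ≡ 0 → subsetSum r A ≈ 0#
  subsetSum-⊥ r []            eq = refl
  subsetSum-⊥ r (outside ∷ A) eq = trans (+-identityˡ _) (subsetSum-⊥ (r ∘ suc) A eq)

  △-zeroSum : (r : Fin n → Carrier) → ∀ A B → subsetSum r A ≈ subsetSum r B → subsetSum r (A △ B) ≈ 0#
  △-zeroSum r A B e = trans (subsetSum-△ r A B) (trans (+-congʳ e) (x+x≈0 _))

  -- d is smaller than the minimum distance of the binary code of the
  -- additive relations among the r i.
  MinimumDistance : (Fin n → Carrier) → ℕ → Set ℓ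
  MinimumDistance r d = ∀ W → ∣ W ∣ ℕ.≤ d → subsetSum r W ≈ 0# → ∣ W ∣ ≡ 0

  Octad : (Fin n → Carrier) → Subset n → Set ℓ
  Octad r B = ∣ B ∣ ≡ 8 × subsetSum r B ≈ 0#

  -- The sextet property of the Golay code: the 4-sets with a given sum cover all points.
  Tetrads : (Fin n → Carrier) → Set ℓ
  Tetrads r = ∀ Q → ∣ Q ∣ ≡ 4 → ∀ x → ∃[ T ] x ∈ₛ T × ∣ T ∣ ≡ 4 × subsetSum r T ≈ subsetSum r Q

module SubsetSumProduct (D : IntegralDomain c ℓ)
  (x+x≈0 : HasCharacteristic2 (IntegralDomain.commutativeRing D)) where

  open IntegralDomain D hiding (zero)
  open Polynomial commutativeRing
  open LinearFactors D x+x≈0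
  open SubsetSum commutativeRing x+x≈0
  open SubsetProduct polynomialRing
  private module P = CommutativeRing polynomialRing

  rootProduct-cong : ∀ {ss us} → ListPointwise _≈_ ss us → rootProduct ss ≈ₚ rootProduct us
  rootProduct-cong []       = P.refl
  rootProduct-cong {s ∷ ss} {u ∷ us} (e ∷ es) =
    P.*-cong {linear s} {linear u} (coeff-≈ λ { zero → e ; (suc _) → refl }) (rootProduct-cong es)

  rootProduct-++ : ∀ ss us → rootProduct (ss ++ us) ≈ₚ rootProduct ss *ₚ rootProduct us
  rootProduct-++ []       us = P.sym (P.*-identityˡ (rootProduct us))
  rootProduct-++ (s ∷ ss) us = P.trans (P.*-congˡ {linear s} (rootProduct-++ ss us))
    (P.sym (P.*-assoc (linear s) (rootProduct ss) (rootProduct us)))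

  sumsFrom : (Fin n → Carrier) → ℕ → Carrier → List Carrier
  sumsFrom {n} r k s = List.map (λ A → s + subsetSum r A) (subsets n k)

  private
    map-pointwise : ∀ {A B : Set} (g : A → Carrier) (h : B → Carrier) (ι : B → A) →
      (∀ y → g (ι y) ≈ h y) → ∀ ys → ListPointwise _≈_ (List.map g (List.map ι ys)) (List.map h ys)
    map-pointwise g h ι e []       = []
    map-pointwise g h ι e (y ∷ ys) = e y ∷ map-pointwise g h ι e ys

  -- Over the polynomial ring, adding the constant `C (r i)` to X + s gives again a linear
  -- polynomial, so every factor of the product stays linear. The offset s collects the roots
  -- already chosen and makes the induction go through.
  subsetProduct-sums : (r : Fin n → Carrier) → ∀ k s →
    subsetProduct k (List.tabulate (C ∘ r)) (linear s) ≈ₚ rootProduct (sumsFrom r k s)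
  subsetProduct-sums {zero}  r zero    s = P.trans
    (P.sym (P.*-identityʳ (linear s)))
    (rootProduct-cong {s ∷ []} (sym (+-identityʳ s) ∷ []))
  subsetProduct-sums {zero}  r (suc k) s = P.refl
  subsetProduct-sums {suc n} r zero    s = P.trans (subsetProduct-sums (r ∘ suc) zero s)
    (P.sym (rootProduct-cong (map-pointwise (λ A → s + subsetSum r A) (λ A → s + subsetSum (r ∘ suc) A)
      (outside ∷_) (λ A → +-congˡ (+-identityˡ _)) (subsets n zero))))
  subsetProduct-sums {suc n} r (suc k) s = begin
    subsetProduct (suc k) rs (linear s) *ₚ subsetProduct k rs (linear (s + r zero))
      ≈⟨ P.*-cong (subsetProduct-sums (r ∘ suc) (suc k) s) (subsetProduct-sums (r ∘ suc) k (s + r zero)) ⟩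
    rootProduct (sumsFrom (r ∘ suc) (suc k) s) *ₚ rootProduct (sumsFrom (r ∘ suc) k (s + r zero))
      ≈⟨ P.*-cong
           (rootProduct-cong (map-pointwise g (λ A → s + subsetSum (r ∘ suc) A)
             (outside ∷_) (λ A → +-congˡ (+-identityˡ _)) (subsets n (suc k))))
           (rootProduct-cong (map-pointwise g (λ A → s + r zero + subsetSum (r ∘ suc) A)
             (inside ∷_) (λ A → sym (+-assoc s (r zero) _)) (subsets n k))) ⟨
    rootProduct (List.map g (List.map (outside ∷_) (subsets n (suc k)))) *ₚ
      rootProduct (List.map g (List.map (inside ∷_) (subsets n k)))
      ≈⟨ rootProduct-++ (List.map g (List.map (outside ∷_) (subsets n (suc k)))) _ ⟨
    rootProduct (List.map g (List.map (outside ∷_) (subsets n (suc k))) ++ List.map g (List.map (inside ∷_) (subsets n k)))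
      ≡⟨ ≡.cong rootProduct (List.map-++ g (List.map (outside ∷_) (subsets n (suc k))) _) ⟨
    rootProduct (sumsFrom r (suc k) s) ∎
    where
    open import Relation.Binary.Reasoning.Setoid P.setoid
    rs = List.tabulate (C ∘ r ∘ suc)
    g = λ A → s + subsetSum r A

allPairs-∈ : {A : Set a} {R : A → A → Set ℓ} {xs : List A} → Unique xs →
  (∀ {x y} → x ∈ xs → y ∈ xs → x ≢ y → R x y) → AllPairs R xs
allPairs-∈ []       g = []
allPairs-∈ (x≢ ∷ u) g =
  All.tabulate (λ y∈ → g (here ≡.refl) (there y∈) (All.lookup x≢ y∈)) ∷
  allPairs-∈ u λ x∈ y∈ → g (there x∈) (there y∈)

sum-constant : {A : Set a} (g : A → ℕ) {c : ℕ} {xs : List A} → All (λ x → g x ≡ c) xs →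
  sum (List.map g xs) ≡ length xs ℕ.* c
sum-constant g []       = ≡.refl
sum-constant g (e ∷ es) = ≡.cong₂ ℕ._+_ e (sum-constant g es)

∈-△ˡ : ∀ {A B : Subset n} {x} → x ∈ₛ A → ¬ x ∈ₛ B → x ∈ₛ A △ B
∈-△ˡ {B = inside  ∷ B} Vec.here      x∉B = contradiction Vec.here x∉B
∈-△ˡ {B = outside ∷ B} Vec.here      x∉B = Vec.here
∈-△ˡ {B = _       ∷ B} (Vec.there i) x∉B = Vec.there (∈-△ˡ i (x∉B ∘ Vec.there))

∈-△ʳ : ∀ {A B : Subset n} {x} → ¬ x ∈ₛ A → x ∈ₛ B → x ∈ₛ A △ B
∈-△ʳ {A = inside  ∷ A} x∉A Vec.here      = contradiction Vec.here x∉A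
∈-△ʳ {A = outside ∷ A} x∉A Vec.here      = Vec.here
∈-△ʳ {A = _       ∷ A} x∉A (Vec.there i) = Vec.there (∈-△ʳ (x∉A ∘ Vec.there) i)

∈⇒∣∣≢0 : ∀ {A : Subset n} {x} → x ∈ₛ A → ∣ A ∣ ≢ 0
∈⇒∣∣≢0 {A = inside  ∷ A} (Vec.there i) ()
∈⇒∣∣≢0 {A = outside ∷ A} (Vec.there i) eq = ∈⇒∣∣≢0 i eq

removePoint : (S : Subset n) → ∀ {k} → ∣ S ∣ ≡ suc k → ∃[ x ] ∃[ Q ]
  ∣ Q ∣ ≡ k × ¬ x ∈ₛ Q × (∀ {y} → y ∈ₛ S → y ≡ x ⊎ y ∈ₛ Q)
removePoint (inside  ∷ S) eq = zero , outside ∷ S , ℕ.suc-injective eq , (λ ()) ,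
  λ { Vec.here → inj₁ ≡.refl ; (Vec.there i) → inj₂ (Vec.there i) }
removePoint (outside ∷ S) eq with removePoint S eq
... | x , Q , eQ , x∉Q , cover = suc x , outside ∷ Q , eQ , (λ { (Vec.there i) → x∉Q i }) ,
  λ { (Vec.there i) → Sum.map (≡.cong suc) Vec.there (cover i) }

-- Octads and the Steiner system

flagCount : (Bs : List (Subset n)) → ∀ k l → All (λ B → ∣ B ∣ ≡ k) Bs →
  (∀ S → ∣ S ∣ ≡ l → count (S ⊆?_) Bs ≡ 1) → length Bs ℕ.* (k choose l) ≡ n choose l
flagCount {n} Bs k l sizes once = begin
  length Bs ℕ.* (k choose l)
    ≡⟨ sum-constant (λ B → count (_⊆? B) (subsets n l))
         (All.map (λ {B} ∣B∣≡k → ≡.trans (count-⊆ B l) (≡.cong (_choose l) ∣B∣≡k)) sizes) ⟨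
  sum (List.map (λ B → count (_⊆? B) (subsets n l)) Bs)
    ≡⟨ doubleCount (λ B S → S ⊆? B) Bs (subsets n l) ⟩
  sum (List.map (λ S → count (S ⊆?_) Bs) (subsets n l))
    ≡⟨ sum-constant (λ S → count (S ⊆?_) Bs) (All.map (λ {S} → once S) (subsets-size n l)) ⟩
  length (subsets n l) ℕ.* 1  ≡⟨ ℕ.*-identityʳ _ ⟩
  length (subsets n l)        ≡⟨ length-subsets n l ⟩
  n choose l                       ∎
  where open ≡.≡-Reasoning

module Octads (R : CommutativeRing c ℓ)
  (x+x≈0 : HasCharacteristic2 R)
  (_≟_ : Decidable (CommutativeRing._≈_ R))
  (r : Fin 24 → CommutativeRing.Carrier R)
  (minimumDistance : SubsetSum.MinimumDistance R x+x≈0 r 7)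
  (tetrad : SubsetSum.Tetrads R x+x≈0 r)
  where

  open CommutativeRing R hiding (zero)
  open SubsetSum R x+x≈0 using (subsetSum; △-zeroSum; Octad)

  octadThrough : ∀ S → ∣ S ∣ ≡ 5 → ∃[ B ] Octad r B × S ⊆ B
  octadThrough S ∣S∣≡5 with removePoint S ∣S∣≡5
  ... | x , Q , ∣Q∣≡4 , x∉Q , cover with tetrad Q ∣Q∣≡4 x
  ...   | T , x∈T , ∣T∣≡4 , σT≈σQ = B , (∣B∣≡8 , △-zeroSum r T Q σT≈σQ) , S⊆B
    where
    B = T △ Q

    sizes : ∣ B ∣ ℕ.+ (∣ T ∩ Q ∣ ℕ.+ ∣ T ∩ Q ∣) ≡ 8
    sizes = ≡.trans (∣△∣ T Q) (≡.cong₂ ℕ._+_ ∣T∣≡4 ∣Q∣≡4)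

    -- A zero-sum set of at most 7 points is empty, which would give T = Q; but x lies in T only.
    8≤∣B∣ : 8 ℕ.≤ ∣ B ∣
    8≤∣B∣ = ℕ.≰⇒> λ ∣B∣≤7 → x∉Q (≡.subst (x ∈ₛ_)
      (∣△∣≡0 T Q (minimumDistance B ∣B∣≤7 (△-zeroSum r T Q σT≈σQ))) x∈T)

    ∣B∣≡8 : ∣ B ∣ ≡ 8
    ∣B∣≡8 = ℕ.≤-antisym (≡.subst (∣ B ∣ ℕ.≤_) sizes (ℕ.m≤m+n ∣ B ∣ _)) 8≤∣B∣

    -- As T and Q have 8 points together, counted separately, attaining 8 makes them disjoint, and
    -- no point of S is cancelled in `B`.
    ∣T∩Q∣≡0 : ∣ T ∩ Q ∣ ≡ 0
    ∣T∩Q∣≡0 = ℕ.m+n≡0⇒m≡0 ∣ T ∩ Q ∣ (ℕ.+-cancelˡ-≡ 8 (∣ T ∩ Q ∣ ℕ.+ ∣ T ∩ Q ∣) 0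
      (≡.trans (≡.cong (ℕ._+ (∣ T ∩ Q ∣ ℕ.+ ∣ T ∩ Q ∣)) (≡.sym ∣B∣≡8)) sizes))

    S⊆B : S ⊆ B
    S⊆B y∈S with cover y∈S
    ... | inj₁ ≡.refl = ∈-△ˡ x∈T x∉Q
    ... | inj₂ y∈Q    = ∈-△ʳ (λ y∈T → ∈⇒∣∣≢0 (Subset.x∈p∩q⁺ (y∈T , y∈Q)) ∣T∩Q∣≡0) y∈Q

  -- Two octads sharing five points differ in at most 16 - 10 = 6 points, and these have sum zero.
  octad-unique : ∀ S → ∣ S ∣ ≡ 5 → ∀ {B B′} → Octad r B → Octad r B′ → S ⊆ B → S ⊆ B′ → B ≡ B′
  octad-unique S ∣S∣≡5 {B} {B′} (∣B∣≡8 , σB≈0) (∣B′∣≡8 , σB′≈0) S⊆B S⊆B′ =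
    ∣△∣≡0 B B′ (minimumDistance (B △ B′) (ℕ.m≤n⇒m≤1+n ∣△∣≤6) (△-zeroSum r B B′ (trans σB≈0 (sym σB′≈0))))
    where
    5≤i : 5 ℕ.≤ ∣ B ∩ B′ ∣
    5≤i = ≡.subst (ℕ._≤ ∣ B ∩ B′ ∣) ∣S∣≡5
      (Subset.p⊆q⇒∣p∣≤∣q∣ {p = S} {q = B ∩ B′} λ x∈S → Subset.x∈p∩q⁺ (S⊆B x∈S , S⊆B′ x∈S))
    ∣△∣≤6 : ∣ B △ B′ ∣ ℕ.≤ 6
    ∣△∣≤6 = ℕ.+-cancelʳ-≤ 10 ∣ B △ B′ ∣ 6 (begin
      ∣ B △ B′ ∣ ℕ.+ 10                               ≤⟨ ℕ.+-monoʳ-≤ ∣ B △ B′ ∣ (ℕ.+-mono-≤ 5≤i 5≤i) ⟩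
      ∣ B △ B′ ∣ ℕ.+ (∣ B ∩ B′ ∣ ℕ.+ ∣ B ∩ B′ ∣)      ≡⟨ ∣△∣ B B′ ⟩
      ∣ B ∣ ℕ.+ ∣ B′ ∣                                ≡⟨ ≡.cong₂ ℕ._+_ ∣B∣≡8 ∣B′∣≡8 ⟩
      16                                              ∎)
      where open ℕ.≤-Reasoning

  octads-isSteinerSystem : IsSteinerSystem 5 8 24 (Octad r)
  octads-isSteinerSystem = record
    { blockSize   = proj₁
    ; coveredOnce = λ S ∣S∣≡5 → let B , octad , S⊆B = octadThrough S ∣S∣≡5 in
        B , (octad , S⊆B) , λ (octad′ , S⊆B′) → octad-unique S ∣S∣≡5 octad octad′ S⊆B S⊆B′
    }

  private
    zero-sum? : ∀ B → Dec (subsetSum r B ≈ 0#)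
    zero-sum? B = subsetSum r B ≟ 0#

    octads : List (Subset 24)
    octads = filter zero-sum? (subsets 24 8)

    ∈-octads⁻ : ∀ {B} → B ∈ octads → Octad r B
    ∈-octads⁻ B∈ = All.lookup (subsets-size 24 8) (proj₁ (split B∈)) , proj₂ (split B∈)
      where split = ∈.∈-filter⁻ zero-sum? {xs = subsets 24 8}

    ∈-octads⁺ : ∀ {B} → Octad r B → B ∈ octads
    ∈-octads⁺ {B} (∣B∣≡8 , σB≈0) = ∈.∈-filter⁺ zero-sum? (∈-subsets B ∣B∣≡8) σB≈0

    octads-unique : Unique octads
    octads-unique = Unique.filter⁺ zero-sum? (subsets-unique 24 8)

    covering-octads : ∀ {S} → ∣ S ∣ ≡ 5 → count (S ⊆?_) octads ≡ 1
    covering-octads {S} ∣S∣≡5 = count-unique (S ⊆?_)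
      (allPairs-∈ octads-unique λ B∈ B′∈ B≢B′ (S⊆B , S⊆B′) →
        B≢B′ (octad-unique S ∣S∣≡5 (∈-octads⁻ B∈) (∈-octads⁻ B′∈) S⊆B S⊆B′))
      (let B , octad , S⊆B = octadThrough S ∣S∣≡5 in lose (∈-octads⁺ octad) S⊆B)

  octads-cardinality : HasCardinality (Octad r) 759
  octads-cardinality = octads , octads-unique , (λ B → mk⇔ ∈-octads⁻ ∈-octads⁺) ,
    ℕ.*-cancelʳ-≡ (length octads) 759 56 (flagCount octads 8 5
      (All.tabulate (proj₁ ∘ ∈-octads⁻)) (λ S → covering-octads {S}))

-- 2-polynomials

module PowersOfX (R : CommutativeRing c ℓ) where

  open CommutativeRing R hiding (zero)
  open Polynomial R
  open PolynomialProperties R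
  private module P = CommutativeRing polynomialRing
  open RawSemiringDefs (Semiring.rawSemiring P.semiring) using (_^_)

  X*-shift : ∀ p → X *ₚ p ≈ₚ 0# ∷ p
  X*-shift p .at zero = trans (coeff-+ (scale 0# p) _ 0)
    (trans (+-congʳ (trans (coeff-scale 0# p 0) (zeroˡ _))) (+-identityˡ 0#))
  X*-shift p .at (suc n) = trans (coeff-+ (scale 0# p) (0# ∷ (C 1# *ₚ p)) (suc n))
    (trans (+-congʳ (trans (coeff-scale 0# p (suc n)) (zeroˡ _)))
    (trans (+-identityˡ _) (at (P.*-identityˡ p) n)))

  coeff-X^n : ∀ n → coeff (X ^ n) n ≈ 1#
  coeff-X^n zero    = refl
  coeff-X^n (suc n) = trans (at (X*-shift (X ^ n)) (suc n)) (coeff-X^n n)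

  coeff-X^m : ∀ {m n} → m ≢ n → coeff (X ^ m) n ≈ 0#
  coeff-X^m {zero}  {zero}  m≢n = contradiction ≡.refl m≢n
  coeff-X^m {zero}  {suc n} m≢n = refl
  coeff-X^m {suc m} {zero}  m≢n = at (X*-shift (X ^ m)) 0
  coeff-X^m {suc m} {suc n} m≢n =
    trans (at (X*-shift (X ^ m)) (suc n)) (coeff-X^m (m≢n ∘ ≡.cong suc))

  eval-0 : ∀ p → eval p 0# ≈ coeff p 0
  eval-0 []      = refl
  eval-0 (x ∷ p) = trans (+-congˡ (zeroˡ _)) (+-identityʳ x)

  derivative-0 : ∀ p → derivative p 0# ≈ coeff p 1
  derivative-0 []      = refl
  derivative-0 (x ∷ p) = trans (+-cong (eval-0 p) (zeroˡ _)) (+-identityʳ _)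

module Characteristic2 {A : CommutativeRing a ℓ₁} {B : CommutativeRing b ℓ₂}
  {φ : CommutativeRing.Carrier A → CommutativeRing.Carrier B}
  (φ-hom : RingHomomorphisms.IsRingHomomorphism A B φ)
  (x+x≈0 : HasCharacteristic2 B) where

  open CommutativeRing B using (_≈_; _+_; _*_; 0#; 1#)
  private
    module A = CommutativeRing A
    module B = CommutativeRing B
    module PA = Polynomial A
    module PB = Polynomial B
    module P = CommutativeRing PA.polynomialRing
  open MapPolynomial {A = A} {B} φ-hom
  open PolynomialProperties B
  open RingHomomorphisms.IsRingHomomorphism A B φ-hom using (1#-homo; 0#-homo)
  open RawSemiringDefs (Semiring.rawSemiring P.semiring) using (_^_) renaming (sum to ∑)
  open Exp P.semiring using (^-homo-*)
  open import Relation.Binary.Reasoning.Setoid B.setoid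
  open import Algebra.Properties.CommutativeSemigroup B.+-commutativeSemigroup using (interchange)
  open Solver B.commutativeSemiring using (solve; _:=_; _:+_; _:*_; con)

  value slopeAt : PA.Poly → B.Carrier → B.Carrier
  value   p x = PB.eval (mapₚ p) x
  slopeAt p x = derivative (mapₚ p) x

  value-cong : ∀ {p q} x → p PA.≈ₚ q → value p x ≈ value q x
  value-cong {p} {q} x e = eval-congˡ {mapₚ p} {mapₚ q} x (map-cong e)

  value-+ : ∀ p q x → value (p PA.+ₚ q) x ≈ value p x + value q x
  value-+ p q x = B.trans (eval-congˡ {mapₚ (p PA.+ₚ q)} {mapₚ p PB.+ₚ mapₚ q} x (map-+ p q)) (eval-+ (mapₚ p) (mapₚ q) x)

  value-* : ∀ p q x → value (p PA.*ₚ q) x ≈ value p x * value q x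
  value-* p q x = B.trans (eval-congˡ {mapₚ (p PA.*ₚ q)} {mapₚ p PB.*ₚ mapₚ q} x (map-* p q)) (eval-* (mapₚ p) (mapₚ q) x)

  value-X : ∀ x → value PA.X x ≈ x
  value-X x = B.trans (B.+-cong 0#-homo (B.*-congˡ (B.+-congʳ 1#-homo)))
    (solve 1 (λ x → con 0 :+ x :* (con 1 :+ x :* con 0) := x) B.refl x)

  slopeAt-cong : ∀ {p q} x → p PA.≈ₚ q → slopeAt p x ≈ slopeAt q x
  slopeAt-cong {p} {q} x e = derivative-cong {mapₚ p} {mapₚ q} x (map-cong e)

  slopeAt-+ : ∀ p q x → slopeAt (p PA.+ₚ q) x ≈ slopeAt p x + slopeAt q x
  slopeAt-+ p q x = B.trans (derivative-cong {mapₚ (p PA.+ₚ q)} {mapₚ p PB.+ₚ mapₚ q} x (map-+ p q))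
    (derivative-+ (mapₚ p) (mapₚ q) x)

  slopeAt-* : ∀ p q x → slopeAt (p PA.*ₚ q) x ≈ slopeAt p x * value q x + value p x * slopeAt q x
  slopeAt-* p q x = B.trans (derivative-cong {mapₚ (p PA.*ₚ q)} {mapₚ p PB.*ₚ mapₚ q} x (map-* p q))
    (derivative-* (mapₚ p) (mapₚ q) x)

  slopeAt-C : ∀ y x → slopeAt (PA.C y) x ≈ 0#
  slopeAt-C y x = solve 1 (λ x → con 0 :+ x :* con 0 := con 0) B.refl x

  slopeAt-X : ∀ x → slopeAt PA.X x ≈ 1#
  slopeAt-X x = B.trans (B.+-congʳ (B.+-congʳ 1#-homo))
    (solve 1 (λ x → (con 1 :+ x :* con 0) :+ x :* (con 0 :+ x :* con 0) := con 1) B.refl x)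

  slopeAt-square : ∀ {q} p x → q PA.≈ₚ p PA.*ₚ p → slopeAt q x ≈ 0#
  slopeAt-square {q} p x e = begin
    slopeAt q x            ≈⟨ slopeAt-cong {q} {p PA.*ₚ p} x e ⟩
    slopeAt (p PA.*ₚ p) x  ≈⟨ slopeAt-* p p x ⟩
    slopeAt p x * value p x + value p x * slopeAt p x  ≈⟨ B.+-congˡ (B.*-comm _ _) ⟩
    slopeAt p x * value p x + slopeAt p x * value p x  ≈⟨ x+x≈0 _ ⟩
    0#                     ∎

  -- The two properties of 2-polynomials that matter here. Constancy of the derivative compares two
  -- points instead of naming the constant, so it is inherited by sums and multiples at once.
  Additive ConstantDerivative : PA.Poly → Set (b ⊔ ℓ₂)
  Additive           p = ∀ x y → value p (x + y) ≈ value p x + value p y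
  ConstantDerivative p = ∀ x y → slopeAt p x ≈ slopeAt p y

  private
    doubled : ∀ k → PA.X ^ (2 ℕ.^ suc k) PA.≈ₚ PA.X ^ (2 ℕ.^ k) PA.*ₚ PA.X ^ (2 ℕ.^ k)
    doubled k = P.trans (P.reflexive (≡.cong (λ m → PA.X ^ (2 ℕ.^ k ℕ.+ m)) (ℕ.+-identityʳ (2 ℕ.^ k))))
      (^-homo-* PA.X (2 ℕ.^ k) (2 ℕ.^ k))

  frobenius : ∀ k → Additive (PA.X ^ (2 ℕ.^ k))
  frobenius zero x y = B.trans (identity (x + y)) (B.sym (B.+-cong (identity x) (identity y)))
    where
    identity : ∀ x → value (PA.X ^ 1) x ≈ x
    identity x = B.trans (value-cong {PA.X ^ 1} {PA.X} x (P.*-identityʳ PA.X)) (value-X x)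
  frobenius (suc k) x y = begin
    value (PA.X ^ (2 ℕ.^ suc k)) (x + y)  ≈⟨ square (x + y) ⟩
    v (x + y) * v (x + y)                 ≈⟨ B.*-cong (frobenius k x y) (frobenius k x y) ⟩
    (v x + v y) * (v x + v y)
      ≈⟨ solve 2 (λ x y → (x :+ y) :* (x :+ y) := x :* x :+ y :* y :+ (x :* y :+ x :* y)) B.refl (v x) (v y) ⟩
    v x * v x + v y * v y + (v x * v y + v x * v y)  ≈⟨ B.+-congˡ (x+x≈0 _) ⟩
    v x * v x + v y * v y + 0#            ≈⟨ B.+-identityʳ _ ⟩
    v x * v x + v y * v y                 ≈⟨ B.+-cong (square x) (square y) ⟨
    value (PA.X ^ (2 ℕ.^ suc k)) x + value (PA.X ^ (2 ℕ.^ suc k)) y ∎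
    where
    v = value (PA.X ^ (2 ℕ.^ k))
    square : ∀ x → value (PA.X ^ (2 ℕ.^ suc k)) x ≈ v x * v x
    square x = B.trans (value-cong {PA.X ^ (2 ℕ.^ suc k)} {PA.X ^ (2 ℕ.^ k) PA.*ₚ PA.X ^ (2 ℕ.^ k)} x (doubled k))
      (value-* (PA.X ^ (2 ℕ.^ k)) (PA.X ^ (2 ℕ.^ k)) x)

  frobenius-constantDerivative : ∀ k → ConstantDerivative (PA.X ^ (2 ℕ.^ k))
  frobenius-constantDerivative zero    x y = B.trans (one x) (B.sym (one y))
    where
    one : ∀ x → slopeAt (PA.X ^ 1) x ≈ 1#
    one x = B.trans (slopeAt-cong {PA.X ^ 1} {PA.X} x (P.*-identityʳ PA.X)) (slopeAt-X x)
  frobenius-constantDerivative (suc k) x y = B.trans (vanish x) (B.sym (vanish y))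
    where
    vanish : ∀ x → slopeAt (PA.X ^ (2 ℕ.^ suc k)) x ≈ 0#
    vanish x = slopeAt-square {PA.X ^ (2 ℕ.^ suc k)} (PA.X ^ (2 ℕ.^ k)) x (doubled k)

  monomial-additive : ∀ y p → Additive p → Additive (PA.C y PA.*ₚ p)
  monomial-additive y p add-p x z = begin
    value (PA.C y PA.*ₚ p) (x + z)       ≈⟨ value-* (PA.C y) p (x + z) ⟩
    value (PA.C y) (x + z) * value p (x + z)  ≈⟨ B.*-cong (eval-C (φ y) (x + z)) (add-p x z) ⟩
    φ y * (value p x + value p z)        ≈⟨ B.distribˡ (φ y) _ _ ⟩
    φ y * value p x + φ y * value p z    ≈⟨ B.+-cong (term x) (term z) ⟨
    value (PA.C y PA.*ₚ p) x + value (PA.C y PA.*ₚ p) z ∎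
    where
    term : ∀ x → value (PA.C y PA.*ₚ p) x ≈ φ y * value p x
    term x = B.trans (value-* (PA.C y) p x) (B.*-congʳ (eval-C (φ y) x))

  monomial-constantDerivative : ∀ y p → ConstantDerivative p → ConstantDerivative (PA.C y PA.*ₚ p)
  monomial-constantDerivative y p const x z = B.trans (term x) (B.trans (B.*-congˡ (const x z)) (B.sym (term z)))
    where
    term : ∀ x → slopeAt (PA.C y PA.*ₚ p) x ≈ φ y * slopeAt p x
    term x = B.trans (slopeAt-* (PA.C y) p x)
      (B.trans (B.+-cong (B.trans (B.*-congʳ (slopeAt-C y x)) (B.zeroˡ _)) (B.*-congʳ (eval-C (φ y) x)))
        (B.+-identityˡ _))

  sum-additive : ∀ {n} (p : Vector PA.Poly n) → (∀ i → Additive (p i)) → Additive (∑ p)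
  sum-additive {zero}  p adds x y = B.sym (B.+-identityˡ 0#)
  sum-additive {suc n} p adds x y = begin
    value (p zero PA.+ₚ s) (x + y)                         ≈⟨ value-+ (p zero) s (x + y) ⟩
    value (p zero) (x + y) + value s (x + y)
      ≈⟨ B.+-cong (adds zero x y) (sum-additive (p ∘ suc) (adds ∘ suc) x y) ⟩
    (value (p zero) x + value (p zero) y) + (value s x + value s y)  ≈⟨ interchange _ _ _ _ ⟩
    (value (p zero) x + value s x) + (value (p zero) y + value s y)
      ≈⟨ B.+-cong (value-+ (p zero) s x) (value-+ (p zero) s y) ⟨
    value (p zero PA.+ₚ s) x + value (p zero PA.+ₚ s) y ∎
    where s = ∑ (p ∘ suc)

  sum-constantDerivative : ∀ {n} (p : Vector PA.Poly n) → (∀ i → ConstantDerivative (p i)) → ConstantDerivative (∑ p)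
  sum-constantDerivative {zero}  p consts x y = B.refl
  sum-constantDerivative {suc n} p consts x y = B.trans (slopeAt-+ (p zero) s x)
    (B.trans (B.+-cong (consts zero x y) (sum-constantDerivative (p ∘ suc) (consts ∘ suc) x y))
      (B.sym (slopeAt-+ (p zero) s y)))
    where s = ∑ (p ∘ suc)

module TwoPolynomialProperties (F : Field a ℓ ℓ₁) {B : CommutativeRing b ℓ₂}
  {φ : Field.Carrier F → CommutativeRing.Carrier B}
  (φ-hom : RingHomomorphisms.IsRingHomomorphism (Field.commutativeRing F) B φ)
  (x+x≈0 : HasCharacteristic2 B)
  {p} {n} (2-poly : TwoPolynomial.IsMonic2Polynomial F p n) where

  private
    module B = CommutativeRing B
  open Polynomial (Field.commutativeRing F)
  open Characteristic2 {A = Field.commutativeRing F} {B} φ-hom x+x≈0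
  open RawSemiringDefs (Semiring.rawSemiring (CommutativeRing.semiring polynomialRing)) using (_^_)
  open TwoPolynomial F using (twoPolynomial)

  additive : Additive p
  additive = go 2-poly
    where
    go : TwoPolynomial.IsMonic2Polynomial F p n → Additive p
    go (a , e , _) x y = B.trans (value-cong {p} {twoPolynomial a} (x B.+ y) e) (B.trans
      (sum-additive (λ i → C (a i) *ₚ X ^ (2 ℕ.^ toℕ i))
        (λ i → monomial-additive (a i) (X ^ (2 ℕ.^ toℕ i)) (frobenius (toℕ i))) x y)
      (B.sym (B.+-cong (value-cong {p} {twoPolynomial a} x e) (value-cong {p} {twoPolynomial a} y e))))

  constantDerivative : ConstantDerivative p
  constantDerivative = go 2-poly
    where
    go : TwoPolynomial.IsMonic2Polynomial F p n → ConstantDerivative p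
    go (a , e , _) x y = B.trans (slopeAt-cong {p} {twoPolynomial a} x e) (B.trans
      (sum-constantDerivative (λ i → C (a i) *ₚ X ^ (2 ℕ.^ toℕ i))
        (λ i → monomial-constantDerivative (a i) (X ^ (2 ℕ.^ toℕ i)) (frobenius-constantDerivative (toℕ i))) x y)
      (B.sym (slopeAt-cong {p} {twoPolynomial a} y e)))

-- Sums of the roots of f as roots of L

module FieldEmbedding (F : Field a ℓ ℓ₁) (K : Field b ℓ₂ ℓ₁′)
  {φ : Field.Carrier F → Field.Carrier K}
  (φ-hom : RingHomomorphisms.IsRingHomomorphism (Field.commutativeRing F) (Field.commutativeRing K) φ) where

  private
    module F = Field F
    module K = Field K
  open FieldProperties F using (_≟_; inverse)
  open FieldProperties K using (1≉0)
  open RingHomomorphisms.IsRingHomomorphism F.commutativeRing K.commutativeRing φ-hom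
  open MapPolynomial {A = F.commutativeRing} {K.commutativeRing} φ-hom using (mapₚ; coeff-map)
  open Polynomial using (HasDegree)

  Root : Polynomial.Poly F.commutativeRing → K.Carrier → Set ℓ₂
  Root p x = Polynomial.eval K.commutativeRing (mapₚ p) x K.≈ K.0#

  kernel : ∀ {x} → φ x K.≈ K.0# → x F.≈ F.0#
  kernel {x} φx≈0 with x ≟ F.0#
  ... | yes x≈0 = x≈0
  ... | no  x≉0 with y , yx≈1 ← inverse x≉0 =
    contradiction (K.trans (K.sym 1#-homo) (K.trans (⟦⟧-cong (F.sym yx≈1))
      (K.trans (*-homo y x) (K.trans (K.*-congˡ φx≈0) (K.zeroʳ _))))) 1≉0

  map-degree : ∀ {q d} → HasDegree F.commutativeRing q d → HasDegree K.commutativeRing (mapₚ q) d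
  map-degree {q} {d} (q≉0 , q≈0) =
    (λ e → q≉0 (kernel (K.trans (K.sym (coeff-map q d)) e))) ,
    λ m d<m → K.trans (coeff-map q m) (K.trans (⟦⟧-cong (q≈0 m d<m)) 0#-homo)

module RootSums (F : Field a ℓ ℓ₁) (K : Field b ℓ₂ ℓ₁′)
  (x+x≈0 : HasCharacteristic2 (Field.commutativeRing K))
  {φ : Field.Carrier F → Field.Carrier K}
  (φ-hom : RingHomomorphisms.IsRingHomomorphism (Field.commutativeRing F) (Field.commutativeRing K) φ)
  {n} (as : Vec (Field.Carrier F) n)
  (r : Fin n → Field.Carrier K)
  (r-injective : ∀ {i j} → Field._≈_ K (r i) (r j) → i ≡ j)
  (r-root : ∀ i → FieldEmbedding.Root F K φ-hom (MonicDivision.monic (Field.commutativeRing F) as) (r i))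
  where

  open Field K using (_≈_; _+_; 0#)
  private
    A = Field.commutativeRing F
    B = Field.commutativeRing K
    module F = Field F
    module K = Field K
    module PF = Polynomial A
    module PK = Polynomial B
    module Q = CommutativeRing PK.polynomialRing
  D = FieldProperties.domain K
  open LinearFactors D x+x≈0
  open SubsetSum B x+x≈0
  open SubsetSumProduct D x+x≈0
  open MapPolynomial {A = A} {B} φ-hom using (mapₚ)
  open MonicDivision PK.polynomialRing using (horner; horner-cong)
  open ConstantEmbedding B using (C-isRingHomomorphism)
  open RingHomomorphisms.IsRingHomomorphism A B φ-hom using (1#-homo; 0#-homo)

  sums : ℕ → List K.Carrier
  sums k = List.map (subsetSum r) (subsets n k)

  -- P_k itself: the resolvent over F[X] at the point X, with the coefficients of f as constants. By
  -- construction its coefficients lie in F.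
  sumPolynomial : ℕ → PF.Poly
  sumPolynomial k = resolvent PF.polynomialRing k (Vec.map PF.C as) PF.X

  private
    constants : ∀ {m} (bs : Vec F.Carrier m) →
      Pointwise PK._≈ₚ_ (Vec.map mapₚ (Vec.map PF.C bs)) (Vec.map PK.C (Vec.map φ bs))
    constants []       = []
    constants (b ∷ bs) = Q.refl ∷ constants bs

    root : ∀ i → horner Q.1# (Vec.map mapₚ (Vec.map PF.C as)) (PK.C (r i)) PK.≈ₚ []
    root i = begin
      horner Q.1# (Vec.map mapₚ (Vec.map PF.C as)) (PK.C (r i))
        ≈⟨ horner-cong {as = Vec.map mapₚ (Vec.map PF.C as)} Q.refl (constants as) Q.refl ⟩
      horner (PK.C K.1#) (Vec.map PK.C (Vec.map φ as)) (PK.C (r i))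
        ≈⟨ MapHorner.horner-map {A = B} {PK.polynomialRing} C-isRingHomomorphism K.1# (Vec.map φ as) (r i) ⟩
      PK.C (MonicDivision.horner B K.1# (Vec.map φ as) (r i))
        ≈⟨ ⟦⟧-cong (K.trans (K.sym (MapHorner.eval-monic-map {A = A} {B} φ-hom as (r i))) (r-root i)) ⟩
      PK.C K.0#  ≈⟨ 0#-homo′ ⟩
      []         ∎
      where
      open import Relation.Binary.Reasoning.Setoid Q.setoid
      open RingHomomorphisms.IsRingHomomorphism B PK.polynomialRing C-isRingHomomorphism
        using (⟦⟧-cong) renaming (0#-homo to 0#-homo′)

  -- An instance of `resolvent-spec` with K[X] as target, where the roots become distinct constant
  -- polynomials. The point X is `linear` at 0, the empty offset of `subsetProduct-sums`.
  sumPolynomial-roots : ∀ k → HasRoots (mapₚ (sumPolynomial k)) (sums k)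
  sumPolynomial-roots k = hasRoots K.1# (IntegralDomain.1≉0 D) (begin
    mapₚ (sumPolynomial k)
      ≈⟨ resolvent-spec (polynomialDomain D) PF.polynomialRing mapₚ
           (MapPolynomial.map-isRingHomomorphism {A = A} {B} φ-hom)
           k (Vec.map PF.C as) PF.X rs (List.length-tabulate (PK.C ∘ r))
           (AllPairs.tabulate⁺ λ i≢j e → i≢j (r-injective (PK.at e 0)))
           (All.tabulate⁺ root) ⟨
    subsetProduct k rs (mapₚ PF.X)
      ≈⟨ subsetProduct-cong k rs {mapₚ PF.X} {linear K.0#}
           (PK.coeff-≈ λ { 0 → 0#-homo ; 1 → 1#-homo ; (suc (suc _)) → K.refl }) ⟩
    subsetProduct k rs (linear K.0#)  ≈⟨ subsetProduct-sums r k K.0# ⟩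
    rootProduct (sumsFrom r k K.0#)   ≈⟨ rootProduct-cong (zeroOffset (subsets n k)) ⟩
    rootProduct (sums k)              ≈⟨ Q.*-identityˡ (rootProduct (sums k)) ⟨
    PK.C K.1# PK.*ₚ rootProduct (sums k) ∎)
    where
    open SubsetProduct PK.polynomialRing
    open import Relation.Binary.Reasoning.Setoid Q.setoid
    rs = List.tabulate (PK.C ∘ r)
    zeroOffset : ∀ As → ListPointwise _≈_ (List.map (λ A → K.0# + subsetSum r A) As) (List.map (subsetSum r) As)
    zeroOffset []       = []
    zeroOffset (A ∷ As) = K.+-identityˡ _ ∷ zeroOffset As

  sum-∈ : ∀ A {k} → ∣ A ∣ ≡ k → subsetSum r A ∈ sums k
  sum-∈ A ∣A∣≡k = ∈.∈-map⁺ (subsetSum r) (∈-subsets A ∣A∣≡k)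

  length-sums : ∀ k → length (sums k) ≡ n choose k
  length-sums k = ≡.trans (List.length-map (subsetSum r) (subsets n k)) (length-subsets n k)

  equalSums : ∀ {d} → MinimumDistance r d → ∀ {A B} → ∣ A △ B ∣ ℕ.≤ d →
    subsetSum r A ≈ subsetSum r B → A ≡ B
  equalSums minDist {A} {B} le e = ∣△∣≡0 A B (minDist (A △ B) le (△-zeroSum r A B e))

  equalSizes : ∀ {d} → MinimumDistance r d → ∀ {A B j k} → ∣ A ∣ ≡ j → ∣ B ∣ ≡ k → j ℕ.+ k ℕ.≤ d →
    subsetSum r A ≈ subsetSum r B → j ≡ k
  equalSizes minDist {A} {B} ≡.refl ≡.refl le e =
    ≡.cong ∣_∣ (equalSums minDist {A} {B} (ℕ.≤-trans (∣△∣≤ A B) le) e)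

  -- A word of weight j + k is the difference of words of weights j and k.
  extendDistance : ∀ {d} j k → suc d ≡ j ℕ.+ k → MinimumDistance r d →
    (∀ A B → ∣ A ∣ ≡ j → ∣ B ∣ ≡ k → subsetSum r A ≈ subsetSum r B → A ≡ B) →
    MinimumDistance r (suc d)
  extendDistance {d} j k eq minDist inj W ∣W∣≤1+d σW≈0 with ∣ W ∣ ℕ.≤? d
  ... | yes ∣W∣≤d = minDist W ∣W∣≤d σW≈0
  ... | no  ∣W∣≰d with partition W j k (≡.trans (ℕ.≤-antisym ∣W∣≤1+d (ℕ.≰⇒> ∣W∣≰d)) eq)
  ...   | A , B , ∣A∣≡j , ∣B∣≡k , ≡.refl
    with ≡.refl ← inj A B ∣A∣≡j ∣B∣≡k (x+y≈0⇒x≈y (K.trans (K.sym (subsetSum-△ r A B)) σW≈0)) = ∣A△A∣≡0 A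
    where
    ∣A△A∣≡0 : ∀ {m} (A : Subset m) → ∣ A △ A ∣ ≡ 0
    ∣A△A∣≡0 []            = ≡.refl
    ∣A△A∣≡0 (outside ∷ A) = ∣A△A∣≡0 A
    ∣A△A∣≡0 (inside  ∷ A) = ∣A△A∣≡0 A

-- Arithmetic of the degrees

<! : ∀ {m n} {_ : True (m ℕ.<? n)} → m ℕ.< n
<! {_} {_} {lt} = toWitness lt

private
  multiple-≤ : ∀ {d m N} → d ℕ.∣ m → m ℕ.≤ N → N ℕ.< d → m ≡ 0
  multiple-≤ {m = zero}  _   _   _   = ≡.refl
  multiple-≤ {m = suc _} d∣m m≤N N<d = contradiction (ℕ.≤-trans (ℕ.∣⇒≤ d∣m) m≤N) (ℕ.<⇒≱ N<d)

  ∤! : ∀ {m n} {_ : False (m ℕ.∣? n)} → ¬ m ℕ.∣ n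
  ∤! {_} {_} {nd} = toWitnessFalse nd

  -- Closes a case distinction on the multiplicity of d: if k copies already exceed N, all
  -- multiplicities k + e are refuted at once.
  tooMany : ∀ k d e {N rest} {_ : True (N ℕ.<? k ℕ.* d)} {A : Set} → N ≡ rest ℕ.+ (k ℕ.+ e) ℕ.* d → A
  tooMany k d e {N} {rest} {lt} eq = contradiction (ℕ.m≤m+n k e) (ℕ.<⇒≱ (ℕ.*-cancelʳ-< d (k ℕ.+ e) k
    (ℕ.≤-<-trans (≡.subst ((k ℕ.+ e) ℕ.* d ℕ.≤_) (≡.sym eq) (ℕ.m≤n+m _ rest)) (toWitness lt))))

-- In use, N is 24 choose k and the summands are the numbers of k-sums among the roots of the
-- factors of degrees 1, 24, 276, 1771, 2024. The final `+ 0` is that of `sum` on lists.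
module Degrees {n₀ n₁ n₂ n₃ n₄ N : ℕ} (total : N ≡ n₀ ℕ.+ (n₁ ℕ.+ (n₂ ℕ.+ (n₃ ℕ.+ (n₄ ℕ.+ 0)))))
  (24∣n₁ : 24 ℕ.∣ n₁) (276∣n₂ : 276 ℕ.∣ n₂) (1771∣n₃ : 1771 ℕ.∣ n₃) (2024∣n₄ : 2024 ℕ.∣ n₄) where

  private
    n₁₊≤N : n₁ ℕ.+ (n₂ ℕ.+ (n₃ ℕ.+ (n₄ ℕ.+ 0))) ℕ.≤ N
    n₁₊≤N = ≡.subst (_ ℕ.≤_) (≡.sym total) (ℕ.m≤n+m _ n₀)
    n₂₊≤N = ℕ.≤-trans (ℕ.m≤n+m (n₂ ℕ.+ (n₃ ℕ.+ (n₄ ℕ.+ 0))) n₁) n₁₊≤N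
    n₃₊≤N = ℕ.≤-trans (ℕ.m≤n+m (n₃ ℕ.+ (n₄ ℕ.+ 0)) n₂) n₂₊≤N
    n₄₊≤N = ℕ.≤-trans (ℕ.m≤n+m (n₄ ℕ.+ 0) n₃) n₃₊≤N

  n₁≡0 : N ℕ.< 24 → n₁ ≡ 0
  n₁≡0 = multiple-≤ 24∣n₁ (ℕ.≤-trans (ℕ.m≤m+n n₁ _) n₁₊≤N)
  n₂≡0 : N ℕ.< 276 → n₂ ≡ 0
  n₂≡0 = multiple-≤ 276∣n₂ (ℕ.≤-trans (ℕ.m≤m+n n₂ _) n₂₊≤N)
  n₃≡0 : N ℕ.< 1771 → n₃ ≡ 0
  n₃≡0 = multiple-≤ 1771∣n₃ (ℕ.≤-trans (ℕ.m≤m+n n₃ _) n₃₊≤N)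
  n₄≡0 : N ℕ.< 2024 → n₄ ≡ 0
  n₄≡0 = multiple-≤ 2024∣n₄ (ℕ.≤-trans (ℕ.m≤m+n n₄ _) n₄₊≤N)

  only₀ : n₁ ≡ 0 → n₂ ≡ 0 → n₃ ≡ 0 → n₄ ≡ 0 → n₀ ≡ N
  only₀ ≡.refl ≡.refl ≡.refl ≡.refl = ≡.sym (≡.trans total (ℕ.+-identityʳ n₀))

  only₁ : n₀ ≡ 0 → n₂ ≡ 0 → n₃ ≡ 0 → n₄ ≡ 0 → n₁ ≡ N
  only₁ ≡.refl ≡.refl ≡.refl ≡.refl = ≡.sym (≡.trans total (ℕ.+-identityʳ n₁))

  total₁₂ : n₀ ≡ 0 → n₃ ≡ 0 → n₄ ≡ 0 → N ≡ n₁ ℕ.+ n₂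
  total₁₂ ≡.refl ≡.refl ≡.refl = ≡.trans total (≡.cong (n₁ ℕ.+_) (ℕ.+-identityʳ n₂))

  total₂₃₄ : n₀ ≡ 0 → n₁ ≡ 0 → N ≡ (n₂ ℕ.+ n₃) ℕ.+ n₄
  total₂₃₄ ≡.refl ≡.refl = ≡.trans total (≡.trans
    (≡.cong (λ m → n₂ ℕ.+ (n₃ ℕ.+ m)) (ℕ.+-identityʳ n₄)) (≡.sym (ℕ.+-assoc n₂ n₃ n₄)))

  total₃₄ : n₀ ≡ 0 → n₁ ≡ 0 → n₂ ≡ 0 → N ≡ n₃ ℕ.+ n₄
  total₃₄ ≡.refl ≡.refl ≡.refl = ≡.trans total (≡.cong (n₃ ℕ.+_) (ℕ.+-identityʳ n₄))

-- 24 ∤ 276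
pairs : ∀ {n₁ n₂} → 276 ≡ n₁ ℕ.+ n₂ → 24 ℕ.∣ n₁ → 276 ℕ.∣ n₂ → n₂ ≡ 276
pairs {n₁} eq 24∣n₁ (divides 0 ≡.refl) =
  contradiction (≡.subst (24 ℕ.∣_) (≡.sym (≡.trans eq (ℕ.+-identityʳ n₁))) 24∣n₁) ∤!
pairs eq 24∣n₁ (divides 1 ≡.refl) = ≡.refl
pairs {n₁} eq 24∣n₁ (divides (suc (suc e)) ≡.refl) =
  tooMany 2 276 e eq

-- 276 divides neither 2024 nor 2024 − 1771
triples : ∀ {n₂ n₃ n₄} → 2024 ≡ (n₂ ℕ.+ n₃) ℕ.+ n₄ → 276 ℕ.∣ n₂ → 1771 ℕ.∣ n₃ → 2024 ℕ.∣ n₄ → n₄ ≡ 2024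
triples {n₂} {n₃} eq 276∣n₂ 1771∣n₃ (divides 0 ≡.refl) =
  contradiction 1771∣n₃ (split (≡.trans eq (ℕ.+-identityʳ (n₂ ℕ.+ n₃))))
  where
  split : ∀ {n₃} → 2024 ≡ n₂ ℕ.+ n₃ → ¬ 1771 ℕ.∣ n₃
  split eq (divides 0 ≡.refl) =
    contradiction (≡.subst (276 ℕ.∣_) (≡.sym (≡.trans eq (ℕ.+-identityʳ n₂))) 276∣n₂) ∤!
  split eq (divides 1 ≡.refl) =
    contradiction (≡.subst (276 ℕ.∣_) (≡.sym (ℕ.+-cancelʳ-≡ 1771 253 n₂ eq)) 276∣n₂) ∤!
  split eq (divides (suc (suc e)) ≡.refl) = tooMany 2 1771 e eq
triples eq 276∣n₂ 1771∣n₃ (divides 1 ≡.refl) = ≡.refl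
triples eq 276∣n₂ 1771∣n₃ (divides (suc (suc e)) ≡.refl) = tooMany 2 2024 e eq

-- 1771 ∤ 10626 − 2024 e for e = 1, …, 5
quadruples : ∀ {n₃ n₄} → 10626 ≡ n₃ ℕ.+ n₄ → 1771 ℕ.∣ n₃ → 2024 ℕ.∣ n₄ → n₃ ≡ 10626
quadruples {n₃} eq 1771∣n₃ (divides 0 ≡.refl) = ≡.sym (≡.trans eq (ℕ.+-identityʳ n₃))
quadruples {n₃} eq 1771∣n₃ (divides 1 ≡.refl) =
  contradiction (≡.subst (1771 ℕ.∣_) (≡.sym (ℕ.+-cancelʳ-≡ 2024 8602 n₃ eq)) 1771∣n₃) ∤!
quadruples {n₃} eq 1771∣n₃ (divides 2 ≡.refl) =
  contradiction (≡.subst (1771 ℕ.∣_) (≡.sym (ℕ.+-cancelʳ-≡ 4048 6578 n₃ eq)) 1771∣n₃) ∤!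
quadruples {n₃} eq 1771∣n₃ (divides 3 ≡.refl) =
  contradiction (≡.subst (1771 ℕ.∣_) (≡.sym (ℕ.+-cancelʳ-≡ 6072 4554 n₃ eq)) 1771∣n₃) ∤!
quadruples {n₃} eq 1771∣n₃ (divides 4 ≡.refl) =
  contradiction (≡.subst (1771 ℕ.∣_) (≡.sym (ℕ.+-cancelʳ-≡ 8096 2530 n₃ eq)) 1771∣n₃) ∤!
quadruples {n₃} eq 1771∣n₃ (divides 5 ≡.refl) =
  contradiction (≡.subst (1771 ℕ.∣_) (≡.sym (ℕ.+-cancelʳ-≡ 10120 506 n₃ eq)) 1771∣n₃) ∤!
quadruples {n₃} eq 1771∣n₃ (divides (suc (suc (suc (suc (suc (suc e)))))) ≡.refl) =
  tooMany 6 2024 e eq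

-- Matching sums of few roots with the factors

count≡length⇒All : {A : Set a} {P : A → Set b} (P? : ∀ x → Dec (P x)) → ∀ xs → count P? xs ≡ length xs → All P xs
count≡length⇒All P? xs eq =
  ≡.subst (All _) (List.filter-complete P? eq) (All.all-filter P? xs)

allPairs-lookup : {A : Set a} {R : A → A → Set ℓ} {xs : List A} → AllPairs R xs →
  ∀ {x y} → x ∈ xs → y ∈ xs → x ≡ y ⊎ (R x y ⊎ R y x)
allPairs-lookup (rs ∷ _)  (here ≡.refl) (here ≡.refl) = inj₁ ≡.refl
allPairs-lookup (rs ∷ _)  (here ≡.refl) (there j)     = inj₂ (inj₁ (All.lookup rs j))
allPairs-lookup (rs ∷ _)  (there i)     (here ≡.refl) = inj₂ (inj₂ (All.lookup rs i))
allPairs-lookup (_ ∷ rss) (there i)     (there j)     = allPairs-lookup rss i j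

pigeonhole : (R : CommutativeRing c ℓ) → let open CommutativeRing R in
  ∀ xs {ys} → AllPairs _≉_ xs → All (λ x → Any (_≈ x) ys) xs → length xs ℕ.≤ length ys
pigeonhole R []       _            _            = z≤n
pigeonhole R (x ∷ xs) {ys} (x≉ ∷ xs≉) (x∈ys ∷ xs∈ys) with find x∈ys
... | y , y∈ys , y≈x with zs , ys↭ ← ∈⇒↭ y∈ys =
  ≡.subst (suc (length xs) ℕ.≤_) (≡.sym (↭-length ys↭)) (s≤s (pigeonhole R xs xs≉
    (All.zipWith (λ (x≉z , z∈ys) → other x≉z (Any-resp-↭ ys↭ z∈ys)) (x≉ , xs∈ys))))
  where
  open CommutativeRing R
  other : ∀ {z} → x ≉ z → Any (_≈ z) (y ∷ zs) → Any (_≈ z) zs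
  other x≉z (here y≈z) = contradiction (trans (sym y≈x) y≈z) x≉z
  other x≉z (there i)  = i

module FactoredSums (F : Field a ℓ ℓ₁) (K : Field b ℓ₂ ℓ₁′)
  (x+x≈0 : HasCharacteristic2 (Field.commutativeRing K))
  {φ : Field.Carrier F → Field.Carrier K}
  (φ-hom : RingHomomorphisms.IsRingHomomorphism (Field.commutativeRing F) (Field.commutativeRing K) φ)
  (as : Vec (Field.Carrier F) 24)
  (r : Fin 24 → Field.Carrier K)
  (r-injective : ∀ {i j} → Field._≈_ K (r i) (r j) → i ≡ j)
  (r-root : ∀ i → FieldEmbedding.Root F K φ-hom (MonicDivision.monic (Field.commutativeRing F) as) (r i))
  (r-nonzero : ∀ i → Field._≉_ K (r i) (Field.0# K))
  (p : Polynomial.Poly (Field.commutativeRing F))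
  (additive : Characteristic2.Additive {A = Field.commutativeRing F} {Field.commutativeRing K} φ-hom x+x≈0 p)
  (p-root : ∀ i → FieldEmbedding.Root F K φ-hom p (r i))
  (separable : LinearFactors.Separable (FieldProperties.domain K) x+x≈0 (List.map φ p))
  (q₀ q₁ q₂ q₃ q₄ : Polynomial.Poly (Field.commutativeRing F))
  (factorization : Polynomial._≈ₚ_ (Field.commutativeRing F) p
    (polynomialProduct (Field.commutativeRing F) (q₀ ∷ q₁ ∷ q₂ ∷ q₃ ∷ q₄ ∷ [])))
  (q₀-irreducible : Factorization.Irreducible F q₀) (q₀-degree : Polynomial.HasDegree (Field.commutativeRing F) q₀ 1)
  (q₁-irreducible : Factorization.Irreducible F q₁) (q₁-degree : Polynomial.HasDegree (Field.commutativeRing F) q₁ 24)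
  (q₂-irreducible : Factorization.Irreducible F q₂) (q₂-degree : Polynomial.HasDegree (Field.commutativeRing F) q₂ 276)
  (q₃-irreducible : Factorization.Irreducible F q₃) (q₃-degree : Polynomial.HasDegree (Field.commutativeRing F) q₃ 1771)
  (q₄-irreducible : Factorization.Irreducible F q₄) (q₄-degree : Polynomial.HasDegree (Field.commutativeRing F) q₄ 2024)
  where

  open Field K using (_≈_; _+_; 0#)
  open Factorization F using (Irreducible)
  open Polynomial (Field.commutativeRing F) using (HasDegree)
  private
    A = Field.commutativeRing F
    B = Field.commutativeRing K
    module F = Field F
    module K = Field K
    module PF = Polynomial A
    module PK = Polynomial B
    module Q = CommutativeRing PK.polynomialRing
  open RootSums F K x+x≈0 φ-hom as r r-injective r-root
  open LinearFactors D x+x≈0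
  open SubsetSum B x+x≈0
  open RootCount F D x+x≈0 φ-hom
  open MapPolynomial {A = A} {B} φ-hom using (mapₚ; map-cong; map-*)
  open RingHomomorphisms.IsRingHomomorphism A B φ-hom using (1#-homo)
  open FieldEmbedding F K φ-hom using (map-degree)

  _⊢_ : PF.Poly → K.Carrier → Set ℓ₂
  q ⊢ x = FieldEmbedding.Root F K φ-hom q x

  private
    qs : List PF.Poly
    qs = q₀ ∷ q₁ ∷ q₂ ∷ q₃ ∷ q₄ ∷ []

    map-product : ∀ qs → mapₚ (foldr PF._*ₚ_ (PF.C F.1#) qs) PK.≈ₚ product (List.map mapₚ qs)
    map-product []       = PK.coeff-≈ λ { zero → 1#-homo ; (suc _) → K.refl }
    map-product (q ∷ qs) = Q.trans (map-* q (foldr PF._*ₚ_ (PF.C F.1#) qs)) (Q.*-congˡ {mapₚ q} (map-product qs))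

    map-p : mapₚ p PK.≈ₚ product (List.map mapₚ qs)
    map-p = Q.trans (map-cong factorization) (map-product qs)

    separable-factors : Separable (product (List.map mapₚ qs))
    separable-factors = separable-cong {mapₚ p} {product (List.map mapₚ qs)} map-p separable

  root-p : ∀ {m} (s : Fin m → K.Carrier) → (∀ i → p ⊢ s i) → ∀ A → p ⊢ subsetSum s A
  root-p s roots []      = K.trans (PolynomialProperties.eval-congʳ B (mapₚ p) (K.sym (K.+-identityˡ 0#)))
    (K.trans (additive 0# 0#) (x+x≈0 _))
  root-p s roots (u ∷ A) = K.trans (additive _ _) (K.trans (K.+-cong (head u) (root-p (s ∘ suc) (roots ∘ suc) A)) (K.+-identityˡ 0#))
    where
    head : ∀ u → p ⊢ (if u then s zero else 0#)
    head inside  = roots zero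
    -- The empty sum supplies that 0 is a root of `p`.
    head outside = root-p {0} (λ ()) (λ ()) []

  exclusive : ∀ x → AllPairs (λ q q′ → ¬ (q ⊢ x × q′ ⊢ x)) qs
  exclusive x = AllPairs.map⁻ {f = mapₚ} (separable-product (List.map mapₚ qs) separable-factors x)

  exactlyOne : ∀ {x} → p ⊢ x → count (λ q → isRoot? q x) qs ≡ 1
  exactlyOne {x} px = count-unique (λ q → isRoot? q x) (exclusive x)
    (Any.map⁻ {f = mapₚ} (root-product (List.map mapₚ qs)
      (K.trans (K.sym (PolynomialProperties.eval-congˡ B {mapₚ p} {product (List.map mapₚ qs)} x map-p)) px)))

  number : PF.Poly → ℕ → ℕ
  number q k = count (isRoot? q) (sums k)

  -- Pairs of a k-sum and a factor vanishing at it are counted both ways: additivity makes each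
  -- k-sum a root of `p`, and separability allows it exactly one factor.
  total : ∀ k → 24 choose k ≡ number q₀ k ℕ.+ (number q₁ k ℕ.+ (number q₂ k ℕ.+ (number q₃ k ℕ.+ (number q₄ k ℕ.+ 0))))
  total k = begin
    24 choose k                     ≡⟨ length-sums k ⟨
    length (sums k)            ≡⟨ ℕ.*-identityʳ _ ⟨
    length (sums k) ℕ.* 1      ≡⟨ sum-constant (λ x → count (λ q → isRoot? q x) qs)
                                    (All.map⁺ {xs = subsets 24 k} (All.tabulate λ {A} _ → exactlyOne (root-p r p-root A))) ⟨
    sum (List.map (λ x → count (λ q → isRoot? q x) qs) (sums k))
                               ≡⟨ doubleCount (λ x q → isRoot? q x) (sums k) qs ⟩
    sum (List.map (λ q → number q k) qs) ∎
    where open ≡.≡-Reasoning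

  divides-number : ∀ {q d} → Irreducible q → HasDegree q d → ∀ k → d ℕ.∣ number q k
  divides-number {q} irr deg k = degree-∣-count irr (map-degree {q} deg) {sumPolynomial k} (<-wellFounded _) (sumPolynomial-roots k)

  module Total k = Degrees {number q₀ k} {number q₁ k} {number q₂ k} {number q₃ k} {number q₄ k} {24 choose k} (total k) (divides-number q₁-irreducible q₁-degree k)
    (divides-number q₂-irreducible q₂-degree k) (divides-number q₃-irreducible q₃-degree k)
    (divides-number q₄-irreducible q₄-degree k)

  -- The content of P_k being `q` up to a constant, with `q` separable, in terms of sums alone.
  record Stage (q : PF.Poly) (k : ℕ) : Set (b ⊔ ℓ₂) where
    field
      roots    : ∀ A → ∣ A ∣ ≡ k → q ⊢ subsetSum r A
      isSum    : ∀ {x} → q ⊢ x → ∃[ A ] ∣ A ∣ ≡ k × subsetSum r A ≈ x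
      distinct : ∀ A B → ∣ A ∣ ≡ k → ∣ B ∣ ≡ k → subsetSum r A ≈ subsetSum r B → A ≡ B

  sums-roots : ∀ {q k} → number q k ≡ 24 choose k → ∀ A → ∣ A ∣ ≡ k → q ⊢ subsetSum r A
  sums-roots {q} {k} eq A ∣A∣≡k = All.lookup
    (count≡length⇒All (isRoot? q) (sums k) (≡.trans eq (≡.sym (length-sums k))))
    (sum-∈ A ∣A∣≡k)

  -- Since P_k and `q` have the same degree, `allRoots` identifies the list of k-sums with the root
  -- list of `q`, and separability makes the sums distinct. The set `A₀` provides the one common
  -- root that makes `q` divide P_k.
  stage : ∀ {q k d} → Irreducible q → HasDegree q d → Separable (mapₚ q) →
    number q k ≡ 24 choose k → 24 choose k ≡ d → ∃[ A ] ∣ A ∣ ≡ k → Stage q k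
  stage {q} {k} irr deg sep eq eq′ (A₀ , ∣A₀∣≡k) = build
    (allRoots irr (map-degree {q} deg) {sumPolynomial k} (sumPolynomial-roots k) (≡.trans (length-sums k) eq′)
      (lose (sum-∈ A₀ ∣A₀∣≡k) (sums-roots {q} eq A₀ ∣A₀∣≡k)))
    where
    build : ∃[ ss ] sums k ↭ ss × HasRoots (mapₚ q) ss → Stage q k
    build (ss , perm , h) = record
      { roots    = sums-roots {q} eq
      ; isSum    = λ qx → find′ (Any.map⁻ (Any-resp-↭ (↭-sym perm) (hasRoots-root h qx)))
      ; distinct = λ A B ∣A∣≡k ∣B∣≡k e → decide e (allPairs-lookup pairwise (∈-subsets A ∣A∣≡k) (∈-subsets B ∣B∣≡k))
      }
      where
      find′ : ∀ {x} → Any (λ A → subsetSum r A ≈ x) (subsets 24 k) → ∃[ A ] ∣ A ∣ ≡ k × subsetSum r A ≈ x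
      find′ any = let A , A∈ , e = find any in A , All.lookup (subsets-size 24 k) A∈ , e
      pairwise : AllPairs (λ A B → subsetSum r A K.≉ subsetSum r B) (subsets 24 k)
      pairwise = AllPairs.map⁻ {f = subsetSum r} {xs = subsets 24 k} (AllPairs-resp-↭ (λ x≉y y≈x → x≉y (K.sym y≈x)) (↭-sym perm) (separable-distinct sep h))
      decide : ∀ {A B} → subsetSum r A ≈ subsetSum r B →
        A ≡ B ⊎ (subsetSum r A K.≉ subsetSum r B ⊎ subsetSum r B K.≉ subsetSum r A) → A ≡ B
      decide e (inj₁ A≡B)        = A≡B
      decide e (inj₂ (inj₁ A≉B)) = contradiction e A≉B
      decide e (inj₂ (inj₂ B≉A)) = contradiction (K.sym e) B≉A

  -- A root of `q` is a j-sum. If it were also a k-sum, the difference of the two sets would be a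
  -- nonempty zero-sum set of at most j + k points.
  noSums : ∀ {q j k d} → Stage q j → MinimumDistance r d → j ℕ.+ k ℕ.≤ d → j ≢ k → number q k ≡ 0
  noSums {q} {j} {k} s minDist le j≢k = count-none (isRoot? q) (λ any → absurd (find (Any.map⁻ any)))
    where
    absurd : ¬ ∃ λ B → B ∈ subsets 24 k × q ⊢ subsetSum r B
    absurd (B , B∈ , qB) = let A , ∣A∣≡j , e = Stage.isSum s qB in
      j≢k (equalSizes minDist {A} {B} ∣A∣≡j (All.lookup (subsets-size 24 k) B∈) le e)

  separable-∈ : ∀ {q} qs → Separable (product (List.map mapₚ qs)) → q ∈ qs → Separable (mapₚ q)
  separable-∈ (q ∷ qs) sep (here ≡.refl) = separable-*ˡ {mapₚ q} {product (List.map mapₚ qs)} sep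
  separable-∈ (q ∷ qs) sep (there i) = separable-∈ qs (separable-*ʳ {mapₚ q} {product (List.map mapₚ qs)} sep) i

  -- Sums belonging to different factors are never equal, so the conclusion holds vacuously; it has
  -- the form that `extendDistance` asks for.
  apart : ∀ {q q′ j k} → (∀ x → ¬ (q ⊢ x × q′ ⊢ x)) →
    (∀ A → ∣ A ∣ ≡ j → q ⊢ subsetSum r A) → (∀ B → ∣ B ∣ ≡ k → q′ ⊢ subsetSum r B) →
    ∀ A B → ∣ A ∣ ≡ j → ∣ B ∣ ≡ k → subsetSum r A ≈ subsetSum r B → A ≡ B
  apart {q} {q′} excl rq rq′ A B ∣A∣≡j ∣B∣≡k e = contradiction
    (K.trans (PolynomialProperties.eval-congʳ B′ (mapₚ q) (K.sym e)) (rq A ∣A∣≡j) , rq′ B ∣B∣≡k)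
    (excl (subsetSum r B))
    where B′ = K.commutativeRing

  private
    ofSize : ∀ j k → j ℕ.+ k ≡ 24 → ∃[ A ] ∣ A ∣ ≡ j
    ofSize j k eq = let A , _ , ∣A∣≡j , _ = partition {24} Subset.⊤ j k (≡.sym eq) in A , ∣A∣≡j

    singleton : ∀ {m} (s : Fin m → K.Carrier) → ∀ A → ∣ A ∣ ≡ 1 → ∃[ i ] subsetSum s A ≈ s i
    singleton s (inside  ∷ A) eq = zero , K.trans (K.+-congˡ (subsetSum-⊥ (s ∘ suc) A (ℕ.suc-injective eq))) (K.+-identityʳ _)
    singleton s (outside ∷ A) eq = let i , e = singleton (s ∘ suc) A eq in suc i , K.trans (K.+-identityˡ _) e

    factors-separable : ∀ {q} → q ∈ qs → Separable (mapₚ q)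
    factors-separable = separable-∈ qs separable-factors

    distance₀ : MinimumDistance r 0
    distance₀ W ∣W∣≤0 _ = ℕ.n≤0⇒n≡0 ∣W∣≤0

    -- A set of weight 1 has a single root as its sum, which is nonzero; for f this reflects the
    -- constant term t.
    distance₁ : MinimumDistance r 1
    distance₁ = extendDistance 0 1 ≡.refl distance₀ λ A B ∣A∣≡0 ∣B∣≡1 e →
      let i , e′ = singleton r B ∣B∣≡1 in
      contradiction (K.trans (K.sym e′) (K.trans (K.sym e) (subsetSum-⊥ r A ∣A∣≡0))) (r-nonzero i)

    -- The only 0-sum is the empty sum 0. One element is too few for any degree above 1.
    stage₀ : Stage q₀ 0
    stage₀ = stage q₀-irreducible q₀-degree (factors-separable (here ≡.refl))
      (only₀ (n₁≡0 <!) (n₂≡0 <!) (n₃≡0 <!) (n₄≡0 <!)) ≡.refl (ofSize 0 24 ≡.refl)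
      where open Total 0

    stage₁ : Stage q₁ 1
    stage₁ = stage q₁-irreducible q₁-degree (factors-separable (there (here ≡.refl)))
      (only₁ (noSums stage₀ distance₁ ℕ.≤-refl λ ()) (n₂≡0 <!) (n₃≡0 <!) (n₄≡0 <!)) ≡.refl (ofSize 1 23 ≡.refl)
      where open Total 1

    distance₂ : MinimumDistance r 2
    distance₂ = extendDistance 1 1 ≡.refl distance₁ (Stage.distinct stage₁)

    -- To exclude that a sum of two roots is a root, distance 3 would be needed, which is not yet
    -- available. That 24 does not divide 276 decides instead.
    stage₂ : Stage q₂ 2
    stage₂ = stage q₂-irreducible q₂-degree (factors-separable (there (there (here ≡.refl))))
      (pairs (total₁₂ (noSums stage₀ distance₂ ℕ.≤-refl λ ()) (n₃≡0 <!) (n₄≡0 <!))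
        (divides-number q₁-irreducible q₁-degree 2) (divides-number q₂-irreducible q₂-degree 2))
      ≡.refl (ofSize 2 22 ≡.refl)
      where open Total 2

    distance₃ : MinimumDistance r 3
    distance₃ = extendDistance 1 2 ≡.refl distance₂
      (apart {q₁} {q₂} (λ x → exclusive₁₂ (exclusive x)) (Stage.roots stage₁) (Stage.roots stage₂))
      where
      exclusive₁₂ : ∀ {R : PF.Poly → PF.Poly → Set ℓ₂} → AllPairs R qs → R q₁ q₂
      exclusive₁₂ (_ ∷ (e ∷ _) ∷ _) = e

    distance₄ : MinimumDistance r 4
    distance₄ = extendDistance 2 2 ≡.refl distance₃ (Stage.distinct stage₂)

    -- Distance 4 removes the sums of no root and of one root. Removing those of two would take
    -- distance 5, so `triples` has to deal with degree 276 by arithmetic.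
    stage₃ : Stage q₄ 3
    stage₃ = stage q₄-irreducible q₄-degree (factors-separable (there (there (there (there (here ≡.refl))))))
      (triples (total₂₃₄ (noSums stage₀ distance₄ (ℕ.n≤1+n 3) λ ()) (noSums stage₁ distance₄ ℕ.≤-refl λ ()))
        (divides-number q₂-irreducible q₂-degree 3) (divides-number q₃-irreducible q₃-degree 3)
        (divides-number q₄-irreducible q₄-degree 3))
      ≡.refl (ofSize 3 21 ≡.refl)
      where open Total 3

    distance₅ : MinimumDistance r 5
    distance₅ = extendDistance 2 3 ≡.refl distance₄
      (apart {q₂} {q₄} (λ x → exclusive₂₄ (exclusive x)) (Stage.roots stage₂) (Stage.roots stage₃))
      where
      exclusive₂₄ : ∀ {R : PF.Poly → PF.Poly → Set ℓ₂} → AllPairs R qs → R q₂ q₄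
      exclusive₂₄ (_ ∷ _ ∷ (_ ∷ e ∷ _) ∷ _) = e

    distance₆ : MinimumDistance r 6
    distance₆ = extendDistance 3 3 ≡.refl distance₅ (Stage.distinct stage₃)

    -- Distance 6 leaves degrees 1771 and 2024. There is no `Stage` here: 24 choose 4 is 10626 = 6 ·
    -- 1771, so sums of four roots do repeat.
    roots₄ : ∀ A → ∣ A ∣ ≡ 4 → q₃ ⊢ subsetSum r A
    roots₄ = sums-roots {q₃} (quadruples
      (total₃₄ (noSums stage₀ distance₆ (ℕ.m≤m+n 4 2) λ ()) (noSums stage₁ distance₆ (ℕ.n≤1+n 5) λ ())
        (noSums stage₂ distance₆ ℕ.≤-refl λ ()))
      (divides-number q₃-irreducible q₃-degree 4) (divides-number q₄-irreducible q₄-degree 4))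
      where open Total 4

  -- The last step of this kind: weight 8 = 4 + 4 would require distinct sums of four roots, and
  -- octads do exist.
  distance₇ : MinimumDistance r 7
  distance₇ = extendDistance 3 4 ≡.refl distance₆
    (apart {q₄} {q₃} (λ x (e , e′) → exclusive₃₄ (exclusive x) (e′ , e)) (Stage.roots stage₃) roots₄)
    where
    exclusive₃₄ : ∀ {R : PF.Poly → PF.Poly → Set ℓ₂} → AllPairs R qs → R q₃ q₄
    exclusive₃₄ (_ ∷ _ ∷ _ ∷ (e ∷ _) ∷ _) = e

  private
    -- The splitting provides a root list of `q₃` in K, of length equal to its degree, into which
    -- distinct roots are injected.
    bound : ∀ {ss} → SplitOff q₃-irreducible ss → ∀ {xs} → AllPairs K._≉_ xs → All (q₃ ⊢_) xs → length xs ℕ.≤ 1771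
    bound split {xs} xs≉ rs = ≡.subst (length xs ℕ.≤_)
      (hasRoots-length (SplitOff.roots₂ split) (map-degree {q₃} q₃-degree))
      (pigeonhole K.commutativeRing xs xs≉ (All.map (hasRoots-root (SplitOff.roots₂ split)) rs))

    split₄ : ∀ A → ∣ A ∣ ≡ 4 → SplitOff q₃-irreducible (sums 4)
    split₄ A ∣A∣≡4 = splitOff q₃-irreducible {sumPolynomial 4} (sumPolynomial-roots 4)
      (lose (sum-∈ A ∣A∣≡4) (roots₄ A ∣A∣≡4))

  module Through (x : Fin 24) where

    through : Subset 23 → Subset 24
    through A = insertAt A x inside

    through-size : ∀ A → ∣ A ∣ ≡ 3 → ∣ through A ∣ ≡ 4
    through-size A ∣A∣≡3 = ≡.trans (∣insertAt-inside∣ A x) (≡.cong suc ∣A∣≡3)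

    -- The common point x cancels, so the two 4-sets differ in at most 6 points, within the reach of
    -- `distance₇`.
    through-injective : ∀ A B → ∣ A ∣ ≡ 3 → ∣ B ∣ ≡ 3 → subsetSum r (through A) ≈ subsetSum r (through B) → A ≡ B
    through-injective A B ∣A∣≡3 ∣B∣≡3 e = ∣△∣≡0 A B (≡.trans (≡.sym (∣insertAt-△∣ A B x))
      (distance₇ (through A △ through B)
        (≡.subst (ℕ._≤ 7) (≡.sym (∣insertAt-△∣ A B x)) (ℕ.m≤n⇒m≤1+n
          (≡.subst (∣ A △ B ∣ ℕ.≤_) (≡.cong₂ ℕ._+_ ∣A∣≡3 ∣B∣≡3) (∣△∣≤ A B))))
        (△-zeroSum r (through A) (through B) e)))

    -- Equality in K is decidable, so the list can be searched. If the search failed, the sum of Q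
    -- and the sums of the listed sets would be 1772 distinct roots of `q₃`.
    search : ∀ As → Unique As → All (λ A → ∣ A ∣ ≡ 3) As → length As ≡ 1771 →
      ∀ Q → ∣ Q ∣ ≡ 4 → ∃[ A ] ∣ A ∣ ≡ 3 × subsetSum r (through A) ≈ subsetSum r Q
    search As As-unique sizes length-As Q ∣Q∣≡4 =
      decide (Any.any? (λ A → subsetSum r (through A) ≟ subsetSum r Q) As)
      where
      open IntegralDomain D using (_≟_)
      candidates : List K.Carrier
      candidates = List.map (subsetSum r ∘ through) As

      decide : Dec (Any (λ A → subsetSum r (through A) ≈ subsetSum r Q) As) →
        ∃[ A ] ∣ A ∣ ≡ 3 × subsetSum r (through A) ≈ subsetSum r Q
      decide (yes any) = let A , A∈ , e = find any in A , All.lookup sizes A∈ , e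
      decide (no ¬any) = contradiction
        (bound (split₄ Q ∣Q∣≡4) {subsetSum r Q ∷ candidates}
          (All.map⁺ {xs = As} (All.tabulate λ A∈ e → ¬any (lose A∈ (K.sym e))) ∷
            AllPairs.map⁺ (allPairs-∈ As-unique λ {A} {B} A∈ B∈ A≢B e →
              A≢B (through-injective A B (All.lookup sizes A∈) (All.lookup sizes B∈) e)))
          (roots₄ Q ∣Q∣≡4 ∷ All.map⁺ {xs = As} (All.map (λ {A} ∣A∣≡3 → roots₄ (through A) (through-size A ∣A∣≡3)) sizes)))
        (ℕ.<⇒≱ (s≤s (ℕ.≤-reflexive (≡.sym (≡.trans (List.length-map (subsetSum r ∘ through) As) length-As)))))

  -- The 4-sets through x have 23 choose 3 = 1771 different sums, as many as q₃ has
  -- roots.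
  tetrad : Tetrads r
  tetrad Q ∣Q∣≡4 x =
    let A , ∣A∣≡3 , e = search (subsets 23 3) (subsets-unique 23 3) (subsets-size 23 3) (length-subsets 23 3) Q ∣Q∣≡4 in
    through A , lookup⇒[]= x (through A) (insertAt-lookup A x inside) , through-size A ∣A∣≡3 , e
    where open Through x

  steinerSystem : IsSteinerSystem 5 8 24 (Octad r) × HasCardinality (Octad r) 759
  steinerSystem = Octads.octads-isSteinerSystem B x+x≈0 _≟_ r distance₇ tetrad ,
    Octads.octads-cardinality B x+x≈0 _≟_ r distance₇ tetrad
    where open IntegralDomain D using (_≟_)

-- Trinomials and their splitting fields

lookup-injective : {A : Set a} {R : A → A → Set ℓ} {xs : List A} → (∀ {x y} → R x y → R y x) →
  AllPairs (λ x y → ¬ R x y) xs → ∀ {i j} → R (List.lookup xs i) (List.lookup xs j) → i ≡ j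
lookup-injective sym (x≉ ∷ _) {zero}  {zero}  e = ≡.refl
lookup-injective sym (x≉ ∷ _) {zero}  {suc j} e = contradiction e (All.lookup x≉ (∈.∈-lookup j))
lookup-injective sym (x≉ ∷ _) {suc i} {zero}  e = contradiction (sym e) (All.lookup x≉ (∈.∈-lookup i))
lookup-injective sym (_ ∷ rs) {suc i} {suc j} e = ≡.cong suc (lookup-injective sym rs e)

-- A record, so that comparing two instances does not unfold X ^ n.
record IsTrinomial (R : CommutativeRing c ℓ) (n : ℕ) (t₀ : CommutativeRing.Carrier R)
                   (p : Polynomial.Poly R) : Set ℓ where
  constructor isTrinomial
  open Polynomial R
  open RawSemiringDefs (Semiring.rawSemiring (CommutativeRing.semiring polynomialRing)) using (_^_)
  field
    expansion : p ≈ₚ X ^ n +ₚ X +ₚ C t₀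

module TrinomialCoefficients (R : CommutativeRing c ℓ) (n : ℕ) (t₀ : CommutativeRing.Carrier R) where

  open CommutativeRing R hiding (zero)
  open Polynomial R
  open PowersOfX R
  open RawSemiringDefs (Semiring.rawSemiring (CommutativeRing.semiring polynomialRing)) using (_^_)

  module _ {p} (p-trinomial : IsTrinomial R n t₀ p) where

    open IsTrinomial p-trinomial using (expansion)

    coeff-trinomial : ∀ m → coeff p m ≈ coeff (X ^ n) m + coeff X m + coeff (C t₀) m
    coeff-trinomial m = trans (at expansion m) (trans (coeff-+ (X ^ n +ₚ X) (C t₀) m) (+-congʳ (coeff-+ (X ^ n) X m)))

    coeff-high : ∀ m → 1 ℕ.< m → coeff p m ≈ coeff (X ^ n) m
    coeff-high m@(suc (suc _)) _ = trans (coeff-trinomial m) (trans (+-identityʳ _) (+-identityʳ _))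
    coeff-high (suc zero) (s≤s ())

    module _ (1<n : 1 ℕ.< n) where

      coeff-leading : coeff p n ≈ 1#
      coeff-leading = trans (coeff-high n 1<n) (coeff-X^n n)

      coeff-higher : ∀ m → n ℕ.< m → coeff p m ≈ 0#
      coeff-higher m n<m = trans (coeff-high m (ℕ.<-trans 1<n n<m)) (coeff-X^m (ℕ.<⇒≢ n<m))

      coeff-constant : coeff p 0 ≈ t₀
      coeff-constant = trans (coeff-trinomial 0) (trans (+-congʳ (trans (+-identityʳ _)
        (coeff-X^m λ n≡0 → ℕ.n≮0 (≡.subst (1 ℕ.<_) n≡0 1<n)))) (+-identityˡ t₀))

module TrinomialDerivative {A : CommutativeRing a ℓ₁} {B : CommutativeRing b ℓ₂}
  {φ : CommutativeRing.Carrier A → CommutativeRing.Carrier B}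
  (φ-hom : RingHomomorphisms.IsRingHomomorphism A B φ)
  (x+x≈0 : HasCharacteristic2 B) where

  private module B = CommutativeRing B
  open Polynomial A
  open Characteristic2 {A = A} {B} φ-hom x+x≈0
  open Exp (CommutativeRing.semiring polynomialRing) using (_^_; ^-homo-*)
  open import Relation.Binary.Reasoning.Setoid B.setoid

  -- For even n the power X ^ n is a square and has derivative zero, so only X contributes.
  slopeAt-trinomial : ∀ {p} n m t₀ → n ≡ m ℕ.+ m → IsTrinomial A n t₀ p → ∀ x → slopeAt p x B.≈ B.1#
  slopeAt-trinomial {p} n m t₀ ≡.refl (isTrinomial p≈) x = begin
    slopeAt p x                                ≈⟨ slopeAt-cong {p} {X ^ n +ₚ X +ₚ C t₀} x p≈ ⟩
    slopeAt (X ^ n +ₚ X +ₚ C t₀) x             ≈⟨ slopeAt-+ (X ^ n +ₚ X) (C t₀) x ⟩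
    slopeAt (X ^ n +ₚ X) x B.+ slopeAt (C t₀) x  ≈⟨ B.+-congʳ (slopeAt-+ (X ^ n) X x) ⟩
    slopeAt (X ^ n) x B.+ slopeAt X x B.+ slopeAt (C t₀) x
      ≈⟨ B.+-cong (B.+-cong (slopeAt-square {X ^ n} (X ^ m) x (^-homo-* X m m)) (slopeAt-X x)) (slopeAt-C t₀ x) ⟩
    B.0# B.+ B.1# B.+ B.0#                     ≈⟨ B.+-identityʳ _ ⟩
    B.0# B.+ B.1#                              ≈⟨ B.+-identityˡ B.1# ⟩
    B.1#                                       ∎

record HasLinearTerm (R : CommutativeRing c ℓ) (p : Polynomial.Poly R) : Set ℓ where
  constructor hasLinearTerm
  field
    coeff-1≉0 : ¬ (CommutativeRing._≈_ R (Polynomial.coeff R p 1) (CommutativeRing.0# R))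

module Trinomial (F : Field a ℓ ℓ₁) (t₀ : Field.Carrier F)
  (1+1≈0 : Field._≈_ F (Field._+_ F (Field.1# F) (Field.1# F)) (Field.0# F))
  (t₀≉0 : ¬ Field._≈_ F t₀ (Field.0# F))
  (f₀ : Polynomial.Poly (Field.commutativeRing F)) 
  (f₀-trinomial : IsTrinomial (Field.commutativeRing F) 24 t₀ f₀)
  (K : Field b ℓ₂ ℓ₁′) (S : SplittingField F K f₀)
  where

  private
    A = Field.commutativeRing F
    module F = Field F
    module K = Field K
    module PF = Polynomial A
    module PK = Polynomial K.commutativeRing
    module P = CommutativeRing PF.polynomialRing
    module Q = CommutativeRing PK.polynomialRing
  open Polynomial A using (Poly; _≈ₚ_)
  open RawSemiringDefs (Semiring.rawSemiring P.semiring) using (_∣_)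
  open SplittingField S
  open RingHomomorphisms.IsRingHomomorphism A K.commutativeRing embed-isHomomorphism
  open FieldEmbedding F K embed-isHomomorphism
  open MapPolynomial {A = A} {K.commutativeRing} embed-isHomomorphism
  open FieldProperties K using (1≉0) renaming (domain to D)

  x+x≈0 : ∀ x → x K.+ x K.≈ K.0#
  x+x≈0 x = begin
    x K.+ x                        ≈⟨ K.+-cong (K.*-identityˡ x) (K.*-identityˡ x) ⟨
    K.1# K.* x K.+ K.1# K.* x      ≈⟨ K.distribʳ x K.1# K.1# ⟨
    (K.1# K.+ K.1#) K.* x
      ≈⟨ K.*-congʳ (K.+-cong 1#-homo 1#-homo) ⟨
    (embed F.1# K.+ embed F.1#) K.* x  ≈⟨ K.*-congʳ (+-homo F.1# F.1#) ⟨
    embed (F.1# F.+ F.1#) K.* x    ≈⟨ K.*-congʳ (K.trans (⟦⟧-cong 1+1≈0) 0#-homo) ⟩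
    K.0# K.* x                     ≈⟨ K.zeroˡ x ⟩
    K.0#                           ∎
    where open import Relation.Binary.Reasoning.Setoid K.setoid

  open LinearFactors D x+x≈0
  open Characteristic2 {A = A} {K.commutativeRing} embed-isHomomorphism x+x≈0

  private
    1<24 : 1 ℕ.< 24
    1<24 = s≤s (s≤s z≤n)

  coeff-f₀-24 : PF.coeff f₀ 24 F.≈ F.1#
  coeff-f₀-24 = TrinomialCoefficients.coeff-leading F.commutativeRing 24 t₀ {f₀} f₀-trinomial 1<24

  coeff-f₀-higher : ∀ m → 24 ℕ.< m → PF.coeff f₀ m F.≈ F.0#
  coeff-f₀-higher m 24<m = TrinomialCoefficients.coeff-higher F.commutativeRing 24 t₀ {f₀} f₀-trinomial 1<24 m 24<m

  coeff-f₀-0 : PF.coeff f₀ 0 F.≈ t₀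
  coeff-f₀-0 = TrinomialCoefficients.coeff-constant F.commutativeRing 24 t₀ {f₀} f₀-trinomial 1<24

  lower : Vec F.Carrier 24
  lower = Truncation.truncate A 24 f₀

  f₀-monic : f₀ ≈ₚ MonicDivision.monic A lower
  f₀-monic = Truncation.monic-truncate A 24 f₀ coeff-f₀-24 coeff-f₀-higher

  f₀-degree : PK.HasDegree (mapₚ f₀) 24
  f₀-degree = map-degree {f₀} ((λ e → FieldProperties.1≉0 F (F.trans (F.sym coeff-f₀-24) e)) , coeff-f₀-higher)

  f₀-separable : Separable (mapₚ f₀)
  f₀-separable x _ e = 1≉0 (K.trans
    (K.sym (TrinomialDerivative.slopeAt-trinomial {A = F.commutativeRing} {K.commutativeRing} embed-isHomomorphism x+x≈0
      {f₀} 24 12 t₀ ≡.refl f₀-trinomial x)) e)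

  root-nonzero : ∀ {x} → IsRoot x → x K.≉ K.0#
  root-nonzero {x} fx≈0 x≈0 = t₀≉0 (kernel (begin
    embed t₀              ≈⟨ ⟦⟧-cong coeff-f₀-0 ⟨
    embed (PF.coeff f₀ 0) ≈⟨ coeff-map f₀ 0 ⟨
    PK.coeff (mapₚ f₀) 0  ≈⟨ PowersOfX.eval-0 K.commutativeRing (mapₚ f₀) ⟨
    PK.eval (mapₚ f₀) K.0# ≈⟨ PolynomialProperties.eval-congʳ K.commutativeRing (mapₚ f₀) x≈0 ⟨
    PK.eval (mapₚ f₀) x   ≈⟨ fx≈0 ⟩
    K.0#                  ∎))
    where open import Relation.Binary.Reasoning.Setoid K.setoid

  rootList : HasRoots (mapₚ f₀) roots
  rootList = hasRoots leading leading≉0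
    (Q.trans splits (Q.*-congˡ {PK.C leading} (factors roots)))
    where
    factors : ∀ ss → foldr (λ s p → (PK.X Q.- PK.C s) PK.*ₚ p) Q.1# ss PK.≈ₚ rootProduct ss
    factors []       = Q.refl
    factors (s ∷ ss) = Q.*-cong {PK.X Q.- PK.C s} {linear s} (PK.coeff-≈ λ
      { zero → K.trans (K.+-identityˡ _) (x+y≈0⇒x≈y (K.-‿inverseˡ s)) ; (suc _) → K.refl }) (factors ss)
    -- Otherwise the image of `f₀` would be zero, against its coefficient 1 in degree 24.
    leading≉0 : leading K.≉ K.0#
    leading≉0 e = proj₁ f₀-degree (PK.at (Q.trans splits (Q.trans
      (Q.*-congʳ {_} {PK.C leading} {[]} (PK.coeff-≈ λ { zero → e ; (suc _) → K.refl })) (Q.zeroˡ (foldr (λ s p → (PK.X Q.- PK.C s) PK.*ₚ p) Q.1# roots)))) 24)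

  -- The degree gives the length 24 of the list of roots, and separability makes its entries
  -- distinct, so indexing is bijective.
  rootEnumeration : SplittingField.RootEnumeration S 24
  rootEnumeration = enumerate (hasRoots-length rootList f₀-degree)
    where
    position : ∀ {x ss} → Any (K._≈ x) ss → ∃[ i ] List.lookup ss i K.≈ x
    position any = Any.index any , Any.lookup-index any

    enumerate : ∀ {n} → length roots ≡ n → RootEnumeration n
    enumerate ≡.refl = record
      { to        = λ i → List.lookup roots i ,
          root-hasRoots rootList (lose (∈.∈-lookup {xs = roots} i) K.refl)
      ; cong      = λ { ≡.refl → K.refl }
      ; bijective = lookup-injective K.sym (separable-distinct f₀-separable rootList) ,
          λ (x , fx≈0) → let i , e = position (hasRoots-root rootList fx≈0) in i , λ { ≡.refl → e }
      }

  module _ (L₀ : Poly) (L₀-minimal : TwoPolynomial.IsMinimal2Polynomial F f₀ L₀ 12)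
    (L₀-linearTerm : HasLinearTerm A L₀)
    (L₀-factors : Factorization.HasIrreducibleFactorDegrees F L₀ (1 ∷ 24 ∷ 276 ∷ 1771 ∷ 2024 ∷ []))
    (e : SplittingField.RootEnumeration S 24) where

    open TwoPolynomial.IsMinimal2Polynomial L₀-minimal using (monic) renaming (divides to f₀∣L₀)
    open TwoPolynomialProperties F {K.commutativeRing} embed-isHomomorphism x+x≈0 {L₀} monic

    -- The derivative is constant, hence everywhere equal to its value at 0, the linear coefficient.
    L₀-separable : Separable (mapₚ L₀)
    L₀-separable x _ L₀′x≈0 = HasLinearTerm.coeff-1≉0 L₀-linearTerm (kernel (begin
      embed (PF.coeff L₀ 1)   ≈⟨ coeff-map L₀ 1 ⟨
      PK.coeff (mapₚ L₀) 1    ≈⟨ PowersOfX.derivative-0 K.commutativeRing (mapₚ L₀) ⟨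
      slopeAt L₀ K.0#         ≈⟨ constantDerivative K.0# x ⟩
      slopeAt L₀ x            ≈⟨ L₀′x≈0 ⟩
      K.0#                    ∎))
      where open import Relation.Binary.Reasoning.Setoid K.setoid

    r : Fin 24 → K.Carrier
    r i = proj₁ (Bijection.to e i)

    root-f₀ : ∀ i → PK.eval (mapₚ f₀) (r i) K.≈ K.0#
    root-f₀ i = proj₂ (Bijection.to e i)

    root-monic : ∀ i → PK.eval (mapₚ (MonicDivision.monic A lower)) (r i) K.≈ K.0#
    root-monic i = K.trans (value-cong {MonicDivision.monic A lower} {f₀} (r i) (P.sym f₀-monic)) (root-f₀ i)

    root-L₀ : ∀ i → PK.eval (mapₚ L₀) (r i) K.≈ K.0#
    root-L₀ i = go f₀∣L₀
      where
      go : f₀ ∣ L₀ → PK.eval (mapₚ L₀) (r i) K.≈ K.0#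
      go (s , sf≈L) = K.trans (value-cong {L₀} {s PF.*ₚ f₀} (r i) (P.sym sf≈L))
        (K.trans (value-* s f₀ (r i)) (K.trans (K.*-congˡ (root-f₀ i)) (K.zeroʳ _)))

    rootsFormSteinerSystem : IsSteinerSystem 5 8 24 (SplittingField.ZeroSum S e 8) × HasCardinality (SplittingField.ZeroSum S e 8) 759
    rootsFormSteinerSystem = go L₀-factors
      where
      go : Factorization.HasIrreducibleFactorDegrees F L₀ (1 ∷ 24 ∷ 276 ∷ 1771 ∷ 2024 ∷ []) →
        IsSteinerSystem 5 8 24 (SplittingField.ZeroSum S e 8) × HasCardinality (SplittingField.ZeroSum S e 8) 759
      go (q₀ ∷ q₁ ∷ q₂ ∷ q₃ ∷ q₄ ∷ [] , eq , (i₀ , d₀) ∷ (i₁ , d₁) ∷ (i₂ , d₂) ∷ (i₃ , d₃) ∷ (i₄ , d₄) ∷ []) =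
        FactoredSums.steinerSystem F K x+x≈0 embed-isHomomorphism lower r (Bijection.injective e) root-monic
          (λ i → root-nonzero (root-f₀ i)) L₀ additive root-L₀ L₀-separable
          q₀ q₁ q₂ q₃ q₄ eq i₀ d₀ i₁ d₁ i₂ d₂ i₃ d₃ i₄ d₄

-- Specialisation to 𝔽₂(t) and the given polynomials

module 𝔽₂[t] = Polynomial (IntegralDomain.commutativeRing 𝔽₂)

t≉0 : Field._≉_ 𝔽₂⟨t⟩ t (Field.0# 𝔽₂⟨t⟩)
t≉0 (FractionField.cross e) with () ← 𝔽₂[t].at e 1

𝔽₂⟨t⟩-1+1≈0 : let open Field 𝔽₂⟨t⟩ in 1# + 1# ≈ 0#
𝔽₂⟨t⟩-1+1≈0 = FractionField.cross (𝔽₂[t].coeff-≈ λ { zero → ≡.refl ; (suc n) → ≡.refl })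

L-linearTerm : HasLinearTerm (Field.commutativeRing 𝔽₂⟨t⟩) L
L-linearTerm = hasLinearTerm nonzero
  where
  nonzero : ¬ _
  -- The linear coefficient of `L` is t^24 + t; after clearing denominators its coefficient at t is
  -- 1.
  nonzero e with () ← 𝔽₂[t].at (FractionField.cross-≈ e) 1

-- By evaluation: comparing f with its definition syntactically would expand
-- X ^ 24 without sharing.
f-trinomial : IsTrinomial (Field.commutativeRing 𝔽₂⟨t⟩) 24 t f
f-trinomial = isTrinomial (toWitness {a? = IntegralDomain._≟_ (polynomialDomain (FieldProperties.domain 𝔽₂⟨t⟩)) f _} _)

lemma23 : Factorization.Irreducible 𝔽₂⟨t⟩ f →
    TwoPolynomial.IsMinimal2Polynomial 𝔽₂⟨t⟩ f L 12 →
    Factorization.HasIrreducibleFactorDegrees 𝔽₂⟨t⟩ L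
    (1 ∷ 24 ∷ 276 ∷ 1771 ∷ 2024 ∷ []) →
    ∀ {c ℓ₁ ℓ₂ : Level} (K : Field c ℓ₁ ℓ₂) (S : SplittingField 𝔽₂⟨t⟩ K f) →
    let open SplittingField S in
    RootEnumeration 24 ×
    ((e : RootEnumeration 24) →
    IsSteinerSystem 5 8 24 (ZeroSum e 8) ×
    HasCardinality (ZeroSum e 8) 759)
lemma23 _ L-minimal L-factors K S =
  Trinomial.rootEnumeration 𝔽₂⟨t⟩ t 𝔽₂⟨t⟩-1+1≈0 t≉0 f f-trinomial K S ,
  Trinomial.rootsFormSteinerSystem 𝔽₂⟨t⟩ t 𝔽₂⟨t⟩-1+1≈0 t≉0 f f-trinomial K S L L-minimal L-linearTerm L-factors
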